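{- Let $q$ be a prime power with $q\equiv3\pmod4$, $G=\mathrm{SL}_2(\mathbb F_q)$, and $S$ the union of the conjugacy classes in $G$ of $\begin{pmatrix}1&0\\1&1\end{pmatrix}$ and $\begin{pmatrix}1&0\\-1&1\end{pmatrix}$. Let $\sigma_q$ be the automorphism of $G$ induced by conjugation by either of the matrices $\begin{pmatrix}0&1\\1&0\end{pmatrix}$, $\begin{pmatrix}0&1\\-1&0\end{pmatrix}$ in $\mathrm{GL}_2(\mathbb F_q)$. Then the graphs $C_\Sigma(G,S)$, $C(G,S)^{\sigma_q}$ and $C_\Sigma(G,S)^{\sigma_q}$ are Ramanujan graphs.
   Context: For a group $G$, subset $S$ and automorphism $\sigma$: $C_\Sigma(G,S)$ has vertex set $G$ and an edge from $x$ to $x^{ -1}s$ for each $s\in S$; $C(G,S)^\sigma$ has an edge from $x$ to $\sigma(xs)$; $C_\Sigma(G,S)^\sigma$ has an edge from $x$ to $\sigma(x^{ -1}s)$. A $k$-regular undirected graph is Ramanujan if every eigenvalue $\lambda$ of its adjacency matrix with $|\lambda|\ne k$ satisfies $|\lambda|\le2\sqrt{k-1}$. -}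

module Defs where

open import Algebra.Apartness.Bundles using (HeytingCommutativeRing; HeytingField)
open import Algebra.Bundles using (CommutativeRing; Group)
open import Algebra.Morphism.Structures using (module GroupMorphisms)
open import Data.Bool.Base using (if_then_else_)
open import Data.Fin.Base using (Fin; zero; suc)
import Data.Fin.Properties as Fin
open import Data.Integer.Base as ℤ using (+_; +[1+_]; -[1+_]; +<+)
import Data.Integer.Properties as ℤ
open import Data.Nat.Base as ℕ using (ℕ; zero; suc)
open import Data.Nat.Coprimality using (Coprime)
open import Data.Nat.Primality using (Prime)
import Data.Nat.Properties as ℕ
open import Data.Nat.Tactic.RingSolver using (solve-∀)
open import Data.Product.Base using (Σ; ∃; ∃₂; _×_; _,_; proj₁; proj₂)
open import Data.Product.Function.NonDependent.Setoid using (_×-inverse_)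
open import Data.Product.Relation.Binary.Pointwise.NonDependent using (_×ₛ_; Pointwise-≡↔≡)
open import Data.Rational.Base as ℚ using (ℚ; mkℚ; 0ℚ; 1ℚ; ½)
import Data.Rational.Properties as ℚ
open import Data.Rational.Unnormalised.Base as ℚᵘ using (mkℚᵘ)
import Data.Rational.Unnormalised.Properties as ℚᵘ
import Data.Rational.Solver as ℚ-Solver
open import Data.Sum.Base using (_⊎_; inj₁; inj₂)
open import Data.Vec.Functional using (Vector; foldr)
open import Function.Base using (_∘_; id; const)
open import Function.Bundles using (Inverse)
import Function.Construct.Composition as Comp
import Function.Construct.Symmetry as Symm
open import Level using (0ℓ; _⊔_) renaming (suc to lsuc)
open import Relation.Binary.Bundles using (Setoid)
open import Relation.Binary.Core using (Rel)
import Relation.Binary.Definitions as B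
open import Relation.Binary.PropositionalEquality as ≡ using (_≡_; refl; cong; cong₂; subst; subst₂)
import Relation.Binary.Reasoning.Setoid as ≈-Reasoning
open import Relation.Nullary using (¬_; Dec; yes; no; does; contradiction)
import Relation.Nullary.Decidable as Dec
open import Relation.Unary using (Pred; Decidable)

IsCauchy : (ℕ → ℚ) → Set
IsCauchy x = ∀ ε → 0ℚ ℚ.< ε →
  ∃ λ N → ∀ m n → N ℕ.≤ m → N ℕ.≤ n → ℚ.∣ x m ℚ.- x n ∣ ℚ.< ε

record ℝ : Set where
  constructor mkℝ
  field
    approx : ℕ → ℚ
    cauchy : IsCauchy approx

open ℝ

infix 4 _≃_ _≤_

_≃_ : Rel ℝ 0ℓ
x ≃ y = ∀ ε → 0ℚ ℚ.< ε →
  ∃ λ N → ∀ n → N ℕ.≤ n → ℚ.∣ approx x n ℚ.- approx y n ∣ ℚ.< ε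

_≤_ : Rel ℝ 0ℓ
x ≤ y = ∀ ε → 0ℚ ℚ.< ε →
  ∃ λ N → ∀ n → N ℕ.≤ n → approx x n ℚ.< approx y n ℚ.+ ε

module Cauchy where
  half : ∀ {ε} → 0ℚ ℚ.< ε → 0ℚ ℚ.< ½ ℚ.* ε
  half {ε} 0<ε = subst (ℚ._< ½ ℚ.* ε) (ℚ.*-zeroʳ ½) (ℚ.*-monoʳ-<-pos ½ 0<ε)

  half+half : ∀ ε → ½ ℚ.* ε ℚ.+ ½ ℚ.* ε ≡ ε
  half+half ε = ≡.trans (≡.sym (ℚ.*-distribʳ-+ ε ½ ½)) (ℚ.*-identityˡ ε)

  open ℚ-Solver.+-*-Solver using (_:+_; _:*_; _:-_; :-_; _:=_)
    renaming (solve to ℚ-solve)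

  +-diff : ∀ a b c d → (a ℚ.+ b) ℚ.- (c ℚ.+ d) ≡ (a ℚ.- c) ℚ.+ (b ℚ.- d)
  +-diff = ℚ-solve 4 (λ a b c d → (a :+ b) :- (c :+ d) := (a :- c) :+ (b :- d)) refl

  *-diff : ∀ a b c d → a ℚ.* b ℚ.- c ℚ.* d ≡ a ℚ.* (b ℚ.- d) ℚ.+ (a ℚ.- c) ℚ.* d
  *-diff = ℚ-solve 4 (λ a b c d → a :* b :- c :* d := a :* (b :- d) :+ (a :- c) :* d) refl

  split : ∀ a b → a ≡ b ℚ.+ (a ℚ.- b)
  split = ℚ-solve 2 (λ a b → a := b :+ (a :- b)) refl

  constCauchy : ∀ p → IsCauchy (const p)
  constCauchy p ε 0<ε = 0 , λ _ _ _ _ →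
    subst (ℚ._< ε) (≡.sym (cong ℚ.∣_∣ (ℚ.+-inverseʳ p))) 0<ε

  +-cauchy : ∀ x y → IsCauchy x → IsCauchy y → IsCauchy (λ n → x n ℚ.+ y n)
  +-cauchy x y cx cy ε 0<ε with cx _ (half 0<ε) | cy _ (half 0<ε)
  ... | M , p | N , q = M ℕ.⊔ N , λ m n m≥ n≥ → begin-strict
      ℚ.∣ (x m ℚ.+ y m) ℚ.- (x n ℚ.+ y n) ∣
        ≡⟨ cong ℚ.∣_∣ (+-diff (x m) (y m) (x n) (y n)) ⟩
      ℚ.∣ (x m ℚ.- x n) ℚ.+ (y m ℚ.- y n) ∣
        ≤⟨ ℚ.∣p+q∣≤∣p∣+∣q∣ (x m ℚ.- x n) (y m ℚ.- y n) ⟩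
      ℚ.∣ x m ℚ.- x n ∣ ℚ.+ ℚ.∣ y m ℚ.- y n ∣
        <⟨ ℚ.+-mono-< (p m n (ℕ.m⊔n≤o⇒m≤o M N m≥) (ℕ.m⊔n≤o⇒m≤o M N n≥))
                      (q m n (ℕ.m⊔n≤o⇒n≤o M N m≥) (ℕ.m⊔n≤o⇒n≤o M N n≥)) ⟩
      ½ ℚ.* ε ℚ.+ ½ ℚ.* ε ≡⟨ half+half ε ⟩
      ε ∎
    where open ℚ.≤-Reasoning

  bound : ∀ {x} → IsCauchy x →
    ∃₂ λ N B → 0ℚ ℚ.< B × (∀ n → N ℕ.≤ n → ℚ.∣ x n ∣ ℚ.≤ B)
  bound {x} cx with cx 1ℚ (ℚ.positive⁻¹ 1ℚ)
  ... | N , p = N , ℚ.∣ x N ∣ ℚ.+ 1ℚ , 0<B , λ n n≥ → begin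
      ℚ.∣ x n ∣                          ≡⟨ cong ℚ.∣_∣ (split (x n) (x N)) ⟩
      ℚ.∣ x N ℚ.+ (x n ℚ.- x N) ∣        ≤⟨ ℚ.∣p+q∣≤∣p∣+∣q∣ (x N) (x n ℚ.- x N) ⟩
      ℚ.∣ x N ∣ ℚ.+ ℚ.∣ x n ℚ.- x N ∣    ≤⟨ ℚ.+-monoʳ-≤ ℚ.∣ x N ∣ (ℚ.<⇒≤ (p n N n≥ ℕ.≤-refl)) ⟩
      ℚ.∣ x N ∣ ℚ.+ 1ℚ                   ∎
    where
    open ℚ.≤-Reasoning
    0<B : 0ℚ ℚ.< ℚ.∣ x N ∣ ℚ.+ 1ℚ
    0<B = ℚ.+-mono-≤-< (ℚ.0≤∣p∣ (x N)) (ℚ.positive⁻¹ 1ℚ)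

  scale : ∀ {B ε} → 0ℚ ℚ.< B → 0ℚ ℚ.< ε → ∃ λ δ → 0ℚ ℚ.< δ × B ℚ.* δ ≡ ε
  scale {B} {ε} 0<B 0<ε = δ , 0<δ , (begin
      B ℚ.* (ℚ.1/ B ℚ.* ε)   ≡⟨ ℚ.*-assoc B (ℚ.1/ B) ε ⟨
      B ℚ.* ℚ.1/ B ℚ.* ε     ≡⟨ cong (ℚ._* ε) (ℚ.*-inverseʳ B) ⟩
      1ℚ ℚ.* ε               ≡⟨ ℚ.*-identityˡ ε ⟩
      ε                      ∎)
    where
    open ≡.≡-Reasoning
    instance
      B-pos : ℚ.Positive B
      B-pos = ℚ.positive 0<B
      B≢0 : ℚ.NonZero B
      B≢0 = ℚ.pos⇒nonZero B
      ε-pos : ℚ.Positive ε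
      ε-pos = ℚ.positive 0<ε
      1/B-pos : ℚ.Positive (ℚ.1/ B)
      1/B-pos = ℚ.1/pos⇒pos B
    δ = ℚ.1/ B ℚ.* ε
    0<δ : 0ℚ ℚ.< δ
    0<δ = ℚ.positive⁻¹ δ {{ℚ.pos*pos⇒pos (ℚ.1/ B) ε}}

  *-estimate : ∀ {B C δ η} a b c d → 0ℚ ℚ.< B → 0ℚ ℚ.< C →
    ℚ.∣ a ∣ ℚ.≤ B → ℚ.∣ d ∣ ℚ.≤ C → ℚ.∣ b ℚ.- d ∣ ℚ.< δ → ℚ.∣ a ℚ.- c ∣ ℚ.< η →
    ℚ.∣ a ℚ.* b ℚ.- c ℚ.* d ∣ ℚ.< B ℚ.* δ ℚ.+ C ℚ.* η
  *-estimate {B} {C} {δ} {η} a b c d 0<B 0<C ∣a∣≤B ∣d∣≤C Δ₁<δ Δ₂<η = begin-strict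
      ℚ.∣ a ℚ.* b ℚ.- c ℚ.* d ∣
        ≡⟨ cong ℚ.∣_∣ (*-diff a b c d) ⟩
      ℚ.∣ a ℚ.* (b ℚ.- d) ℚ.+ (a ℚ.- c) ℚ.* d ∣
        ≤⟨ ℚ.∣p+q∣≤∣p∣+∣q∣ (a ℚ.* (b ℚ.- d)) ((a ℚ.- c) ℚ.* d) ⟩
      ℚ.∣ a ℚ.* (b ℚ.- d) ∣ ℚ.+ ℚ.∣ (a ℚ.- c) ℚ.* d ∣
        ≡⟨ cong₂ ℚ._+_ (ℚ.∣p*q∣≡∣p∣*∣q∣ a (b ℚ.- d))
             (≡.trans (ℚ.∣p*q∣≡∣p∣*∣q∣ (a ℚ.- c) d) (ℚ.*-comm ℚ.∣ a ℚ.- c ∣ ℚ.∣ d ∣)) ⟩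
      ℚ.∣ a ∣ ℚ.* ℚ.∣ b ℚ.- d ∣ ℚ.+ ℚ.∣ d ∣ ℚ.* ℚ.∣ a ℚ.- c ∣
        ≤⟨ ℚ.+-mono-≤
             (ℚ.*-monoʳ-≤-nonNeg ℚ.∣ b ℚ.- d ∣ {{ℚ.∣-∣-nonNeg (b ℚ.- d)}} ∣a∣≤B)
             (ℚ.*-monoʳ-≤-nonNeg ℚ.∣ a ℚ.- c ∣ {{ℚ.∣-∣-nonNeg (a ℚ.- c)}} ∣d∣≤C) ⟩
      B ℚ.* ℚ.∣ b ℚ.- d ∣ ℚ.+ C ℚ.* ℚ.∣ a ℚ.- c ∣
        <⟨ ℚ.+-mono-< (ℚ.*-monoʳ-<-pos B {{ℚ.positive 0<B}} Δ₁<δ)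
                      (ℚ.*-monoʳ-<-pos C {{ℚ.positive 0<C}} Δ₂<η) ⟩
      B ℚ.* δ ℚ.+ C ℚ.* η ∎
    where open ℚ.≤-Reasoning

  *-cauchy : ∀ x y → IsCauchy x → IsCauchy y → IsCauchy (λ n → x n ℚ.* y n)
  *-cauchy x y cx cy ε 0<ε =
    let K , B , 0<B , ∣x∣≤B = bound cx
        L , C , 0<C , ∣y∣≤C = bound cy
        δ , 0<δ , Bδ≡ = scale 0<B (half 0<ε)
        η , 0<η , Cη≡ = scale 0<C (half 0<ε)
        M , p = cy δ 0<δ
        N , q = cx η 0<η
        KL = K ℕ.⊔ L
        MN = M ℕ.⊔ N
    in KL ℕ.⊔ MN , λ m n m≥ n≥ →
      let MN≤m = ℕ.m⊔n≤o⇒n≤o KL MN m≥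
          MN≤n = ℕ.m⊔n≤o⇒n≤o KL MN n≥
      in subst (ℚ.∣ x m ℚ.* y m ℚ.- x n ℚ.* y n ∣ ℚ.<_)
           (≡.trans (cong₂ ℚ._+_ Bδ≡ Cη≡) (half+half ε))
           (*-estimate (x m) (y m) (x n) (y n) 0<B 0<C
             (∣x∣≤B m (ℕ.m⊔n≤o⇒m≤o K L (ℕ.m⊔n≤o⇒m≤o KL MN m≥)))
             (∣y∣≤C n (ℕ.m⊔n≤o⇒n≤o K L (ℕ.m⊔n≤o⇒m≤o KL MN n≥)))
             (p m n (ℕ.m⊔n≤o⇒m≤o M N MN≤m) (ℕ.m⊔n≤o⇒m≤o M N MN≤n))
             (q m n (ℕ.m⊔n≤o⇒n≤o M N MN≤m) (ℕ.m⊔n≤o⇒n≤o M N MN≤n)))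

  ∣∣-≤ : ∀ {p r} → p ℚ.≤ r → ℚ.- p ℚ.≤ r → ℚ.∣ p ∣ ℚ.≤ r
  ∣∣-≤ {p} {r} p≤r -p≤r with ℚ.∣p∣≡p∨∣p∣≡-p p
  ... | inj₁ eq = subst (ℚ._≤ r) (≡.sym eq) p≤r
  ... | inj₂ eq = subst (ℚ._≤ r) (≡.sym eq) -p≤r

  ∣∣-< : ∀ {p r} → p ℚ.< r → ℚ.- p ℚ.< r → ℚ.∣ p ∣ ℚ.< r
  ∣∣-< {p} {r} p<r -p<r with ℚ.∣p∣≡p∨∣p∣≡-p p
  ... | inj₁ eq = subst (ℚ._< r) (≡.sym eq) p<r
  ... | inj₂ eq = subst (ℚ._< r) (≡.sym eq) -p<r

  -<→<+ : ∀ {p r ε} → p ℚ.< r ℚ.+ ε → p ℚ.- r ℚ.< ε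
  -<→<+ {p} {r} {ε} p< = subst (p ℚ.- r ℚ.<_)
    (ℚ-solve 2 (λ r ε → (r :+ ε) :- r := ε) refl r ε) (ℚ.+-monoˡ-< (ℚ.- r) p<)

  neg-diff : ∀ a b → ℚ.- (a ℚ.- b) ≡ b ℚ.- a
  neg-diff = ℚ-solve 2 (λ a b → :- (a :- b) := b :- a) refl

  ∣diff∣-< : ∀ {p r ε} → p ℚ.< r ℚ.+ ε → r ℚ.< p ℚ.+ ε → ℚ.∣ p ℚ.- r ∣ ℚ.< ε
  ∣diff∣-< {p} {r} {ε} p< r< =
    ∣∣-< (-<→<+ p<) (subst (ℚ._< ε) (≡.sym (neg-diff p r)) (-<→<+ r<))

  ∣a∣-∣b∣≤ : ∀ a b → ℚ.∣ a ∣ ℚ.- ℚ.∣ b ∣ ℚ.≤ ℚ.∣ a ℚ.- b ∣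
  ∣a∣-∣b∣≤ a b = begin
    ℚ.∣ a ∣ ℚ.- ℚ.∣ b ∣
      ≡⟨ cong (λ t → ℚ.∣ t ∣ ℚ.- ℚ.∣ b ∣) (split a b) ⟩
    ℚ.∣ b ℚ.+ (a ℚ.- b) ∣ ℚ.- ℚ.∣ b ∣
      ≤⟨ ℚ.+-monoˡ-≤ (ℚ.- ℚ.∣ b ∣) (ℚ.∣p+q∣≤∣p∣+∣q∣ b (a ℚ.- b)) ⟩
    (ℚ.∣ b ∣ ℚ.+ ℚ.∣ a ℚ.- b ∣) ℚ.- ℚ.∣ b ∣
      ≡⟨ ℚ-solve 2 (λ x y → (x :+ y) :- x := y) refl ℚ.∣ b ∣ ℚ.∣ a ℚ.- b ∣ ⟩
    ℚ.∣ a ℚ.- b ∣ ∎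
    where open ℚ.≤-Reasoning

  ∣∣-cauchy : ∀ x → IsCauchy x → IsCauchy (λ n → ℚ.∣ x n ∣)
  ∣∣-cauchy x cx ε 0<ε with cx ε 0<ε
  ... | N , p = N , λ m n m≥ n≥ → ℚ.≤-<-trans
      (∣∣-≤ (∣a∣-∣b∣≤ (x m) (x n)) (below (x m) (x n))) (p m n m≥ n≥)
    where
    open ℚ.≤-Reasoning
    below : ∀ a b → ℚ.- (ℚ.∣ a ∣ ℚ.- ℚ.∣ b ∣) ℚ.≤ ℚ.∣ a ℚ.- b ∣
    below a b = begin
      ℚ.- (ℚ.∣ a ∣ ℚ.- ℚ.∣ b ∣) ≡⟨ neg-diff ℚ.∣ a ∣ ℚ.∣ b ∣ ⟩
      ℚ.∣ b ∣ ℚ.- ℚ.∣ a ∣       ≤⟨ ∣a∣-∣b∣≤ b a ⟩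
      ℚ.∣ b ℚ.- a ∣             ≡⟨ cong ℚ.∣_∣ (neg-diff a b) ⟨
      ℚ.∣ ℚ.- (a ℚ.- b) ∣       ≡⟨ ℚ.∣-p∣≡∣p∣ (a ℚ.- b) ⟩
      ℚ.∣ a ℚ.- b ∣             ∎

open Cauchy

infixl 6 _+_
infixl 7 _*_

fromℚ : ℚ → ℝ
fromℚ p = mkℝ (const p) (constCauchy p)

fromℕ : ℕ → ℝ
fromℕ n = fromℚ (+ n ℚ./ 1)

_+_ : ℝ → ℝ → ℝ
x + y = mkℝ (λ n → approx x n ℚ.+ approx y n) (+-cauchy (approx x) (approx y) (cauchy x) (cauchy y))

_*_ : ℝ → ℝ → ℝ
x * y = mkℝ (λ n → approx x n ℚ.* approx y n) (*-cauchy (approx x) (approx y) (cauchy x) (cauchy y))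

∣_∣ : ℝ → ℝ
∣ x ∣ = mkℝ (λ n → ℚ.∣ approx x n ∣) (∣∣-cauchy (approx x) (cauchy x))

-- ⌊√ n⌋, as isqrt-lower and isqrt-upper show.
isqrt : ℕ → ℕ
isqrt zero    = 0
isqrt (suc n) with suc (isqrt n) ℕ.* suc (isqrt n) ℕ.≤? suc n
... | yes _ = suc (isqrt n)
... | no  _ = isqrt n

isqrt-lower : ∀ n → isqrt n ℕ.* isqrt n ℕ.≤ n
isqrt-lower zero    = ℕ.z≤n
isqrt-lower (suc n) with suc (isqrt n) ℕ.* suc (isqrt n) ℕ.≤? suc n
... | yes p = p
... | no  _ = ℕ.m≤n⇒m≤1+n (isqrt-lower n)

isqrt-upper : ∀ n → n ℕ.< suc (isqrt n) ℕ.* suc (isqrt n)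
isqrt-upper zero    = ℕ.s≤s ℕ.z≤n
isqrt-upper (suc n) with suc (isqrt n) ℕ.* suc (isqrt n) ℕ.≤? suc n
... | yes p = ℕ.≤-<-trans (isqrt-upper n)
                (ℕ.*-mono-< (ℕ.n<1+n (suc (isqrt n))) (ℕ.n<1+n (suc (isqrt n))))
... | no ¬p = ℕ.≰⇒> ¬p

-- ⌊N √ m⌋ / N with N = suc n, a rational within 1 / N of √ m.
√-approx : ℕ → ℕ → ℚ
√-approx m n = + isqrt (m ℕ.* (suc n ℕ.* suc n)) ℚ./ suc n

module √-Cauchy where
  -- a / N < b / M + p / D, cleared of denominators
  cross : ∀ a b p n m d → a ℕ.* suc m ℕ.< suc b ℕ.* suc n → d ℕ.≤ m →
    a ℕ.* (suc m ℕ.* suc d) ℕ.< (b ℕ.* suc d ℕ.+ suc p ℕ.* suc m) ℕ.* suc n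
  cross a b p n m d aM< d≤m = begin-strict
    a ℕ.* (suc m ℕ.* suc d)                        ≡⟨ ℕ.*-assoc a (suc m) (suc d) ⟨
    a ℕ.* suc m ℕ.* suc d                          <⟨ ℕ.*-monoˡ-< (suc d) aM< ⟩
    suc b ℕ.* suc n ℕ.* suc d                      ≡⟨ rearrange b (suc n) (suc d) ⟩
    (b ℕ.* suc d ℕ.+ suc d) ℕ.* suc n
      ≤⟨ ℕ.*-monoˡ-≤ (suc n) (ℕ.+-monoʳ-≤ (b ℕ.* suc d)
           (ℕ.≤-trans (ℕ.s≤s d≤m) (ℕ.m≤m+n (suc m) (p ℕ.* suc m)))) ⟩
    (b ℕ.* suc d ℕ.+ suc p ℕ.* suc m) ℕ.* suc n    ∎
    where
    open ℕ.≤-Reasoning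
    rearrange : ∀ b n d → suc b ℕ.* n ℕ.* d ≡ (b ℕ.* d ℕ.+ d) ℕ.* n
    rearrange = solve-∀

  /-close : ∀ a b p n m d .(c : Coprime (suc p) (suc d)) → a ℕ.* suc m ℕ.< suc b ℕ.* suc n → d ℕ.≤ m →
    + a ℚ./ suc n ℚ.< (+ b ℚ./ suc m) ℚ.+ mkℚ +[1+ p ] d c
  /-close a b p n m d c aM< d≤m = ℚ.toℚᵘ-cancel-< (begin-strict
    ℚ.toℚᵘ (+ a ℚ./ suc n)                    ≃⟨ ℚ.toℚᵘ-fromℚᵘ (mkℚᵘ (+ a) n) ⟩
    mkℚᵘ (+ a) n                              <⟨ ℚᵘ.*<* ints ⟩
    mkℚᵘ (+ b) m ℚᵘ.+ mkℚᵘ +[1+ p ] d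
      ≃⟨ ℚᵘ.+-congˡ (mkℚᵘ +[1+ p ] d) (ℚ.toℚᵘ-fromℚᵘ (mkℚᵘ (+ b) m)) ⟨
    ℚ.toℚᵘ (+ b ℚ./ suc m) ℚᵘ.+ ℚ.toℚᵘ ε      ≃⟨ ℚ.toℚᵘ-homo-+ (+ b ℚ./ suc m) ε ⟨
    ℚ.toℚᵘ ((+ b ℚ./ suc m) ℚ.+ ε)            ∎)
    where
    open ℚᵘ.≤-Reasoning
    ε : ℚ
    ε = mkℚ +[1+ p ] d c
    ints : + a ℤ.* ℚᵘ.↧ (mkℚᵘ (+ b) m ℚᵘ.+ mkℚᵘ +[1+ p ] d)
         ℤ.< ℚᵘ.↥ (mkℚᵘ (+ b) m ℚᵘ.+ mkℚᵘ +[1+ p ] d) ℤ.* + suc n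
    ints = subst₂ ℤ._<_
      (ℤ.pos-* a (suc m ℕ.* suc d))
      (≡.trans (ℤ.pos-* (b ℕ.* suc d ℕ.+ suc p ℕ.* suc m) (suc n))
        (cong (ℤ._* + suc n)
          (cong₂ ℤ._+_ (ℤ.pos-* b (suc d)) (ℤ.pos-* (suc p) (suc m)))))
      (+<+ (cross a b p n m d aM< d≤m))

  square-cancel-< : ∀ {a b} → a ℕ.* a ℕ.< b ℕ.* b → a ℕ.< b
  square-cancel-< {a} {b} a²<b² with a ℕ.<? b
  ... | yes a<b = a<b
  ... | no  a≮b = contradiction a²<b² (ℕ.≤⇒≯ (ℕ.*-mono-≤ (ℕ.≮⇒≥ a≮b) (ℕ.≮⇒≥ a≮b)))

  isqrt-cross : ∀ k N M → .{{_ : ℕ.NonZero N}} →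
    isqrt (k ℕ.* (N ℕ.* N)) ℕ.* M ℕ.< suc (isqrt (k ℕ.* (M ℕ.* M))) ℕ.* N
  isqrt-cross k N M = square-cancel-< (begin-strict
    a ℕ.* M ℕ.* (a ℕ.* M)              ≡⟨ interchange a M ⟩
    a ℕ.* a ℕ.* (M ℕ.* M)              ≤⟨ ℕ.*-monoˡ-≤ (M ℕ.* M) (isqrt-lower (k ℕ.* (N ℕ.* N))) ⟩
    k ℕ.* (N ℕ.* N) ℕ.* (M ℕ.* M)      ≡⟨ swap k (N ℕ.* N) (M ℕ.* M) ⟩
    k ℕ.* (M ℕ.* M) ℕ.* (N ℕ.* N)
      <⟨ ℕ.*-monoˡ-< (N ℕ.* N) {{ℕ.m*n≢0 N N}} (isqrt-upper (k ℕ.* (M ℕ.* M))) ⟩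
    b ℕ.* b ℕ.* (N ℕ.* N)              ≡⟨ interchange b N ⟨
    b ℕ.* N ℕ.* (b ℕ.* N)              ∎)
    where
    open ℕ.≤-Reasoning
    a = isqrt (k ℕ.* (N ℕ.* N))
    b = suc (isqrt (k ℕ.* (M ℕ.* M)))
    interchange : ∀ x y → x ℕ.* y ℕ.* (x ℕ.* y) ≡ x ℕ.* x ℕ.* (y ℕ.* y)
    interchange = solve-∀
    swap : ∀ x y z → x ℕ.* y ℕ.* z ≡ x ℕ.* z ℕ.* y
    swap = solve-∀

  √-close : ∀ k p d n m .(c : Coprime (suc p) (suc d)) → d ℕ.≤ m →
    √-approx k n ℚ.< √-approx k m ℚ.+ mkℚ +[1+ p ] d c
  √-close k p d n m c =
    /-close (isqrt (k ℕ.* (suc n ℕ.* suc n))) (isqrt (k ℕ.* (suc m ℕ.* suc m))) p n m d c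
      (isqrt-cross k (suc n) (suc m))

  √-cauchy : ∀ k → IsCauchy (√-approx k)
  √-cauchy k (mkℚ +[1+ p ] d c)   0<ε = d , λ m n m≥ n≥ →
    ∣diff∣-< (√-close k p d m n c n≥) (√-close k p d n m c m≥)
  √-cauchy k (mkℚ (+ zero) d c)   (ℚ.*<* (+<+ ()))
  √-cauchy k (mkℚ (-[1+ p ]) d c) (ℚ.*<* ())

√_ : ℕ → ℝ
√ k = mkℝ (√-approx k) (√-Cauchy.√-cauchy k)

Finite : ∀ {a ℓ} → Setoid a ℓ → Set (a ⊔ ℓ)
Finite A = ∃ λ n → Inverse (≡.setoid (Fin n)) A

module FiniteSetoid {a ℓ} (A : Setoid a ℓ) (fin : Finite A) where
  open Setoid A
  open Inverse (proj₂ fin)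

  infix 4 _≈?_

  _≈?_ : B.Decidable _≈_
  x ≈? y = Dec.map′
    (λ eq → trans (sym (inverseˡ ≡.refl)) (trans (to-cong eq) (inverseˡ ≡.refl)))
    from-cong (from x Fin.≟ from y)

  any? : ∀ {p} {P : Pred Carrier p} → (∀ {x y} → x ≈ y → P x → P y) → Decidable P → Dec (∃ P)
  any? resp P? = Dec.map′
    (λ (i , p) → to i , p)
    (λ (x , p) → from x , resp (sym (inverseˡ ≡.refl)) p)
    (Fin.any? (λ i → P? (to i)))

subsetoid : ∀ {a ℓ p} (A : Setoid a ℓ) → Pred (Setoid.Carrier A) p → Setoid (a ⊔ p) ℓ
subsetoid A P = record
  { Carrier       = Σ Carrier P
  ; _≈_           = λ x y → proj₁ x ≈ proj₁ y
  ; isEquivalence = record { refl = A.refl ; sym = A.sym ; trans = A.trans }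
  }
  where
  module A = Setoid A
  open A using (Carrier; _≈_)

module FiniteConstructions where
  finite-via : ∀ {a b ℓ₁ ℓ₂} {A : Setoid a ℓ₁} {B : Setoid b ℓ₂} →
    Inverse A B → Finite A → Finite B
  finite-via f (n , e) = n , Comp.inverse e f

  finite-× : ∀ {a b ℓ₁ ℓ₂} {A : Setoid a ℓ₁} {B : Setoid b ℓ₂} →
    Finite A → Finite B → Finite (A ×ₛ B)
  finite-× (m , e) (n , f) = m ℕ.* n ,
    Comp.inverse Fin.*↔× (Comp.inverse (Symm.inverse Pointwise-≡↔≡) (e ×-inverse f))

  finite-subset-Fin : ∀ {p} n {P : Pred (Fin n) p} → Decidable P →
    Finite (subsetoid (≡.setoid (Fin n)) P)
  finite-subset-Fin zero P? = 0 , record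
    { to        = λ ()
    ; from      = λ { (() , _) }
    ; to-cong   = λ { {()} }
    ; from-cong = λ { {() , _} }
    ; inverse   = (λ { {() , _} }) , λ { {()} }
    }
  finite-subset-Fin (suc n) {P} P? with P? zero | finite-subset-Fin n (P? ∘ suc)
  ... | yes p₀ | m , e = suc m , record
    { to        = to
    ; from      = from
    ; to-cong   = λ { refl → refl }
    ; from-cong = λ {x} {y} → from-cong {x} {y}
    ; inverse   = (λ { refl → to∘from _ }) , λ {i} {x} eq →
                    ≡.trans (from-cong {x} {to i} eq) (from∘to i)
    }
    where
    module e = Inverse e
    to : Fin (suc m) → Σ (Fin (suc n)) P
    to zero    = zero , p₀
    to (suc i) = suc (proj₁ (e.to i)) , proj₂ (e.to i)
    from : Σ (Fin (suc n)) P → Fin (suc m)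
    from (zero  , _) = zero
    from (suc i , p) = suc (e.from (i , p))
    from-cong : ∀ {x y} → proj₁ x ≡ proj₁ y → from x ≡ from y
    from-cong {zero  , _} {zero  , _} _    = refl
    from-cong {suc i , p} {suc i , r} refl = cong suc (e.from-cong refl)
    to∘from : ∀ x → proj₁ (to (from x)) ≡ proj₁ x
    to∘from (zero  , _) = refl
    to∘from (suc i , p) = cong suc (e.inverseˡ refl)
    from∘to : ∀ i → from (to i) ≡ i
    from∘to zero    = refl
    from∘to (suc i) = cong suc (e.inverseʳ refl)
  ... | no ¬p₀ | m , e = m , record
    { to        = λ i → suc (proj₁ (e.to i)) , proj₂ (e.to i)
    ; from      = from
    ; to-cong   = λ { refl → refl }
    ; from-cong = λ {x} {y} → from-cong {x} {y}
    ; inverse   = (λ { refl → to∘from _ }) , λ {i} {x} eq →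
                    ≡.trans (from-cong {x} {suc (proj₁ (e.to i)) , proj₂ (e.to i)} eq)
                            (e.inverseʳ refl)
    }
    where
    module e = Inverse e
    from : Σ (Fin (suc n)) P → Fin m
    from (zero  , p) = contradiction p ¬p₀
    from (suc i , p) = e.from (i , p)
    from-cong : ∀ {x y} → proj₁ x ≡ proj₁ y → from x ≡ from y
    from-cong {zero  , p} {_}         _    = contradiction p ¬p₀
    from-cong {suc i , p} {suc i , r} refl = e.from-cong refl
    to∘from : ∀ x → suc (proj₁ (e.to (from x))) ≡ proj₁ x
    to∘from (zero  , p) = contradiction p ¬p₀
    to∘from (suc i , p) = cong suc (e.inverseˡ refl)

  finite-subset : ∀ {a ℓ p} {A : Setoid a ℓ} {P : Pred (Setoid.Carrier A) p} →
    (∀ {x y} → Setoid._≈_ A x y → P x → P y) → Decidable P →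
    Finite A → Finite (subsetoid A P)
  finite-subset {A = A} {P} resp P? (n , e) = finite-via
    {A = subsetoid (≡.setoid (Fin n)) (λ i → P (Inverse.to e i))} {B = subsetoid A P}
    (record
      { to        = λ (i , p) → to i , p
      ; from      = λ (x , p) → from x , resp (sym (inverseˡ ≡.refl)) p
      ; to-cong   = to-cong
      ; from-cong = from-cong
      ; inverse   = (λ eq → inverseˡ eq) , (λ eq → inverseʳ eq)
      })
    (finite-subset-Fin n {λ i → P (to i)} (λ i → P? (to i)))
    where
    open Inverse e
    open Setoid A using (sym)

open FiniteConstructions

record FiniteGraph c ℓ e : Set (lsuc (c ⊔ ℓ ⊔ e)) where
  infix 4 _⟶_ _⟶?_
  field
    vertices : Setoid c ℓ
    finite   : Finite vertices
  open Setoid vertices using (Carrier; _≈_) public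
  field
    _⟶_    : Rel Carrier e
    _⟶?_   : B.Decidable _⟶_
    ⟶-resp : _⟶_ B.Respects₂ _≈_

  order : ℕ
  order = proj₁ finite

  vertex : Fin order → Carrier
  vertex = Inverse.to (proj₂ finite)

  adjacency : Fin order → Fin order → ℕ
  adjacency i j = if does (vertex i ⟶? vertex j) then 1 else 0

sum : ∀ {n} → Vector ℝ n → ℝ
sum = foldr _+_ (fromℕ 0)

-- The adjacency matrix of an undirected graph is real symmetric, so its
-- eigenvalues are real and it is enough to look for them in ℝ.
IsEigenvalue : ∀ {n} → (Fin n → Fin n → ℝ) → ℝ → Set
IsEigenvalue {n} A μ = ∃ λ (v : Vector ℝ n) →
  ¬ (∀ i → v i ≃ fromℕ 0) × (∀ i → sum (λ j → A i j * v j) ≃ μ * v i)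

module _ {c ℓ e} (Γ : FiniteGraph c ℓ e) where
  open FiniteGraph Γ

  IsUndirected : Set (c ⊔ e)
  IsUndirected = B.Symmetric _⟶_

  -- A loop contributes 1 to the degree, as it does to the row sum of the
  -- adjacency matrix.
  IsRegular : ℕ → Set
  IsRegular k = ∀ i → foldr ℕ._+_ 0 (adjacency i) ≡ k

  -- For k = 0 the only eigenvalue is k itself, so that the value of √ (k ∸ 1)
  -- is irrelevant.
  IsRamanujan : Set (c ⊔ e)
  IsRamanujan = IsUndirected × ∃ λ k → IsRegular k ×
    (∀ μ → IsEigenvalue (λ i j → fromℕ (adjacency i j)) μ →
       ¬ (∣ μ ∣ ≃ fromℕ k) → ∣ μ ∣ ≤ fromℕ 2 * √ (k ℕ.∸ 1))

record FiniteGroup c ℓ : Set (lsuc (c ⊔ ℓ)) where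
  field
    group  : Group c ℓ
    finite : Finite (Group.setoid group)

record Automorphism {c ℓ} (G : Group c ℓ) : Set (c ⊔ ℓ) where
  open GroupMorphisms (Group.rawGroup G) (Group.rawGroup G)
  field
    ⟦_⟧                : Group.Carrier G → Group.Carrier G
    isGroupIsomorphism : IsGroupIsomorphism ⟦_⟧

record Subset {a ℓ} (A : Setoid a ℓ) p : Set (a ⊔ ℓ ⊔ lsuc p) where
  open Setoid A
  field
    Member  : Pred Carrier p
    member? : Decidable Member
    resp    : ∀ {x y} → x ≈ y → Member x → Member y

module _ {c ℓ} (G : FiniteGroup c ℓ) where
  open FiniteGroup G
  open Group group renaming (refl to ≈-refl)
  open FiniteSetoid setoid finite

  ConjugateTo : Carrier → Pred Carrier (c ⊔ ℓ)
  ConjugateTo g h = ∃ λ x → x ∙ g ∙ x ⁻¹ ≈ h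

  conjugacyClass : Carrier → Subset setoid (c ⊔ ℓ)
  conjugacyClass g = record
    { Member  = ConjugateTo g
    ; member? = λ h → any? (λ x≈y → trans (∙-cong (∙-congʳ (sym x≈y)) (⁻¹-cong (sym x≈y))))
                           (λ x → x ∙ g ∙ x ⁻¹ ≈? h)
    ; resp    = λ h≈k (x , eq) → x , trans eq h≈k
    }

  module _ {p} (S : Subset setoid p) where
    open Subset S

    -- An edge from x to t x s for each s ∈ S.  In all instances below t x is
    -- injective, so that distinct s give distinct edges.
    edgesTo : (t : Carrier → Carrier → Carrier) →
      (∀ {x y s u} → x ≈ y → s ≈ u → t x s ≈ t y u) → FiniteGraph c ℓ (c ⊔ ℓ ⊔ p)
    edgesTo t t-cong = record
      { vertices = setoid
      ; finite   = finite
      ; _⟶_      = λ x y → ∃ λ s → Member s × t x s ≈ y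
      ; _⟶?_     = λ x y → any?
          (λ s≈u (m , eq) → resp s≈u m , trans (t-cong ≈-refl (sym s≈u)) eq)
          (λ s → member? s Dec.×-dec (t x s ≈? y))
      ; ⟶-resp   =
          (λ y≈z (s , m , eq) → s , m , trans eq y≈z) ,
          (λ x≈z (s , m , eq) → s , m , trans (t-cong (sym x≈z) ≈-refl) eq)
      }

    cayleySumGraph : FiniteGraph c ℓ (c ⊔ ℓ ⊔ p)
    cayleySumGraph = edgesTo (λ x s → x ⁻¹ ∙ s) (λ x≈y → ∙-cong (⁻¹-cong x≈y))

    module _ (σ : Automorphism group) where
      open Automorphism σ
      open GroupMorphisms.IsGroupIsomorphism isGroupIsomorphism using (⟦⟧-cong)

      twistedCayleyGraph : FiniteGraph c ℓ (c ⊔ ℓ ⊔ p)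
      twistedCayleyGraph = edgesTo (λ x s → ⟦ x ∙ s ⟧)
        (λ x≈y s≈u → ⟦⟧-cong (∙-cong x≈y s≈u))

      twistedCayleySumGraph : FiniteGraph c ℓ (c ⊔ ℓ ⊔ p)
      twistedCayleySumGraph = edgesTo (λ x s → ⟦ x ⁻¹ ∙ s ⟧)
        (λ x≈y s≈u → ⟦⟧-cong (∙-cong (⁻¹-cong x≈y) s≈u))

_∪_ : ∀ {a ℓ p r} {A : Setoid a ℓ} → Subset A p → Subset A r → Subset A (p ⊔ r)
S ∪ T = record
  { Member  = λ x → S.Member x ⊎ T.Member x
  ; member? = λ x → S.member? x Dec.⊎-dec T.member? x
  ; resp    = λ { x≈y (inj₁ p) → inj₁ (S.resp x≈y p) ; x≈y (inj₂ p) → inj₂ (T.resp x≈y p) }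
  }
  where
  module S = Subset S
  module T = Subset T

module Matrices {c ℓ} (R : CommutativeRing c ℓ) where
  open CommutativeRing R renaming
    (Carrier to K; _+_ to _⊕_; _*_ to _⊛_; _-_ to _⊖_; -_ to ⊖_; setoid to K-setoid; refl to ≈-refl)

  infixr 7 _·_
  infix 4 _≋_

  -- mat a b c d is the matrix with rows (a b) and (c d).
  record Matrix : Set c where
    constructor mat
    field
      e₁₁ e₁₂ e₂₁ e₂₂ : K

  _≋_ : Rel Matrix ℓ
  mat a b c d ≋ mat a′ b′ c′ d′ = a ≈ a′ × b ≈ b′ × c ≈ c′ × d ≈ d′

  _·_ : Matrix → Matrix → Matrix
  mat a b c d · mat x y z w =
    mat (a ⊛ x ⊕ b ⊛ z) (a ⊛ y ⊕ b ⊛ w) (c ⊛ x ⊕ d ⊛ z) (c ⊛ y ⊕ d ⊛ w)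

  𝟙 : Matrix
  𝟙 = mat 1# 0# 0# 1#

  det : Matrix → K
  det (mat a b c d) = a ⊛ d ⊖ b ⊛ c

  adj : Matrix → Matrix
  adj (mat a b c d) = mat d (⊖ b) (⊖ c) a

  matrices : Setoid c ℓ
  matrices = record
    { Carrier       = Matrix
    ; _≈_           = _≋_
    ; isEquivalence = record
      { refl  = ≈-refl , ≈-refl , ≈-refl , ≈-refl
      ; sym   = λ (p , q , r , s) → sym p , sym q , sym r , sym s
      ; trans = λ (p , q , r , s) (p′ , q′ , r′ , s′) →
                  trans p p′ , trans q q′ , trans r r′ , trans s s′
      }
    }

  open Setoid matrices public using ()
    renaming (refl to ≋-refl; sym to ≋-sym; trans to ≋-trans)

  private
    open import Algebra.Properties.Ring ring using (-‿distribˡ-*; -‿distribʳ-*; -‿involutive)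
    open import Algebra.Solver.Ring.NaturalCoefficients.Default commutativeSemiring
      using (solve; _:+_; _:*_; _:=_)

    x⊕y≈z⊕w⇒x⊖z≈w⊖y : ∀ {x y z w} → x ⊕ y ≈ z ⊕ w → x ⊖ z ≈ w ⊖ y
    x⊕y≈z⊕w⇒x⊖z≈w⊖y {x} {y} {z} {w} eq = begin
      x ⊖ z                              ≈⟨ +-identityʳ _ ⟨
      (x ⊖ z) ⊕ 0#                       ≈⟨ +-congˡ (-‿inverseʳ y) ⟨
      (x ⊖ z) ⊕ (y ⊖ y)
        ≈⟨ solve 4 (λ x z y u → (x :+ z) :+ (y :+ u) := (x :+ y) :+ (z :+ u))
             ≈-refl x (⊖ z) y (⊖ y) ⟩
      (x ⊕ y) ⊕ (⊖ z ⊕ ⊖ y)              ≈⟨ +-congʳ eq ⟩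
      (z ⊕ w) ⊕ (⊖ z ⊕ ⊖ y)
        ≈⟨ solve 4 (λ z w v u → (z :+ w) :+ (v :+ u) := (w :+ u) :+ (z :+ v))
             ≈-refl z w (⊖ z) (⊖ y) ⟩
      (w ⊖ y) ⊕ (z ⊖ z)                  ≈⟨ +-congˡ (-‿inverseʳ z) ⟩
      (w ⊖ y) ⊕ 0#                       ≈⟨ +-identityʳ _ ⟩
      w ⊖ y                              ∎
      where open ≈-Reasoning K-setoid

    neg*neg : ∀ x y → ⊖ x ⊛ ⊖ y ≈ x ⊛ y
    neg*neg x y = begin
      ⊖ x ⊛ ⊖ y       ≈⟨ -‿distribˡ-* x (⊖ y) ⟨
      ⊖ (x ⊛ ⊖ y)     ≈⟨ -‿cong (-‿distribʳ-* x y) ⟨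
      ⊖ (⊖ (x ⊛ y))   ≈⟨ -‿involutive (x ⊛ y) ⟩
      x ⊛ y           ∎
      where open ≈-Reasoning K-setoid

    ⊖-* : ∀ x y z w → (x ⊖ y) ⊛ (z ⊖ w) ≈ (x ⊛ z ⊕ y ⊛ w) ⊖ (x ⊛ w ⊕ y ⊛ z)
    ⊖-* x y z w = begin
      (x ⊖ y) ⊛ (z ⊖ w)
        ≈⟨ solve 4 (λ x y z w → (x :+ y) :* (z :+ w) := (x :* z :+ y :* w) :+ (x :* w :+ y :* z))
             ≈-refl x (⊖ y) z (⊖ w) ⟩
      (x ⊛ z ⊕ ⊖ y ⊛ ⊖ w) ⊕ (x ⊛ ⊖ w ⊕ ⊖ y ⊛ z)
        ≈⟨ +-cong (+-congˡ (neg*neg y w))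
             (+-cong (sym (-‿distribʳ-* x w)) (sym (-‿distribˡ-* y z))) ⟩
      (x ⊛ z ⊕ y ⊛ w) ⊕ (⊖ (x ⊛ w) ⊕ ⊖ (y ⊛ z))
        ≈⟨ +-congˡ (-‿+-comm (x ⊛ w) (y ⊛ z)) ⟩
      (x ⊛ z ⊕ y ⊛ w) ⊖ (x ⊛ w ⊕ y ⊛ z) ∎
      where
      open ≈-Reasoning K-setoid
      open import Algebra.Properties.Ring ring using (-‿+-comm)

    cancel : ∀ x y → x ⊛ ⊖ y ⊕ y ⊛ x ≈ 0#
    cancel x y = trans (+-cong (sym (-‿distribʳ-* x y)) (*-comm y x)) (-‿inverseˡ (x ⊛ y))

    det-eq : ∀ x y z w → x ⊛ y ⊕ z ⊛ ⊖ w ≈ x ⊛ y ⊖ z ⊛ w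
    det-eq x y z w = +-congˡ (sym (-‿distribʳ-* z w))

  det-cong : ∀ {M N} → M ≋ N → det M ≈ det N
  det-cong (p , q , r , s) = +-cong (*-cong p s) (-‿cong (*-cong q r))

  ·-cong : ∀ {M M′ N N′} → M ≋ M′ → N ≋ N′ → M · N ≋ M′ · N′
  ·-cong (p , q , r , s) (p′ , q′ , r′ , s′) =
    +-cong (*-cong p p′) (*-cong q r′) , +-cong (*-cong p q′) (*-cong q s′) ,
    +-cong (*-cong r p′) (*-cong s r′) , +-cong (*-cong r q′) (*-cong s s′)

  ·-assoc : ∀ M N P → (M · N) · P ≋ M · (N · P)
  ·-assoc (mat a b c d) (mat x y z w) (mat p q r s) =
    entry a b p r , entry a b q s , entry c d p r , entry c d q s
    where
    entry : ∀ a b p r →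
      (a ⊛ x ⊕ b ⊛ z) ⊛ p ⊕ (a ⊛ y ⊕ b ⊛ w) ⊛ r ≈ a ⊛ (x ⊛ p ⊕ y ⊛ r) ⊕ b ⊛ (z ⊛ p ⊕ w ⊛ r)
    entry a b p r = solve 8
      (λ a b p r x y z w → (a :* x :+ b :* z) :* p :+ (a :* y :+ b :* w) :* r
                        := a :* (x :* p :+ y :* r) :+ b :* (z :* p :+ w :* r))
      ≈-refl a b p r x y z w

  private
    1x+0y : ∀ x y → 1# ⊛ x ⊕ 0# ⊛ y ≈ x
    1x+0y x y = trans (+-cong (*-identityˡ x) (zeroˡ y)) (+-identityʳ x)

    0x+1y : ∀ x y → 0# ⊛ x ⊕ 1# ⊛ y ≈ y
    0x+1y x y = trans (+-cong (zeroˡ x) (*-identityˡ y)) (+-identityˡ y)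

  ·-identityˡ : ∀ M → 𝟙 · M ≋ M
  ·-identityˡ (mat a b c d) = 1x+0y a c , 1x+0y b d , 0x+1y a c , 0x+1y b d

  ·-identityʳ : ∀ M → M · 𝟙 ≋ M
  ·-identityʳ (mat a b c d) = x1+y0 a b , x0+y1 a b , x1+y0 c d , x0+y1 c d
    where
    x1+y0 : ∀ x y → x ⊛ 1# ⊕ y ⊛ 0# ≈ x
    x1+y0 x y = trans (+-cong (*-comm x 1#) (*-comm y 0#)) (1x+0y x y)
    x0+y1 : ∀ x y → x ⊛ 0# ⊕ y ⊛ 1# ≈ y
    x0+y1 x y = trans (+-cong (*-comm x 0#) (*-comm y 1#)) (0x+1y x y)

  det-𝟙 : det 𝟙 ≈ 1#
  det-𝟙 = trans (+-cong (*-identityˡ 1#) (trans (-‿cong (zeroˡ 0#)) -0#≈0#)) (+-identityʳ 1#)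
    where open import Algebra.Properties.Ring ring using (-0#≈0#)

  det-· : ∀ M N → det (M · N) ≈ det M ⊛ det N
  det-· (mat a b c d) (mat x y z w) = trans
    (x⊕y≈z⊕w⇒x⊖z≈w⊖y (solve 8
      (λ a b c d x y z w →
        (a :* x :+ b :* z) :* (c :* y :+ d :* w) :+ (a :* d :* (y :* z) :+ b :* c :* (x :* w))
        := (a :* y :+ b :* w) :* (c :* x :+ d :* z) :+ (a :* d :* (x :* w) :+ b :* c :* (y :* z)))
      ≈-refl a b c d x y z w))
    (sym (⊖-* (a ⊛ d) (b ⊛ c) (x ⊛ w) (y ⊛ z)))

  det-adj : ∀ M → det (adj M) ≈ det M
  det-adj (mat a b c d) = +-cong (*-comm d a) (-‿cong (neg*neg b c))

  adj-cong : ∀ {M N} → M ≋ N → adj M ≋ adj N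
  adj-cong (p , q , r , s) = s , -‿cong q , -‿cong r , p

  adj-inverseʳ : ∀ {M} → det M ≈ 1# → M · adj M ≋ 𝟙
  adj-inverseʳ {mat a b c d} det≈1 =
    trans (det-eq a d b c) det≈1 ,
    cancel a b ,
    trans (+-comm (c ⊛ d) (d ⊛ ⊖ c)) (cancel d c) ,
    trans (trans (+-comm (c ⊛ ⊖ b) (d ⊛ a)) (det-eq d a c b))
      (trans (+-cong (*-comm d a) (-‿cong (*-comm c b))) det≈1)

  adj-inverseˡ : ∀ {M} → det M ≈ 1# → adj M · M ≋ 𝟙
  adj-inverseˡ {mat a b c d} det≈1 =
    trans (+-cong (*-comm d a) (trans (*-comm (⊖ b) c)
      (trans (sym (-‿distribʳ-* c b)) (-‿cong (*-comm c b))))) det≈1 ,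
    trans (+-comm (d ⊛ b) (⊖ b ⊛ d)) (trans (+-cong (*-comm (⊖ b) d) (*-comm d b)) (cancel d b)) ,
    trans (+-congʳ (*-comm (⊖ c) a)) (trans (+-congˡ (*-comm a c)) (cancel a c)) ,
    trans (+-comm (⊖ c ⊛ b) (a ⊛ d)) (trans (+-congˡ (trans (*-comm (⊖ c) b)
      (sym (-‿distribʳ-* b c)))) det≈1)

  HasDet1 : Pred Matrix ℓ
  HasDet1 M = det M ≈ 1#

  SL₂ : Group (c ⊔ ℓ) ℓ
  SL₂ = record
    { Carrier = Σ Matrix HasDet1
    ; _≈_     = λ x y → proj₁ x ≋ proj₁ y
    ; _∙_     = λ (M , p) (N , q) →
                  M · N , trans (det-· M N) (trans (*-cong p q) (*-identityˡ 1#))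
    ; ε       = 𝟙 , det-𝟙
    ; _⁻¹     = λ (M , p) → adj M , trans (det-adj M) p
    ; isGroup = record
      { isMonoid = record
        { isSemigroup = record
          { isMagma = record
            { isEquivalence = Setoid.isEquivalence (subsetoid matrices HasDet1)
            ; ∙-cong        = ·-cong
            }
          ; assoc = λ (M , _) (N , _) (P , _) → ·-assoc M N P
          }
        ; identity = (λ (M , _) → ·-identityˡ M) , (λ (M , _) → ·-identityʳ M)
        }
      ; inverse = (λ (_ , p) → adj-inverseˡ p) , (λ (_ , p) → adj-inverseʳ p)
      ; ⁻¹-cong = adj-cong
      }
    }

  record GL₂ : Set (c ⊔ ℓ) where
    field
      matrix   : Matrix
      inverse  : Matrix
      inverseˡ : inverse · matrix ≋ 𝟙
      inverseʳ : matrix · inverse ≋ 𝟙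

  conjugation : GL₂ → Automorphism SL₂
  conjugation g = record
    { ⟦_⟧                = λ (M , p) → conj M , det-conj M p
    ; isGroupIsomorphism = record
      { isGroupMonomorphism = record
        { isGroupHomomorphism = record
          { isMonoidHomomorphism = record
            { isMagmaHomomorphism = record
              { isRelHomomorphism = record { cong = conj-cong }
              ; homo              = λ (M , _) (N , _) → conj-homo M N
              }
            ; ε-homo = conj-𝟙
            }
          ; ⁻¹-homo = λ x → SL.inverseˡ-unique
              (conj (adj (proj₁ x)) , det-conj (adj (proj₁ x)) (trans (det-adj (proj₁ x)) (proj₂ x)))
              (conj (proj₁ x) , det-conj (proj₁ x) (proj₂ x))
              (≋-trans (≋-sym (conj-homo (adj (proj₁ x)) (proj₁ x)))
                (≋-trans (conj-cong (adj-inverseˡ (proj₂ x))) conj-𝟙))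
          }
        ; injective = λ {x} {y} eq → ≋-trans (≋-sym (unconj-conj (proj₁ x)))
            (≋-trans (unconj-cong eq) (unconj-conj (proj₁ y)))
        }
      ; surjective = λ (M , p) → (unconj M , det-unconj M p) ,
          λ eq → ≋-trans (conj-cong eq) (conj-unconj M)
      }
    }
    where
    open GL₂ g renaming (matrix to w; inverse to w⁻¹; inverseˡ to w⁻¹w; inverseʳ to ww⁻¹)
    module SL where
      open import Algebra.Properties.Group SL₂ public using (inverseˡ-unique)
    conj unconj : Matrix → Matrix
    conj M = w · M · w⁻¹
    unconj M = w⁻¹ · M · w
    conj-cong : ∀ {M N} → M ≋ N → conj M ≋ conj N
    conj-cong eq = ·-cong ≋-refl (·-cong eq ≋-refl)
    unconj-cong : ∀ {M N} → M ≋ N → unconj M ≋ unconj N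
    unconj-cong eq = ·-cong ≋-refl (·-cong eq ≋-refl)
    telescope : ∀ {u v} → u · v ≋ 𝟙 → ∀ M → u · v · M ≋ M
    telescope {u} {v} uv M = ≋-trans (≋-sym (·-assoc u v M))
      (≋-trans (·-cong uv ≋-refl) (·-identityˡ M))
    double : ∀ {u v} → u · v ≋ 𝟙 → ∀ M → u · (v · M · u) · v ≋ M
    double {u} {v} uv M = ≋-trans (≋-sym (·-assoc u (v · M · u) v))
      (≋-trans (·-cong (telescope uv (M · u)) ≋-refl)
        (≋-trans (·-assoc M u v) (≋-trans (·-cong ≋-refl uv) (·-identityʳ M))))
    conj-unconj : ∀ M → conj (unconj M) ≋ M
    conj-unconj = double ww⁻¹
    unconj-conj : ∀ M → unconj (conj M) ≋ M
    unconj-conj = double w⁻¹w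
    conj-𝟙 : conj 𝟙 ≋ 𝟙
    conj-𝟙 = ≋-trans (·-cong ≋-refl (·-identityˡ w⁻¹)) ww⁻¹
    conj-homo : ∀ M N → conj (M · N) ≋ conj M · conj N
    conj-homo M N = ≋-sym (≋-trans (·-assoc w (M · w⁻¹) (conj N)) (·-cong ≋-refl
      (≋-trans (·-assoc M w⁻¹ (conj N)) (≋-trans (·-cong ≋-refl (telescope w⁻¹w (N · w⁻¹)))
        (≋-sym (·-assoc M N w⁻¹))))))
    det-conjugate : ∀ {u v} → u · v ≋ 𝟙 → ∀ M → det M ≈ 1# → det (u · M · v) ≈ 1#
    det-conjugate {u} {v} uv M detM = begin
      det (u · M · v)             ≈⟨ det-· u (M · v) ⟩
      det u ⊛ det (M · v)         ≈⟨ *-congˡ (det-· M v) ⟩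
      det u ⊛ (det M ⊛ det v)     ≈⟨ *-congˡ (trans (*-congʳ detM) (*-identityˡ (det v))) ⟩
      det u ⊛ det v               ≈⟨ det-· u v ⟨
      det (u · v)                 ≈⟨ det-cong uv ⟩
      det 𝟙                       ≈⟨ det-𝟙 ⟩
      1#                          ∎
      where open ≈-Reasoning K-setoid
    det-conj : ∀ M → det M ≈ 1# → det (conj M) ≈ 1#
    det-conj = det-conjugate ww⁻¹
    det-unconj : ∀ M → det M ≈ 1# → det (unconj M) ≈ 1#
    det-unconj = det-conjugate w⁻¹w

  private
    lower : K → Matrix
    lower t = mat 1# 0# t 1#

    det-lower : ∀ t → HasDet1 (lower t)
    det-lower t = trans (+-cong (*-identityˡ 1#) (trans (-‿cong (zeroˡ t)) -0#≈0#)) (+-identityʳ 1#)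
      where open import Algebra.Properties.Ring ring using (-0#≈0#)

  u₊ u₋ : Group.Carrier SL₂
  u₊ = mat 1# 0# 1#     1# , det-lower 1#
  u₋ = mat 1# 0# (⊖ 1#) 1# , det-lower (⊖ 1#)

  private
    0x+y0 : ∀ x y → 0# ⊛ x ⊕ y ⊛ 0# ≈ 0#
    0x+y0 x y = trans (+-cong (zeroˡ x) (zeroʳ y)) (+-identityˡ 0#)

    x0+0y : ∀ x y → x ⊛ 0# ⊕ 0# ⊛ y ≈ 0#
    x0+0y x y = trans (+-cong (zeroʳ x) (zeroˡ y)) (+-identityˡ 0#)

    -1*-1 : ⊖ 1# ⊛ ⊖ 1# ≈ 1#
    -1*-1 = trans (neg*neg 1# 1#) (*-identityˡ 1#)

  w₊ w₋ : GL₂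
  w₊ = record
    { matrix   = mat 0# 1# 1# 0#
    ; inverse  = mat 0# 1# 1# 0#
    ; inverseˡ = 0x+1y 0# 1# , 0x+y0 1# 1# , x0+0y 1# 1# , 1x+0y 1# 0#
    ; inverseʳ = 0x+1y 0# 1# , 0x+y0 1# 1# , x0+0y 1# 1# , 1x+0y 1# 0#
    }
  w₋ = record
    { matrix   = mat 0# 1# (⊖ 1#) 0#
    ; inverse  = mat 0# (⊖ 1#) 1# 0#
    ; inverseˡ = trans (+-cong (zeroˡ 0#) -1*-1) (+-identityˡ 1#) , 0x+y0 1# (⊖ 1#) ,
                 x0+0y 1# (⊖ 1#) , 1x+0y 1# 0#
    ; inverseʳ = 0x+1y 0# 1# , 0x+y0 (⊖ 1#) 1# , x0+0y (⊖ 1#) 1# ,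
                 trans (+-cong -1*-1 (zeroˡ 0#)) (+-identityʳ 1#)
    }

-- A Heyting field with finitely many elements is the same as a finite field in
-- the classical sense: ≈ is decidable, invertibility is decidable by search, and
-- so by tightness x # y is equivalent to ¬ x ≈ y.

toCommutativeRing : ∀ {c ℓ₁ ℓ₂} → HeytingField c ℓ₁ ℓ₂ → CommutativeRing c ℓ₁
toCommutativeRing F =
  HeytingCommutativeRing.commutativeRing (HeytingField.heytingCommutativeRing F)

HasOrder : ∀ {c ℓ₁ ℓ₂} → HeytingField c ℓ₁ ℓ₂ → ℕ → Set (c ⊔ ℓ₁)
HasOrder F q = Inverse (≡.setoid (Fin q)) (CommutativeRing.setoid (toCommutativeRing F))

IsPrimePower : ℕ → Set
IsPrimePower q = ∃₂ λ p n → Prime p × 1 ℕ.≤ n × q ≡ p ℕ.^ n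

module SL₂-over {c ℓ₁ ℓ₂} (F : HeytingField c ℓ₁ ℓ₂) {q} (|F| : HasOrder F q) where
  open Matrices (toCommutativeRing F)
  open CommutativeRing (toCommutativeRing F) using (setoid; 1#; sym; trans)
  open FiniteSetoid setoid (q , |F|) using (_≈?_)

  private
    finite-matrices : Finite matrices
    finite-matrices = finite-via
      (record
        { to        = λ (a , b , c , d) → mat a b c d
        ; from      = λ (mat a b c d) → a , b , c , d
        ; to-cong   = id
        ; from-cong = id
        ; inverse   = id , id
        })
      (finite-× F-finite (finite-× F-finite (finite-× F-finite F-finite)))
      where
      F-finite : Finite setoid
      F-finite = q , |F|

  G : FiniteGroup (c ⊔ ℓ₁) ℓ₁
  G = record
    { group  = SL₂
    ; finite = finite-subset {A = matrices} {P = HasDet1}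
        (λ M≋N → trans (sym (det-cong M≋N))) (λ M → det M ≈? 1#) finite-matrices
    }

  S : Subset (Group.setoid SL₂) (c ⊔ ℓ₁)
  S = conjugacyClass G u₊ ∪ conjugacyClass G u₋

  σ₊ σ₋ : Automorphism SL₂
  σ₊ = conjugation w₊
  σ₋ = conjugation w₋

-- In each of the three graphs x is joined to y exactly when ⟨ x , ψ y ⟩ = 2 and x ≠ ψ y, where ⟨_,_⟩ is the
-- polar form of the determinant, so that ⟨ x , y ⟩ = tr (x⁻¹ y) on SL₂, and ψ is inversion, σ, or σ followed by
-- inversion, an involution with ⟨ x , ψ y ⟩ = ⟨ y , ψ x ⟩.  Indeed for q ≡ 3 (mod 4) every nonzero element of F is
-- plus or minus a square, so that S consists of all elements of trace 2 other than 1.  Hence the graph is regular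
-- of degree k = q² − 1, and its adjacency matrix is (T − 1) Ψ with T the 0-1 matrix of the relation ⟨ x , y ⟩ = 2
-- and Ψ the permutation matrix of ψ.  Counting the elements of trace 2 along the q + 1 lines that they fix gives
-- T² = (q + 1) J + q² − Π, where J is the all-ones matrix and Π y z, the number of lines with the same image under
-- y and z, is positive semidefinite.  So ‖ T w ‖ ≤ q ‖ w ‖ if the coordinates of w have sum 0, as those of an
-- eigenvector for μ ≠ k do, and then ‖ (T − 1) w ‖ ≤ (q + 1) ‖ w ‖, where q + 1 ≤ 2 √ (q² − 2).
--
-- All identities and inequalities hold exactly for the rational approximants of an eigenvector.  Since ∣ μ ∣ ≤ B is
-- stable under double negation, the passage to the limit may assume ∣ μ ∣ > B and decide apartness of reals.

module Submission where

open import Defs hiding (_+_; _*_; _≤_; ∣_∣; sum; module Cauchy)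
import Defs as ℝ
open import Algebra.Apartness.Bundles using (HeytingField)
open import Algebra.Bundles using (CommutativeMonoid; CommutativeRing; Group)
open import Algebra.Morphism.Structures using (module GroupMorphisms)
import Algebra.Properties.AbelianGroup
import Algebra.Properties.CommutativeMonoid.Sum
import Algebra.Properties.Ring
import Algebra.Properties.Semiring.Mult.TCOptimised
import Algebra.Properties.Semiring.Sum
import Algebra.Solver.Ring
open import Algebra.Solver.Ring.AlmostCommutativeRing using (fromCommutativeRing; _-Raw-AlmostCommutative⟶_)
open import Data.Fin.Base using (Fin; zero; suc; punchIn)
open import Data.Fin.Permutation using (Permutation; permutation)
import Data.Fin.Properties as Fin
open import Data.Integer.Base as ℤ using (ℤ; +_; -[1+_])
import Data.Integer.Properties as ℤ
open import Data.Maybe.Base using (Maybe; just; nothing)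
open import Data.Bool.Base using (if_then_else_)
open import Data.Nat.Base as ℕ using (ℕ; zero; suc; _%_)
import Data.Nat.DivMod as ℕ
import Data.Nat.Properties as ℕ
open import Data.Nat.Tactic.RingSolver using (solve-∀)
open import Data.Product.Base using (∃; ∃₂; _×_; _,_; proj₁; proj₂)
open import Data.Rational.Base as ℚ using (ℚ; 0ℚ; 1ℚ; ½; _+_; _*_; _-_; -_; _≤_; _<_; ∣_∣)
import Data.Rational.Properties as ℚ
open import Data.Rational.Solver using (module +-*-Solver)
open import Data.Rational.Unnormalised.Base as ℚᵘ using (mkℚᵘ; *≡*; *≤*)
import Data.Rational.Unnormalised.Properties as ℚᵘ
open import Data.Sum.Base using (_⊎_; inj₁; inj₂; [_,_]′)
open import Data.Vec.Functional using (Vector; foldr)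
open import Function.Base using (_∘_; const)
open import Function.Bundles using (Inverse)
import Function.Construct.Composition as Comp
import Function.Construct.Identity as Identity
open import Level using (_⊔_)
open import Relation.Binary.Bundles using (Setoid)
open import Relation.Binary.PropositionalEquality as ≡ using (_≡_; _≢_; refl; cong; cong₂; subst; subst₂; module ≡-Reasoning)
import Relation.Binary.Reasoning.Setoid as ≈-Reasoning
open import Relation.Nullary using (¬_; Dec; yes; no; does; contradiction)
import Relation.Nullary.Decidable as Dec

open +-*-Solver using () renaming (solve to ℚ-solve; _:+_ to _⊞_; _:*_ to _⊠_; _:-_ to _⊟_; _:=_ to _≣_; con to κ)

-- The obstacle is that neither eigenvectors nor square roots are available exactly: μ and v are
-- known by rational approximants only. So no eigenspace is formed. The norm bound is proved for
-- every rational vector w with an error term C (sum w)², which the late approximants of an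
-- eigenvector make small, and the triangle inequality for norms becomes a weighted inequality
-- between squares. Only ‖ A w ‖ enters and not the spectrum of A, so that Ψ drops out and no
-- characters of SL₂ are needed. The count behind T² works because an element of trace 2 is
-- unipotent: those fixing a given line pointwise are 𝟙 plus a scalar l times a rank one matrix, so
-- that ⟨ x , g ⟩ = 2 is an affine equation in l. It has exactly one solution unless the line is an
-- eigenline of g, and these exceptions are what Π collects. The congruence for q enters once for S
-- and once more because q + 1 is even: its half is an integer, which can be compared with integer
-- square roots.

module IntegerRingSolver {c ℓ} (R : CommutativeRing c ℓ) where
  open CommutativeRing R renaming (_+_ to _⊕_; _*_ to _⊛_; _-_ to _⊖_; -_ to ⊖_; refl to ≈-refl)
  open Algebra.Properties.Ring ring using (-‿distribˡ-*; -‿distribʳ-*; -‿involutive; -0#≈0#)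
  open Algebra.Properties.AbelianGroup +-abelianGroup using () renaming (⁻¹-∙-comm to -‿+-comm)
  open Algebra.Properties.Semiring.Mult.TCOptimised semiring
    using (×-homo-+; ×1-homo-*; 1+×) renaming (_×_ to _⋆_)
  open ≈-Reasoning setoid

  -- The canonical ring map from ℤ, which lets the solver compute with integer coefficients over any
  -- R. With this form of multiples `con (+ 0)`, `con (+ 1)` and `con (+ 2)` evaluate to 0#, 1# and
  -- 1# ⊕ 1# by definition.
  ⟦_⟧ᶻ : ℤ → Carrier
  ⟦ + n ⟧ᶻ      = n ⋆ 1#
  ⟦ -[1+ n ] ⟧ᶻ = ⊖ (suc n ⋆ 1#)

  private
    cancel-⊖ : ∀ x y z → x ⊖ y ≈ (z ⊕ x) ⊖ (z ⊕ y)
    cancel-⊖ x y z = sym (begin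
      (z ⊕ x) ⊖ (z ⊕ y)         ≈⟨ +-cong (+-comm z x) (sym (-‿+-comm z y)) ⟩
      (x ⊕ z) ⊕ (⊖ z ⊕ ⊖ y)     ≈⟨ +-assoc x z _ ⟩
      x ⊕ (z ⊕ (⊖ z ⊕ ⊖ y))     ≈⟨ +-congˡ (+-assoc z (⊖ z) (⊖ y)) ⟨
      x ⊕ ((z ⊖ z) ⊕ ⊖ y)       ≈⟨ +-congˡ (+-congʳ (-‿inverseʳ z)) ⟩
      x ⊕ (0# ⊕ ⊖ y)            ≈⟨ +-congˡ (+-identityˡ (⊖ y)) ⟩
      x ⊖ y                     ∎)

    ⟦⊖⟧ : ∀ m n → ⟦ m ℤ.⊖ n ⟧ᶻ ≈ m ⋆ 1# ⊖ n ⋆ 1#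
    ⟦⊖⟧ m       zero    = sym (trans (+-congˡ -0#≈0#) (+-identityʳ _))
    ⟦⊖⟧ zero    (suc n) = sym (+-identityˡ _)
    ⟦⊖⟧ (suc m) (suc n) = begin
      ⟦ suc m ℤ.⊖ suc n ⟧ᶻ                ≡⟨ cong ⟦_⟧ᶻ (ℤ.[1+m]⊖[1+n]≡m⊖n m n) ⟩
      ⟦ m ℤ.⊖ n ⟧ᶻ                        ≈⟨ ⟦⊖⟧ m n ⟩
      m ⋆ 1# ⊖ n ⋆ 1#                     ≈⟨ cancel-⊖ _ _ 1# ⟩
      (1# ⊕ m ⋆ 1#) ⊖ (1# ⊕ n ⋆ 1#)       ≈⟨ +-cong (1+× m 1#) (-‿cong (1+× n 1#)) ⟨
      suc m ⋆ 1# ⊖ suc n ⋆ 1#             ∎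

    ⟦+⟧ : ∀ i j → ⟦ i ℤ.+ j ⟧ᶻ ≈ ⟦ i ⟧ᶻ ⊕ ⟦ j ⟧ᶻ
    ⟦+⟧ (+ m)      (+ n)      = ×-homo-+ 1# m n
    ⟦+⟧ (+ m)      -[1+ n ]   = ⟦⊖⟧ m (suc n)
    ⟦+⟧ -[1+ m ]   (+ n)      = trans (⟦⊖⟧ n (suc m)) (+-comm _ _)
    ⟦+⟧ -[1+ m ]   -[1+ n ]   = begin
      ⊖ (suc (suc (m ℕ.+ n)) ⋆ 1#)        ≡⟨ cong (λ t → ⊖ (suc t ⋆ 1#)) (ℕ.+-suc m n) ⟨
      ⊖ ((suc m ℕ.+ suc n) ⋆ 1#)          ≈⟨ -‿cong (×-homo-+ 1# (suc m) (suc n)) ⟩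
      ⊖ (suc m ⋆ 1# ⊕ suc n ⋆ 1#)         ≈⟨ -‿+-comm _ _ ⟨
      ⊖ (suc m ⋆ 1#) ⊕ ⊖ (suc n ⋆ 1#)     ∎

    ⟦-⟧ : ∀ i → ⟦ ℤ.- i ⟧ᶻ ≈ ⊖ ⟦ i ⟧ᶻ
    ⟦-⟧ (+ zero)    = sym -0#≈0#
    ⟦-⟧ (+ suc n)   = ≈-refl
    ⟦-⟧ -[1+ n ]    = sym (-‿involutive _)

    ⟦+*⟧ : ∀ m j → ⟦ + m ℤ.* j ⟧ᶻ ≈ m ⋆ 1# ⊛ ⟦ j ⟧ᶻ
    ⟦+*⟧ m (+ n) = trans (reflexive (cong ⟦_⟧ᶻ (≡.sym (ℤ.pos-* m n)))) (×1-homo-* m n)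
    ⟦+*⟧ m -[1+ n ] = begin
      ⟦ + m ℤ.* -[1+ n ] ⟧ᶻ          ≡⟨ cong ⟦_⟧ᶻ (ℤ.neg-distribʳ-* (+ m) (+ suc n)) ⟨
      ⟦ ℤ.- (+ m ℤ.* + suc n) ⟧ᶻ     ≈⟨ ⟦-⟧ (+ m ℤ.* + suc n) ⟩
      ⊖ ⟦ + m ℤ.* + suc n ⟧ᶻ         ≈⟨ -‿cong (⟦+*⟧ m (+ suc n)) ⟩
      ⊖ (m ⋆ 1# ⊛ suc n ⋆ 1#)        ≈⟨ -‿distribʳ-* _ _ ⟩
      m ⋆ 1# ⊛ ⊖ (suc n ⋆ 1#)        ∎

    ⟦*⟧ : ∀ i j → ⟦ i ℤ.* j ⟧ᶻ ≈ ⟦ i ⟧ᶻ ⊛ ⟦ j ⟧ᶻ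
    ⟦*⟧ (+ m) j = ⟦+*⟧ m j
    ⟦*⟧ -[1+ m ] j = begin
      ⟦ -[1+ m ] ℤ.* j ⟧ᶻ            ≡⟨ cong ⟦_⟧ᶻ (ℤ.neg-distribˡ-* (+ suc m) j) ⟨
      ⟦ ℤ.- (+ suc m ℤ.* j) ⟧ᶻ       ≈⟨ ⟦-⟧ (+ suc m ℤ.* j) ⟩
      ⊖ ⟦ + suc m ℤ.* j ⟧ᶻ           ≈⟨ -‿cong (⟦+*⟧ (suc m) j) ⟩
      ⊖ (suc m ⋆ 1# ⊛ ⟦ j ⟧ᶻ)        ≈⟨ -‿distribˡ-* _ _ ⟩
      ⊖ (suc m ⋆ 1#) ⊛ ⟦ j ⟧ᶻ        ∎

    morphism : CommutativeRing.rawRing ℤ.+-*-commutativeRing -Raw-AlmostCommutative⟶ fromCommutativeRing R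
    morphism = record
      { ⟦_⟧    = ⟦_⟧ᶻ
      ; +-homo = ⟦+⟧
      ; *-homo = ⟦*⟧
      ; -‿homo = ⟦-⟧
      ; 0-homo = ≈-refl
      ; 1-homo = ≈-refl
      }

    _≟ᶻ_ : ∀ i j → Maybe (⟦ i ⟧ᶻ ≈ ⟦ j ⟧ᶻ)
    i ≟ᶻ j = coefficient≟ (i ℤ.≟ j)
      where
      coefficient≟ : Dec (i ≡ j) → Maybe (⟦ i ⟧ᶻ ≈ ⟦ j ⟧ᶻ)
      coefficient≟ (yes refl) = just ≈-refl
      coefficient≟ (no _)     = nothing

  open Algebra.Solver.Ring _ _ morphism _≟ᶻ_ public

-- Sums over finite index sets

module _ {a ℓ} (M : CommutativeMonoid a ℓ) where
  open CommutativeMonoid M renaming (refl to ≈-refl)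
  open Algebra.Properties.CommutativeMonoid.Sum M

  -- Stated for a commutative monoid since it serves both for sums in ℚ and for products in the
  -- field.
  sum-single : ∀ {n} (f : Vector Carrier n) i → (∀ j → j ≢ i → f j ≈ ε) → sum f ≈ f i
  sum-single {suc n} f i f≈ε = trans (sum-remove {i = i} f) (trans
    (∙-congˡ (trans (sum-cong-≋ (λ j → f≈ε (punchIn i j) (Fin.punchInᵢ≢i i j))) (sum-replicate-zero n)))
    (identityʳ (f i)))

module Σℚ = Algebra.Properties.Semiring.Sum (CommutativeRing.semiring ℚ.+-*-commutativeRing)
open Σℚ using (sum)

module ℚ-Ring = Algebra.Properties.Ring (CommutativeRing.ring ℚ.+-*-commutativeRing)

ι : ℕ → ℚ
ι n = + n ℚ./ 1

ι≃ : ∀ n → ℚ.toℚᵘ (ι n) ℚᵘ.≃ mkℚᵘ (+ n) 0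
ι≃ n = ℚ.toℚᵘ-fromℚᵘ (mkℚᵘ (+ n) 0)

ι-+ : ∀ m n → ι (m ℕ.+ n) ≡ ι m + ι n
ι-+ m n = ℚ.toℚᵘ-injective (begin
  ℚ.toℚᵘ (ι (m ℕ.+ n))                 ≈⟨ ι≃ (m ℕ.+ n) ⟩
  mkℚᵘ (+ (m ℕ.+ n)) 0                 ≈⟨ *≡* (cong (ℤ._* (+ 1)) (≡.sym (cong₂ ℤ._+_ (ℤ.*-identityʳ (+ m))
      (ℤ.*-identityʳ (+ n))))) ⟩
  mkℚᵘ (+ m) 0 ℚᵘ.+ mkℚᵘ (+ n) 0       ≈⟨ ℚᵘ.+-cong (ι≃ m) (ι≃ n) ⟨
  ℚ.toℚᵘ (ι m) ℚᵘ.+ ℚ.toℚᵘ (ι n)       ≈⟨ ℚ.toℚᵘ-homo-+ (ι m) (ι n) ⟨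
  ℚ.toℚᵘ (ι m + ι n)                   ∎)
  where open ≈-Reasoning ℚᵘ.≃-setoid

ι-* : ∀ m n → ι (m ℕ.* n) ≡ ι m * ι n
ι-* m n = ℚ.toℚᵘ-injective (begin
  ℚ.toℚᵘ (ι (m ℕ.* n))                 ≈⟨ ι≃ (m ℕ.* n) ⟩
  mkℚᵘ (+ (m ℕ.* n)) 0                 ≈⟨ *≡* (cong (ℤ._* (+ 1)) (ℤ.pos-* m n)) ⟩
  mkℚᵘ (+ m) 0 ℚᵘ.* mkℚᵘ (+ n) 0       ≈⟨ ℚᵘ.*-cong (ι≃ m) (ι≃ n) ⟨
  ℚ.toℚᵘ (ι m) ℚᵘ.* ℚ.toℚᵘ (ι n)       ≈⟨ ℚ.toℚᵘ-homo-* (ι m) (ι n) ⟨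
  ℚ.toℚᵘ (ι m * ι n)                   ∎)
  where open ≈-Reasoning ℚᵘ.≃-setoid

ι-injective : ∀ {m n} → ι m ≡ ι n → m ≡ n
ι-injective {m} {n} eq with ℚᵘ.≃-trans (ℚᵘ.≃-sym (ι≃ m)) (ℚᵘ.≃-trans (ℚᵘ.≃-reflexive (cong ℚ.toℚᵘ eq)) (ι≃ n))
... | *≡* eq′ = ℤ.+-injective (≡.trans (≡.sym (ℤ.*-identityʳ (+ m))) (≡.trans eq′ (ℤ.*-identityʳ (+ n))))

ι-nonNeg : ∀ n → 0ℚ ≤ ι n
ι-nonNeg n = ℚ.nonNegative⁻¹ (ι n) {{ℚ.normalize-nonNeg n 1}}

ι-suc : ∀ n → ι (suc n) ≡ 1ℚ + ι n
ι-suc = ι-+ 1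

ι-sum : ∀ {n} (f : Vector ℕ n) → ι (foldr ℕ._+_ 0 f) ≡ sum (ι ∘ f)
ι-sum {zero}  f = refl
ι-sum {suc n} f = ≡.trans (ι-+ (f zero) _) (cong (λ s → ι (f zero) + s) (ι-sum (f ∘ suc)))

sum-const : ∀ n p → sum {n} (const p) ≡ ι n * p
sum-const zero    p = ≡.sym (ℚ.*-zeroˡ p)
sum-const (suc n) p = begin
  p + sum {n} (const p)      ≡⟨ cong₂ _+_ (≡.sym (ℚ.*-identityˡ p)) (sum-const n p) ⟩
  1ℚ * p + ι n * p           ≡⟨ ℚ.*-distribʳ-+ p 1ℚ (ι n) ⟨
  (1ℚ + ι n) * p             ≡⟨ cong (_* p) (ι-suc n) ⟨
  ι (suc n) * p              ∎
  where open ≡-Reasoning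

sum-mono-≤ : ∀ {n} {f g : Vector ℚ n} → (∀ i → f i ≤ g i) → sum f ≤ sum g
sum-mono-≤ {zero}  f≤g = ℚ.≤-refl
sum-mono-≤ {suc n} f≤g = ℚ.+-mono-≤ (f≤g zero) (sum-mono-≤ (f≤g ∘ suc))

sum-zero : ∀ {n} {f : Vector ℚ n} → (∀ i → f i ≡ 0ℚ) → sum f ≡ 0ℚ
sum-zero {n} f≡0 = ≡.trans (Σℚ.sum-cong-≗ f≡0) (Σℚ.sum-replicate-zero n)

sum-nonNeg : ∀ {n} {f : Vector ℚ n} → (∀ i → 0ℚ ≤ f i) → 0ℚ ≤ sum f
sum-nonNeg {zero}  0≤f = ℚ.≤-refl
sum-nonNeg {suc n} 0≤f = ℚ.+-mono-≤ (0≤f zero) (sum-nonNeg (0≤f ∘ suc))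

sum-involution : ∀ {n} (f : Vector ℚ n) (φ : Fin n → Fin n) → (∀ i → φ (φ i) ≡ i) → sum (f ∘ φ) ≡ sum f
sum-involution f φ φφ = ≡.sym (Σℚ.sum-permute f (permutation φ φ φφ φφ))

sum-*ˡ : ∀ {n} p (f : Vector ℚ n) → sum (λ i → p * f i) ≡ p * sum f
sum-*ˡ p f = ≡.sym (Σℚ.*-distribˡ-sum p f)

sum-*ʳ : ∀ {n} p (f : Vector ℚ n) → sum (λ i → f i * p) ≡ sum f * p
sum-*ʳ p f = ≡.sym (Σℚ.*-distribʳ-sum p f)

square-nonNeg : ∀ p → 0ℚ ≤ p * p
square-nonNeg p with ℚ.≤-total 0ℚ p
... | inj₁ 0≤p = ℚ.nonNegative⁻¹ (p * p) {{ℚ.nonNeg*nonNeg⇒nonNeg p {{ℚ.nonNegative 0≤p}} p {{ℚ.nonNegative 0≤p}}}}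
... | inj₂ p≤0 = ℚ.nonNegative⁻¹ (p * p) {{ℚ.nonPos*nonPos⇒nonPos p {{ℚ.nonPositive p≤0}} p {{ℚ.nonPositive p≤0}}}}

‖_‖² : ∀ {n} → Vector ℚ n → ℚ
‖ f ‖² = sum (λ i → f i * f i)

_∙_ : ∀ {m n} → (Fin m → Fin n → ℚ) → Vector ℚ n → Vector ℚ m
(K ∙ w) i = sum (λ j → K i j * w j)

quadratic : ∀ {n} → (Fin n → Fin n → ℚ) → Vector ℚ n → ℚ
quadratic N w = sum (λ j → sum (λ k → w j * w k * N j k))

gram : ∀ {m n} → (Fin m → Fin n → ℚ) → Fin n → Fin n → ℚ
gram K j k = sum (λ i → K i j * K i k)

square-sum : ∀ {n} (f : Vector ℚ n) → sum f * sum f ≡ sum (λ j → sum (λ k → f j * f k))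
square-sum f = ≡.trans (≡.sym (sum-*ʳ (sum f) f)) (Σℚ.sum-cong-≗ (λ j → ≡.sym (sum-*ˡ (f j) f)))

-- Used in both directions: to expand ‖ T ∙ w ‖², and to recognise a sum of Gram matrices as
-- positive semidefinite.
‖K∙w‖² : ∀ {m n} (K : Fin m → Fin n → ℚ) w → ‖ K ∙ w ‖² ≡ quadratic (gram K) w
‖K∙w‖² K w = begin
  sum (λ i → (K ∙ w) i * (K ∙ w) i)
    ≡⟨ Σℚ.sum-cong-≗ (λ i → square-sum (λ j → K i j * w j)) ⟩
  sum (λ i → sum (λ j → sum (λ k → K i j * w j * (K i k * w k))))
    ≡⟨ Σℚ.∑-comm (λ i j → sum (λ k → K i j * w j * (K i k * w k))) ⟩
  sum (λ j → sum (λ i → sum (λ k → K i j * w j * (K i k * w k))))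
    ≡⟨ Σℚ.sum-cong-≗ (λ j → Σℚ.∑-comm (λ i k → K i j * w j * (K i k * w k))) ⟩
  sum (λ j → sum (λ k → sum (λ i → K i j * w j * (K i k * w k))))
    ≡⟨ Σℚ.sum-cong-≗ (λ j → Σℚ.sum-cong-≗ (λ k → ≡.trans
         (Σℚ.sum-cong-≗ (λ i → rearrange (K i j) (w j) (K i k) (w k)))
         (sum-*ˡ (w j * w k) (λ i → K i j * K i k)))) ⟩
  quadratic (gram K) w ∎
  where
  open ≡-Reasoning
  rearrange : ∀ a b c d → a * b * (c * d) ≡ b * d * (a * c)
  rearrange = ℚ-solve 4 (λ a b c d → a ⊠ b ⊠ (c ⊠ d) ≣ b ⊠ d ⊠ (a ⊠ c)) refl

𝟏 : ∀ {p} {P : Set p} → Dec P → ℚ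
𝟏 d = if does d then 1ℚ else 0ℚ

𝟏-yes : ∀ {p} {P : Set p} (d : Dec P) → P → 𝟏 d ≡ 1ℚ
𝟏-yes (yes _) _ = refl
𝟏-yes (no ¬p) p = contradiction p ¬p

𝟏-no : ∀ {p} {P : Set p} (d : Dec P) → ¬ P → 𝟏 d ≡ 0ℚ
𝟏-no (yes p) ¬p = contradiction p ¬p
𝟏-no (no _)  _  = refl

𝟏-⇔ : ∀ {p r} {P : Set p} {R : Set r} (d : Dec P) (e : Dec R) → (P → R) → (R → P) → 𝟏 d ≡ 𝟏 e
𝟏-⇔ (yes p) e f g = ≡.sym (𝟏-yes e (f p))
𝟏-⇔ (no ¬p) e f g = ≡.sym (𝟏-no e (¬p ∘ g))

sum-δ : ∀ {n p} {P : Fin n → Set p} (P? : ∀ j → Dec (P j)) i → P i → (∀ j → P j → j ≡ i) →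
  (f : Vector ℚ n) → sum (λ j → 𝟏 (P? j) * f j) ≡ f i
sum-δ P? i pᵢ unique f = ≡.trans
  (sum-single ℚ.+-0-commutativeMonoid _ i
    (λ j j≢i → ≡.trans (cong (_* f j) (𝟏-no (P? j) (j≢i ∘ unique j))) (ℚ.*-zeroˡ (f j))))
  (≡.trans (cong (_* f i) (𝟏-yes (P? i) pᵢ)) (ℚ.*-identityˡ (f i)))

sum-𝟏-unique : ∀ {n p} {P : Fin n → Set p} (P? : ∀ j → Dec (P j)) i → P i → (∀ j → P j → j ≡ i) →
  sum (λ j → 𝟏 (P? j)) ≡ 1ℚ
sum-𝟏-unique P? i pᵢ unique = ≡.trans
  (Σℚ.sum-cong-≗ (λ j → ≡.sym (ℚ.*-identityʳ (𝟏 (P? j))))) (sum-δ P? i pᵢ unique (const 1ℚ))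

-- Finite fields: Fermat's little theorem and squares up to sign

module FiniteField {c ℓ₁ ℓ₂} (F : HeytingField c ℓ₁ ℓ₂) {q} (|F| : HasOrder F q) where
  open HeytingField F using (tight; #⇒invertible; invertible⇒#; #-irrefl)
  open CommutativeRing (toCommutativeRing F) public
    renaming (Carrier to K; _+_ to _⊕_; _*_ to _⊛_; _-_ to _⊖_; -_ to ⊖_; setoid to K-setoid; refl to ≈-refl)
    using (_≈_; 0#; 1#; sym; trans; +-cong; +-congˡ; +-congʳ; *-cong; *-congˡ; *-congʳ; -‿cong; -‿inverseʳ;
           *-comm; *-assoc; *-identityˡ; *-identityʳ; zeroˡ; zeroʳ; *-commutativeMonoid; *-monoid)
  private
    module Finite-K = FiniteSetoid K-setoid (q , |F|)
  open Inverse |F| public using (to; from)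
  open IntegerRingSolver (toCommutativeRing F) public using (solve; con; _:+_; _:*_; _:-_; :-_; _:=_)
  open ≈-Reasoning K-setoid

  infix 4 _≈?_
  abstract
    _≈?_ : ∀ x y → Dec (x ≈ y)
    _≈?_ = Finite-K._≈?_

  to-from : ∀ x → to (from x) ≈ x
  to-from x = Inverse.inverseˡ |F| refl

  from-to : ∀ i → from (to i) ≡ i
  from-to i = Inverse.inverseʳ |F| ≈-refl

  to-injective : ∀ {i j} → to i ≈ to j → i ≡ j
  to-injective {i} {j} eq = ≡.trans (≡.sym (from-to i)) (≡.trans (Inverse.from-cong |F| eq) (from-to j))

  x⊖y≈0⇒x≈y : ∀ {x y} → x ⊖ y ≈ 0# → x ≈ y
  x⊖y≈0⇒x≈y {x} {y} eq = begin
    x              ≈⟨ solve 2 (λ x y → x := (x :- y) :+ y) ≈-refl x y ⟩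
    (x ⊖ y) ⊕ y    ≈⟨ +-congʳ eq ⟩
    0# ⊕ y         ≈⟨ solve 1 (λ y → con (+ 0) :+ y := y) ≈-refl y ⟩
    y              ∎

  x≈y⇒x⊖y≈0 : ∀ {x y} → x ≈ y → x ⊖ y ≈ 0#
  x≈y⇒x⊖y≈0 {x} {y} eq = trans (+-congʳ eq) (-‿inverseʳ y)

  -- Equations are derived from hypotheses by certificates of ideal membership: the difference of
  -- the two sides is an explicit combination of the differences of the hypotheses, which the ring
  -- solver checks.
  combination₁ : ∀ {x y l r} k → x ⊖ y ≈ k ⊛ (l ⊖ r) → l ≈ r → x ≈ y
  combination₁ k eq l≈r = x⊖y≈0⇒x≈y (trans eq (trans (*-congˡ (x≈y⇒x⊖y≈0 l≈r)) (zeroʳ k)))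

  combination₂ : ∀ {x y l r l′ r′} k k′ → x ⊖ y ≈ k ⊛ (l ⊖ r) ⊕ k′ ⊛ (l′ ⊖ r′) →
    l ≈ r → l′ ≈ r′ → x ≈ y
  combination₂ {l = l} {r} k k′ eq l≈r = combination₁ k′ (trans eq (begin
    k ⊛ (l ⊖ r) ⊕ _     ≈⟨ +-congʳ (trans (*-congˡ (x≈y⇒x⊖y≈0 l≈r)) (zeroʳ k)) ⟩
    0# ⊕ _              ≈⟨ solve 1 (λ y → con (+ 0) :+ y := y) ≈-refl _ ⟩
    _                   ∎))

  combination₃ : ∀ {x y l r l′ r′ l″ r″} k k′ k″ →
    x ⊖ y ≈ k ⊛ (l ⊖ r) ⊕ (k′ ⊛ (l′ ⊖ r′) ⊕ k″ ⊛ (l″ ⊖ r″)) →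
    l ≈ r → l′ ≈ r′ → l″ ≈ r″ → x ≈ y
  combination₃ {l = l} {r} k k′ k″ eq l≈r = combination₂ k′ k″ (trans eq (begin
    k ⊛ (l ⊖ r) ⊕ _     ≈⟨ +-congʳ (trans (*-congˡ (x≈y⇒x⊖y≈0 l≈r)) (zeroʳ k)) ⟩
    0# ⊕ _              ≈⟨ solve 1 (λ y → con (+ 0) :+ y := y) ≈-refl _ ⟩
    _                   ∎))

  -- If 1 ≈ 0, then 1 inverts the difference 0 ⊖ 0, and 0 would be apart from itself.
  1≉0 : ¬ 1# ≈ 0#
  1≉0 1≈0 = #-irrefl {0#} {0#} ≈-refl (invertible⇒# (1# , one , trans (*-comm _ 1#) one))
    where
    one : 1# ⊛ (0# ⊖ 0#) ≈ 1#
    one = trans (solve 0 (con (+ 1) :* (con (+ 0) :- con (+ 0)) := con (+ 0)) ≈-refl) (sym 1≈0)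

  abstract
    -- A failed search for an inverse refutes apartness from 0, and then tightness gives x ≈ 0.
    invert : ∀ {x} → ¬ x ≈ 0# → ∃ λ y → x ⊛ y ≈ 1#
    invert {x} x≉0 with Finite-K.any? (λ y≈z eq → trans (*-congˡ (sym y≈z)) eq) (λ y → x ⊛ y ≈? 1#)
    ... | yes inv = inv
    ... | no ¬inv = contradiction (proj₁ (tight x 0#) ¬x#0) x≉0
      where
      open HeytingField F using (_#_)
      ¬x#0 : ¬ x # 0#
      ¬x#0 x#0 = let y , _ , eq = #⇒invertible x#0 in
        ¬inv (y , trans (solve 2 (λ x y → x :* y := (x :- con (+ 0)) :* y) ≈-refl x y) eq)

  *-zero⇒zeroʳ : ∀ {x y} → ¬ x ≈ 0# → x ⊛ y ≈ 0# → y ≈ 0#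
  *-zero⇒zeroʳ {x} {y} x≉0 xy≈0 = let x⁻¹ , inv = invert x≉0 in
    combination₂ x⁻¹ (⊖ y)
      (solve 3 (λ x y z → y :- con (+ 0) := z :* (x :* y :- con (+ 0)) :+ :- y :* (x :* z :- con
          (+ 1))) ≈-refl x y x⁻¹)
      xy≈0 inv

  *-cancelˡ : ∀ {x y z} → ¬ x ≈ 0# → x ⊛ y ≈ x ⊛ z → y ≈ z
  *-cancelˡ {x} {y} {z} x≉0 eq = x⊖y≈0⇒x≈y (*-zero⇒zeroʳ x≉0
    (trans (solve 3 (λ x y z → x :* (y :- z) := x :* y :- x :* z) ≈-refl x y z) (x≈y⇒x⊖y≈0 eq)))

  *-≉0 : ∀ {x y} → ¬ x ≈ 0# → ¬ y ≈ 0# → ¬ x ⊛ y ≈ 0#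
  *-≉0 x≉0 y≉0 = y≉0 ∘ *-zero⇒zeroʳ x≉0

  square-zero : ∀ {x} → x ⊛ x ≈ 0# → x ≈ 0#
  square-zero {x} x²≈0 with x ≈? 0#
  ... | yes x≈0 = x≈0
  ... | no  x≉0 = *-zero⇒zeroʳ x≉0 x²≈0

  square-one : ∀ {x} → x ⊛ x ≈ 1# → x ≈ 1# ⊎ x ≈ ⊖ 1#
  square-one {x} x²≈1 with (x ⊖ 1#) ≈? 0#
  ... | yes eq  = inj₁ (x⊖y≈0⇒x≈y eq)
  ... | no  neq = inj₂ (x⊖y≈0⇒x≈y (*-zero⇒zeroʳ neq
        (trans (solve 1 (λ x → (x :- con (+ 1)) :* (x :- :- con (+ 1)) := x :* x :- con (+ 1)) ≈-refl x)
               (x≈y⇒x⊖y≈0 x²≈1))))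

  open Algebra.Properties.CommutativeMonoid.Sum *-commutativeMonoid
    renaming (sum to product; sum-permute to product-permute; ∑-distrib-+ to product-distrib;
              sum-cong-≋ to product-cong; sum-replicate to product-replicate)
  open import Algebra.Properties.Monoid.Mult *-monoid renaming (_×_ to _times_; ×-homo-+ to times-+)

  infixr 8 _^_
  _^_ : K → ℕ → K
  x ^ n = n times x

  product-≉0 : ∀ {n} (f : Vector K n) → (∀ i → ¬ f i ≈ 0#) → ¬ product f ≈ 0#
  product-≉0 {zero}  f f≉0 = 1≉0
  product-≉0 {suc n} f f≉0 = *-≉0 (f≉0 zero) (product-≉0 (f ∘ suc) (f≉0 ∘ suc))

  -- Multiplication by x permutes the nonzero elements, so it does not change their product.
  fermat : ∀ {x} → ¬ x ≈ 0# → x ^ q ≈ x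
  fermat {x} x≉0 = begin
    x ^ q                              ≈⟨ product-replicate q ⟨
    product {q} (const x)              ≈⟨ product-cong (λ i → [0:1,else:x]*[0:x,else:1] (to i)) ⟨
    -- The factor at 0 is split off as the final x; the other q - 1 factors have product 1.
    product (λ i → [0: 1# ,else: x ] (to i) ⊛ [0: x ,else: 1# ] (to i))
      ≈⟨ product-distrib (λ i → [0: 1# ,else: x ] (to i)) _ ⟩
    product (λ i → [0: 1# ,else: x ] (to i)) ⊛ product (λ i → [0: x ,else: 1# ] (to i))
      ≈⟨ *-cong product≈1 product≈x ⟩
    1# ⊛ x                             ≈⟨ *-identityˡ x ⟩
    x                                  ∎
    where
    [0:_,else:_] : K → K → K → K
    [0: y ,else: z ] t = if does (t ≈? 0#) then y else z

    [0:1,else:x]*[0:x,else:1] : ∀ t → [0: 1# ,else: x ] t ⊛ [0: x ,else: 1# ] t ≈ x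
    [0:1,else:x]*[0:x,else:1] t with t ≈? 0#
    ... | yes _ = *-identityˡ x
    ... | no  _ = *-identityʳ x

    product≈x : product (λ i → [0: x ,else: 1# ] (to i)) ≈ x
    product≈x = trans (sum-single *-commutativeMonoid _ (from 0#) others) at-zero
      where
      others : ∀ j → j ≢ from 0# → [0: x ,else: 1# ] (to j) ≈ 1#
      others j j≢ with to j ≈? 0#
      ... | yes eq = contradiction (to-injective (trans eq (sym (to-from 0#)))) j≢
      ... | no  _  = ≈-refl
      at-zero : [0: x ,else: 1# ] (to (from 0#)) ≈ x
      at-zero with to (from 0#) ≈? 0#
      ... | yes _  = ≈-refl
      ... | no neq = contradiction (to-from 0#) neq

    x⁻¹ = proj₁ (invert x≉0)

    undo : ∀ {y z} → y ⊛ z ≈ 1# → ∀ i → from (y ⊛ to (from (z ⊛ to i))) ≡ i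
    undo {y} {z} yz≈1 i = to-injective (begin
      to (from (y ⊛ to (from (z ⊛ to i))))   ≈⟨ to-from _ ⟩
      y ⊛ to (from (z ⊛ to i))               ≈⟨ *-congˡ (to-from _) ⟩
      y ⊛ (z ⊛ to i)                         ≈⟨ *-assoc y z (to i) ⟨
      y ⊛ z ⊛ to i                           ≈⟨ *-congʳ yz≈1 ⟩
      1# ⊛ to i                              ≈⟨ *-identityˡ (to i) ⟩
      to i                                   ∎)

    multiply : Permutation q q
    multiply = permutation (λ i → from (x ⊛ to i)) (λ i → from (x⁻¹ ⊛ to i))
      (undo (proj₂ (invert x≉0))) (undo (trans (*-comm x⁻¹ x) (proj₂ (invert x≉0))))

    -- Replacing 0 by 1 turns the product of the nonzero elements into a product over all of
    -- `Fin q`, where `multiply` is a permutation.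
    nonzero : K → K
    nonzero t = [0: 1# ,else: t ] t

    nonzero-≉0 : ∀ t → ¬ nonzero t ≈ 0#
    nonzero-≉0 t with t ≈? 0#
    ... | yes _  = 1≉0
    ... | no t≉0 = t≉0

    nonzero-* : ∀ i → nonzero (to (from (x ⊛ to i))) ≈ [0: 1# ,else: x ] (to i) ⊛ nonzero (to i)
    nonzero-* i with to i ≈? 0# | to (from (x ⊛ to i)) ≈? 0#
    ... | yes _   | yes _  = sym (*-identityˡ 1#)
    ... | yes eq  | no neq = contradiction (trans (to-from _) (trans (*-congˡ eq) (zeroʳ x))) neq
    ... | no  neq | yes eq = contradiction (trans (sym (to-from _)) eq) (*-≉0 x≉0 neq)
    ... | no  _   | no _   = to-from _

    product≈1 : product (λ i → [0: 1# ,else: x ] (to i)) ≈ 1#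
    product≈1 = *-cancelˡ (product-≉0 (λ i → nonzero (to i)) (λ i → nonzero-≉0 (to i))) (begin
      product (λ i → nonzero (to i)) ⊛ product (λ i → [0: 1# ,else: x ] (to i))
        ≈⟨ *-comm _ _ ⟩
      product (λ i → [0: 1# ,else: x ] (to i)) ⊛ product (λ i → nonzero (to i))
        ≈⟨ product-distrib (λ i → [0: 1# ,else: x ] (to i)) _ ⟨
      product (λ i → [0: 1# ,else: x ] (to i) ⊛ nonzero (to i))
        ≈⟨ product-cong nonzero-* ⟨
      product (λ i → nonzero (to (from (x ⊛ to i))))
        ≈⟨ product-permute (λ i → nonzero (to i)) multiply ⟨
      product (λ i → nonzero (to i))          ≈⟨ *-identityʳ _ ⟨
      product (λ i → nonzero (to i)) ⊛ 1#     ∎)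

  -- With q = 4r + 3, the square of x ^ (2r + 1) = x * (x ^ r)² is x ^ (q - 1) = 1.
  square-or-minus-square : q % 4 ≡ 3 → ∀ {x} → ¬ x ≈ 0# →
    ∃ λ y → ¬ y ≈ 0# × (x ≈ y ⊛ y ⊎ x ≈ ⊖ (y ⊛ y))
  square-or-minus-square q≡3 {x} x≉0 = y , y≉0 , [ inj₁ ∘ plus , inj₂ ∘ minus ]′ (square-one half²)
    where
    r = q ℕ./ 4
    q≡ : q ≡ suc (suc (r ℕ.+ r) ℕ.+ suc (r ℕ.+ r))
    q≡ = ≡.trans (ℕ.m≡m%n+[m/n]*n q 4) (≡.trans (cong (ℕ._+ r ℕ.* 4) q≡3) (rearrange r))
      where
      rearrange : ∀ r → 3 ℕ.+ r ℕ.* 4 ≡ suc (suc (r ℕ.+ r) ℕ.+ suc (r ℕ.+ r))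
      rearrange = solve-∀
    p = x ^ r
    p≉0 : ∀ n → ¬ x ^ n ≈ 0#
    p≉0 zero    = 1≉0
    p≉0 (suc n) = *-≉0 x≉0 (p≉0 n)
    -- Since x p² squares to 1, it is 1 or -1, and the inverse y of p then satisfies x = y² or x =
    -- -y².
    y = proj₁ (invert (p≉0 r))
    py≈1 = proj₂ (invert (p≉0 r))
    y≉0 : ¬ y ≈ 0#
    y≉0 y≈0 = 1≉0 (trans (sym py≈1) (trans (*-congˡ y≈0) (zeroʳ p)))
    half = x ⊛ (p ⊛ p)
    x^[1+2r] : x ^ suc (r ℕ.+ r) ≈ half
    x^[1+2r] = *-congˡ (times-+ x r r)
    half² : half ⊛ half ≈ 1#
    half² = *-cancelˡ x≉0 (begin
      x ⊛ (half ⊛ half)                         ≈⟨ *-congˡ (*-cong x^[1+2r] x^[1+2r]) ⟨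
      x ⊛ (x ^ suc (r ℕ.+ r) ⊛ x ^ suc (r ℕ.+ r)) ≈⟨ *-congˡ (times-+ x (suc (r ℕ.+ r)) (suc (r ℕ.+ r))) ⟨
      x ^ suc (suc (r ℕ.+ r) ℕ.+ suc (r ℕ.+ r)) ≡⟨ cong (x ^_) q≡ ⟨
      x ^ q                                     ≈⟨ fermat x≉0 ⟩
      x                                         ≈⟨ *-identityʳ x ⟨
      x ⊛ 1#                                    ∎)
    plus : half ≈ 1# → x ≈ y ⊛ y
    plus eq = combination₂ (y ⊛ y) (⊖ (x ⊛ (p ⊛ y ⊕ 1#)))
      (solve 3 (λ x p y → x :- y :* y := y :* y :* (x :* (p :* p) :- con (+ 1))
        :+ :- (x :* (p :* y :+ con (+ 1))) :* (p :* y :- con (+ 1))) ≈-refl x p y) eq py≈1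
    minus : half ≈ ⊖ 1# → x ≈ ⊖ (y ⊛ y)
    minus eq = combination₂ (y ⊛ y) (⊖ (x ⊛ (p ⊛ y ⊕ 1#)))
      (solve 3 (λ x p y → x :- :- (y :* y) := y :* y :* (x :* (p :* p) :- :- con (+ 1))
        :+ :- (x :* (p :* y :+ con (+ 1))) :* (p :* y :- con (+ 1))) ≈-refl x p y) eq py≈1

-- Elements of trace 2 as shears along the points of the projective line

module Shears {c ℓ₁ ℓ₂} (F : HeytingField c ℓ₁ ℓ₂) {q} (|F| : HasOrder F q) where
  open FiniteField F |F| public
  open Matrices (toCommutativeRing F) public

  2# : K
  2# = 1# ⊕ 1#

  tr : Matrix → K
  tr (mat a b c d) = a ⊕ d

  infix 4 _≋?_
  abstract
    _≋?_ : ∀ M N → Dec (M ≋ N)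
    mat a b c d ≋? mat a′ b′ c′ d′ = (a ≈? a′) Dec.×-dec (b ≈? b′) Dec.×-dec (c ≈? c′) Dec.×-dec (d ≈? d′)

  -- The polar form of the determinant; on SL₂ it is the trace of x⁻¹ y.
  ⟨_,_⟩ : Matrix → Matrix → K
  ⟨ mat a b c d , mat x y z w ⟩ = (a ⊛ w ⊕ d ⊛ x) ⊖ (b ⊛ z ⊕ c ⊛ y)

  ⟨⟩-cong : ∀ {M M′ N N′} → M ≋ M′ → N ≋ N′ → ⟨ M , N ⟩ ≈ ⟨ M′ , N′ ⟩
  ⟨⟩-cong (p , q , r , s) (p′ , q′ , r′ , s′) =
    +-cong (+-cong (*-cong p s′) (*-cong s p′)) (-‿cong (+-cong (*-cong q r′) (*-cong r q′)))

  ⟨⟩-sym : ∀ M N → ⟨ M , N ⟩ ≈ ⟨ N , M ⟩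
  ⟨⟩-sym (mat a b c d) (mat x y z w) = solve 8 (λ a b c d x y z w →
    (a :* w :+ d :* x) :- (b :* z :+ c :* y) := (x :* d :+ w :* a) :- (y :* c :+ z :* b)) ≈-refl a b c d x y z w

  tr-cong : ∀ {M N} → M ≋ N → tr M ≈ tr N
  tr-cong (p , _ , _ , s) = +-cong p s

  ⟨,𝟙⟩ : ∀ M → ⟨ M , 𝟙 ⟩ ≈ tr M
  ⟨,𝟙⟩ (mat a b c d) = solve 4 (λ a b c d →
    (a :* con (+ 1) :+ d :* con (+ 1)) :- (b :* con (+ 0) :+ c :* con (+ 0)) := a :+ d) ≈-refl a b c d

  -- The adjugate is the adjoint of left multiplication. For M in SL₂ it is the inverse, so that the
  -- form is invariant under left translation.
  ⟨·,⟩ : ∀ M N P → ⟨ M · N , P ⟩ ≈ ⟨ N , adj M · P ⟩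
  ⟨·,⟩ (mat a b c d) (mat x y z w) (mat e f g h) = solve 12
    (λ a b c d x y z w e f g h →
      ((a :* x :+ b :* z) :* h :+ (c :* y :+ d :* w) :* e) :- ((a :* y :+ b :* w) :* g :+ (c :* x :+ d :* z) :* f)
      := (x :* (:- c :* f :+ a :* h) :+ w :* (d :* e :+ :- b :* g))
         :- (y :* (:- c :* e :+ a :* g) :+ z :* (d :* f :+ :- b :* h)))
    ≈-refl a b c d x y z w e f g h

  infix 4 _≈ᵛ_
  infixr 7 _·ᵛ_

  _≈ᵛ_ : K × K → K × K → Set ℓ₁
  (a , b) ≈ᵛ (a′ , b′) = a ≈ a′ × b ≈ b′

  0ᵛ : K × K
  0ᵛ = 0# , 0#

  _·ᵛ_ : Matrix → K × K → K × K
  mat a b c d ·ᵛ (u , v) = a ⊛ u ⊕ b ⊛ v , c ⊛ u ⊕ d ⊛ v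

  -- The determinant of two column vectors; it vanishes exactly when they are parallel, so lines can
  -- be compared without choosing scalars.
  cross : K × K → K × K → K
  cross (a , b) (u , v) = a ⊛ v ⊖ b ⊛ u

  cross-congʳ : ∀ u {v w} → v ≈ᵛ w → cross u v ≈ cross u w
  cross-congʳ u (p , r) = +-cong (*-congˡ r) (-‿cong (*-congˡ p))

  cross-congˡ : ∀ {v w} u → v ≈ᵛ w → cross v u ≈ cross w u
  cross-congˡ u (p , r) = +-cong (*-congʳ p) (-‿cong (*-congʳ r))

  -- The adjugate is the adjoint for `cross` too. Hence the eigenlines of y⁻¹ z are the lines with
  -- the same image under y and z.
  cross-adj : ∀ M N v → cross ((adj M · N) ·ᵛ v) v ≈ cross (N ·ᵛ v) (M ·ᵛ v)
  cross-adj (mat a b c d) (mat x y z w) (u , v) = solve 10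
    (λ a b c d x y z w u v →
      ((d :* x :+ :- b :* z) :* u :+ (d :* y :+ :- b :* w) :* v) :* v
        :- ((:- c :* x :+ a :* z) :* u :+ (:- c :* y :+ a :* w) :* v) :* u
      := (x :* u :+ y :* v) :* (c :* u :+ d :* v) :- (z :* u :+ w :* v) :* (a :* u :+ b :* v))
    ≈-refl a b c d x y z w u v

  -- Homogeneous coordinates on the projective line, with point zero at infinity.
  point : Fin (suc q) → K × K
  point zero    = 0# , 1#
  point (suc i) = 1# , to i

  point-≉0 : ∀ m → ¬ point m ≈ᵛ 0ᵛ
  point-≉0 zero    (_ , 1≈0) = 1≉0 1≈0
  point-≉0 (suc i) (1≈0 , _) = 1≉0 1≈0

  ·ᵛ-≉0 : ∀ M → HasDet1 M → ∀ {v} → ¬ v ≈ᵛ 0ᵛ → ¬ M ·ᵛ v ≈ᵛ 0ᵛ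
  ·ᵛ-≉0 (mat a b c d) det≈1 {u , v} v≉0 (eq₁ , eq₂) = v≉0
    ( combination₃ d (⊖ b) (⊖ u)
        (solve 6 (λ a b c d u v → u :- con (+ 0) := d :* (a :* u :+ b :* v :- con (+ 0))
          :+ (:- b :* (c :* u :+ d :* v :- con (+ 0)) :+ :- u :* ((a :* d :- b :* c) :- con
              (+ 1)))) ≈-refl a b c d u v)
        eq₁ eq₂ det≈1
    , combination₃ (⊖ c) a (⊖ v)
        (solve 6 (λ a b c d u v → v :- con (+ 0) := :- c :* (a :* u :+ b :* v :- con (+ 0))
          :+ (a :* (c :* u :+ d :* v :- con (+ 0)) :+ :- v :* ((a :* d :- b :* c) :- con (+ 1)))) ≈-refl a b c d u v)
        eq₁ eq₂ det≈1)

  cross-point : ∀ l m → cross (point l) (point m) ≈ 0# → m ≡ l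
  cross-point zero    zero    _  = refl
  cross-point zero    (suc j) eq = contradiction (combination₁ (⊖ 1#)
    (solve 1 (λ y → con (+ 1) :- con (+ 0) := :- con (+ 1) :* ((con (+ 0) :* y :- con (+ 1) :* con (+ 1)) :- con
        (+ 0)))
      ≈-refl (to j)) eq) 1≉0
  cross-point (suc i) zero    eq = contradiction (combination₁ 1#
    (solve 1 (λ x → con (+ 1) :- con (+ 0) := con (+ 1) :* ((con (+ 1) :* con (+ 1) :- x :* con (+ 0)) :- con (+ 0)))
      ≈-refl (to i)) eq) 1≉0
  cross-point (suc i) (suc j) eq = cong suc (to-injective (combination₁ 1#
    (solve 2 (λ x y → y :- x := con (+ 1) :* ((con (+ 1) :* y :- x :* con (+ 1)) :- con (+ 0)))
      ≈-refl (to i) (to j)) eq))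

  direction : ∀ v → ¬ v ≈ᵛ 0ᵛ → ∃₂ λ m s → ¬ s ≈ 0# × (s ⊛ proj₁ (point m) , s ⊛ proj₂ (point m)) ≈ᵛ v
  direction (a , b) v≉0 with a ≈? 0#
  ... | yes a≈0 = zero , b , (λ b≈0 → v≉0 (a≈0 , b≈0)) ,
        trans (zeroʳ b) (sym a≈0) , *-identityʳ b
  ... | no  a≉0 = let a⁻¹ , inv = invert a≉0 in
        suc (from (a⁻¹ ⊛ b)) , a , a≉0 , *-identityʳ a ,
        trans (*-congˡ (to-from _)) (trans (sym (*-assoc a a⁻¹ b)) (trans (*-congʳ inv) (*-identityˡ b)))

  -- Exactly one point is parallel to u, and it contributes 1 or 0 according to v. The left side is
  -- an entry of a Gram matrix, so this exhibits the relation of being parallel as positive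
  -- semidefinite.
  sum-parallel : ∀ u v → ¬ u ≈ᵛ 0ᵛ →
    sum (λ m → 𝟏 (cross u (point m) ≈? 0#) * 𝟏 (cross v (point m) ≈? 0#)) ≡ 𝟏 (cross v u ≈? 0#)
  sum-parallel u v u≉0 = let m , s , s≉0 , (eq₁ , eq₂) = direction u u≉0 in
    ≡.trans
      (sum-δ (λ l → cross u (point l) ≈? 0#) m
        (trans (cross-congˡ (point m) (sym eq₁ , sym eq₂))
          (solve 3 (λ s x y → s :* x :* y :- s :* y :* x := con (+ 0)) ≈-refl s _ _))
        (λ l eq → cross-point m l (*-zero⇒zeroʳ s≉0 (trans
          (solve 5 (λ s x y z w → s :* (x :* w :- y :* z) := s :* x :* w :- s :* y :* z) ≈-refl s _ _ _ _)
          (trans (cross-congˡ (point l) (eq₁ , eq₂)) eq))))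
        (λ l → 𝟏 (cross v (point l) ≈? 0#)))
      (𝟏-⇔ (cross v (point m) ≈? 0#) (cross v u ≈? 0#)
        (λ eq → trans (cross-congʳ v (sym eq₁ , sym eq₂))
          (trans (sym (scale v s (point m))) (trans (*-congˡ eq) (zeroʳ s))))
        (λ eq → *-zero⇒zeroʳ s≉0 (trans (scale v s (point m)) (trans (cross-congʳ v (eq₁ , eq₂)) eq))))
    where
    scale : ∀ v s w → s ⊛ cross v w ≈ cross v (s ⊛ proj₁ w , s ⊛ proj₂ w)
    scale (x , y) s (z , w) =
      solve 5 (λ s x y z w → s :* (x :* w :- y :* z) := x :* (s :* w) :- y :* (s :* z)) ≈-refl s x y z w

  -- The map x ↦ x + l (cross w x) w.
  shear : K × K → K → Matrix
  shear (u , v) l = mat (1# ⊖ l ⊛ (u ⊛ v)) (l ⊛ (u ⊛ u)) (⊖ (l ⊛ (v ⊛ v))) (1# ⊕ l ⊛ (u ⊛ v))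

  shear-det : ∀ w l → HasDet1 (shear w l)
  shear-det (u , v) l = solve 3 (λ u v l →
    (con (+ 1) :- l :* (u :* v)) :* (con (+ 1) :+ l :* (u :* v)) :- l :* (u :* u) :* :- (l :* (v :* v)) := con (+ 1))
    ≈-refl u v l

  shear-tr : ∀ w l → tr (shear w l) ≈ 2#
  shear-tr (u , v) l = solve 3 (λ u v l →
    (con (+ 1) :- l :* (u :* v)) :+ (con (+ 1) :+ l :* (u :* v)) := con (+ 2)) ≈-refl u v l

  Fixes : K × K → Matrix → Set ℓ₁
  Fixes w x = x ·ᵛ w ≈ᵛ w

  abstract
    fixes? : ∀ w x → Dec (Fixes w x)
    fixes? (u , v) (mat a b c d) = (a ⊛ u ⊕ b ⊛ v ≈? u) Dec.×-dec (c ⊛ u ⊕ d ⊛ v ≈? v)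

  ·ᵛ-congˡ : ∀ {M N} w → M ≋ N → M ·ᵛ w ≈ᵛ N ·ᵛ w
  ·ᵛ-congˡ w (p , q , r , s) = +-cong (*-congʳ p) (*-congʳ q) , +-cong (*-congʳ r) (*-congʳ s)

  shear-fixes : ∀ w l → Fixes w (shear w l)
  shear-fixes (u , v) l =
    solve 3 (λ u v l → (con (+ 1) :- l :* (u :* v)) :* u :+ l :* (u :* u) :* v := u) ≈-refl u v l ,
    solve 3 (λ u v l → :- (l :* (v :* v)) :* u :+ (con (+ 1) :+ l :* (u :* v)) :* v := v) ≈-refl u v l

  -- In a basis beginning with `point m`, a matrix of determinant 1 fixing that point is
  -- unitriangular and has one free parameter: -c for the point at infinity, b for the others.
  fixes⇒shear : ∀ m x → HasDet1 x → Fixes (point m) x → ∃ λ l → x ≋ shear (point m) l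
  fixes⇒shear zero (mat a b c d) det≈1 (eq₁ , eq₂) = ⊖ c ,
    combination₃ 1# c (⊖ a)
      (solve 4 (λ a b c d → a :- (con (+ 1) :- :- c :* (con (+ 0) :* con (+ 1)))
        := con (+ 1) :* ((a :* d :- b :* c) :- con (+ 1)) :+ (c :* ((a :* con (+ 0) :+ b :* con (+ 1)) :- con (+ 0))
           :+ :- a :* ((c :* con (+ 0) :+ d :* con (+ 1)) :- con (+ 1)))) ≈-refl a b c d) det≈1 eq₁ eq₂ ,
    combination₁ 1# (solve 3 (λ a b c → b :- :- c :* (con (+ 0) :* con (+ 0))
        := con (+ 1) :* ((a :* con (+ 0) :+ b :* con (+ 1)) :- con (+ 0))) ≈-refl a b c) eq₁ ,
    solve 1 (λ c → c := :- (:- c :* (con (+ 1) :* con (+ 1)))) ≈-refl c ,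
    combination₁ 1# (solve 2 (λ c d → d :- (con (+ 1) :+ :- c :* (con (+ 0) :* con (+ 1)))
        := con (+ 1) :* ((c :* con (+ 0) :+ d :* con (+ 1)) :- con (+ 1))) ≈-refl c d) eq₂
  fixes⇒shear (suc i) (mat a b c d) det≈1 (eq₁ , eq₂) = b ,
    combination₁ 1# (solve 3 (λ a b m → a :- (con (+ 1) :- b :* (con (+ 1) :* m))
        := con (+ 1) :* ((a :* con (+ 1) :+ b :* m) :- con (+ 1))) ≈-refl a b m) eq₁ ,
    solve 1 (λ b → b := b :* (con (+ 1) :* con (+ 1))) ≈-refl b ,
    combination₃ (⊖ m) (m ⊛ d) (1# ⊖ m ⊛ b)
      (solve 5 (λ a b c d m → c :- :- (b :* (m :* m))
        := :- m :* ((a :* d :- b :* c) :- con (+ 1)) :+ (m :* d :* ((a :* con (+ 1) :+ b :* m) :- con (+ 1))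
           :+ (con (+ 1) :- m :* b) :* ((c :* con (+ 1) :+ d :* m) :- m))) ≈-refl a b c d m) det≈1 eq₁ eq₂ ,
    combination₃ 1# (⊖ d) b
      (solve 5 (λ a b c d m → d :- (con (+ 1) :+ b :* (con (+ 1) :* m))
        := con (+ 1) :* ((a :* d :- b :* c) :- con (+ 1)) :+ (:- d :* ((a :* con (+ 1) :+ b :* m) :- con (+ 1))
           :+ b :* ((c :* con (+ 1) :+ d :* m) :- m))) ≈-refl a b c d m) det≈1 eq₁ eq₂
    where m = to i

  shear-injective : ∀ m {l l′} → shear (point m) l ≋ shear (point m) l′ → l ≈ l′
  shear-injective zero {l} {l′} (_ , _ , eq , _) = combination₁ (⊖ 1#) (solve 2 (λ l l′ → l :- l′
    := :- con (+ 1) :* (:- (l :* (con (+ 1) :* con (+ 1))) :- :- (l′ :* (con (+ 1) :* con (+ 1))))) ≈-refl l l′) eq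
  shear-injective (suc i) {l} {l′} (_ , eq , _ , _) = combination₁ 1# (solve 2 (λ l l′ → l :- l′
    := con (+ 1) :* (l :* (con (+ 1) :* con (+ 1)) :- l′ :* (con (+ 1) :* con (+ 1)))) ≈-refl l l′) eq

  shear-congʳ : ∀ w {l l′} → l ≈ l′ → shear w l ≋ shear w l′
  shear-congʳ w eq = +-congˡ (-‿cong (*-congʳ eq)) , *-congʳ eq , -‿cong (*-congʳ eq) , +-congˡ (*-congʳ eq)

  sum-shear : ∀ m x → HasDet1 x → sum (λ i → 𝟏 (x ≋? shear (point m) (to i))) ≡ 𝟏 (fixes? (point m) x)
  sum-shear m x det≈1 with fixes? (point m) x
  ... | yes fixes = let l , x≋ = fixes⇒shear m x det≈1 fixes in
        sum-𝟏-unique (λ i → x ≋? shear (point m) (to i)) (from l)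
          (≋-trans x≋ (shear-congʳ (point m) (sym (to-from l))))
          (λ j eq → to-injective (trans (shear-injective m (≋-trans (≋-sym eq) x≋)) (sym (to-from l))))
  ... | no ¬fixes = sum-zero (λ i → 𝟏-no (x ≋? shear (point m) (to i)) (λ eq → ¬fixes (shear-fixed eq)))
    where
    shear-fixed : ∀ {l} → x ≋ shear (point m) l → Fixes (point m) x
    shear-fixed {l} eq = let p , r = ·ᵛ-congˡ (point m) eq ; p′ , r′ = shear-fixes (point m) l in
      trans p p′ , trans r r′

  fixes⇒tr≈2 : ∀ m x → HasDet1 x → Fixes (point m) x → tr x ≈ 2#
  fixes⇒tr≈2 m x det≈1 fixes = let l , eq = fixes⇒shear m x det≈1 fixes in
    trans (tr-cong eq) (shear-tr (point m) l)

  -- For b = 0 the entry a is a root of the characteristic polynomial X² - 2 X + 1 = (X - 1)².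
  e₁₂≈0⇒e₁₁≈1 : ∀ x → HasDet1 x → tr x ≈ 2# → Matrix.e₁₂ x ≈ 0# → Matrix.e₁₁ x ≈ 1#
  e₁₂≈0⇒e₁₁≈1 (mat a b c d) det≈1 tr≈2 b≈0 = x⊖y≈0⇒x≈y (square-zero (combination₃ a (⊖ 1#) (⊖ c)
    (solve 4 (λ a b c d → (a :- con (+ 1)) :* (a :- con (+ 1)) :- con (+ 0) := a :* ((a :+ d) :- con (+ 2))
      :+ (:- con (+ 1) :* ((a :* d :- b :* c) :- con (+ 1)) :+ :- c :* (b :- con (+ 0)))) ≈-refl a b c d)
    tr≈2 det≈1 b≈0))

  e₁₂≈0⇒e₂₂≈1 : ∀ x → HasDet1 x → tr x ≈ 2# → Matrix.e₁₂ x ≈ 0# → Matrix.e₂₂ x ≈ 1#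
  e₁₂≈0⇒e₂₂≈1 x@(mat a b c d) det≈1 tr≈2 b≈0 = combination₂ 1# (⊖ 1#)
    (solve 2 (λ a d → d :- con (+ 1) := con (+ 1) :* ((a :+ d) :- con (+ 2)) :+ :- con (+ 1) :* (a :- con (+ 1)))
      ≈-refl a d) tr≈2 (e₁₂≈0⇒e₁₁≈1 x det≈1 tr≈2 b≈0)

  -- An element of trace 2 other than the identity fixes exactly one line.
  sum-fixes : ∀ x → HasDet1 x →
    sum (λ m → 𝟏 (fixes? (point m) x)) ≡ 𝟏 (tr x ≈? 2#) + ι q * 𝟏 (x ≋? 𝟙)
  sum-fixes x@(mat a b c d) det≈1 with tr x ≈? 2#
  ... | no  tr≉2 = ≡.trans
        (sum-zero (λ m → 𝟏-no (fixes? (point m) x) (tr≉2 ∘ fixes⇒tr≈2 m x det≈1)))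
        (≡.sym (≡.trans (ℚ.+-identityˡ _) (≡.trans
          (cong (ι q *_) (𝟏-no (x ≋? 𝟙) (tr≉2 ∘ tr-cong))) (ℚ.*-zeroʳ (ι q)))))
  ... | yes tr≈2 with b ≈? 0#
  ...   | no b≉0 = ≡.trans
          (sum-𝟏-unique (λ m → fixes? (point m) x) (suc (from m₀)) fixes₀ unique)
          (not-𝟙 (λ (_ , b≈0 , _) → b≉0 b≈0))
    where
    b⁻¹ = proj₁ (invert b≉0)
    bb⁻¹≈1 = proj₂ (invert b≉0)
    -- The solution m of a + b m = 1, the first coordinate of the fixing condition; trace and
    -- determinant give the second.
    m₀ = (1# ⊖ a) ⊛ b⁻¹
    not-𝟙 : ¬ x ≋ 𝟙 → 1ℚ ≡ 1ℚ + ι q * 𝟏 (x ≋? 𝟙)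
    not-𝟙 x≉𝟙 = ≡.sym (≡.trans (cong (λ s → 1ℚ + s) (≡.trans
      (cong (ι q *_) (𝟏-no (x ≋? 𝟙) x≉𝟙)) (ℚ.*-zeroʳ (ι q)))) (ℚ.+-identityʳ 1ℚ))
    fixes₀ : Fixes (point (suc (from m₀))) x
    fixes₀ =
      trans (+-congˡ (*-congˡ (to-from m₀))) (combination₁ (1# ⊖ a)
        (solve 3 (λ a b b⁻¹ → (a :* con (+ 1) :+ b :* ((con (+ 1) :- a) :* b⁻¹)) :- con (+ 1)
          := (con (+ 1) :- a) :* (b :* b⁻¹ :- con (+ 1))) ≈-refl a b b⁻¹) bb⁻¹≈1) ,
      trans (+-congˡ (*-congˡ (to-from m₀))) (trans (combination₃ (⊖ c) b⁻¹ (⊖ b⁻¹)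
        (solve 5 (λ a b c d b⁻¹ → (c :* con (+ 1) :+ d :* ((con (+ 1) :- a) :* b⁻¹)) :- (con (+ 1) :- a) :* b⁻¹
          := :- c :* (b :* b⁻¹ :- con (+ 1)) :+ (b⁻¹ :* ((a :+ d) :- con (+ 2))
             :+ :- b⁻¹ :* ((a :* d :- b :* c) :- con (+ 1)))) ≈-refl a b c d b⁻¹) bb⁻¹≈1 tr≈2 det≈1)
        (sym (to-from m₀)))
    unique : ∀ m → Fixes (point m) x → m ≡ suc (from m₀)
    unique zero    (eq , _) = contradiction (combination₁ 1#
      (solve 2 (λ a b → b :- con (+ 0) := con (+ 1) :* ((a :* con (+ 0) :+ b :* con (+ 1)) :- con (+ 0)))
        ≈-refl a b) eq) b≉0
    unique (suc i) (eq , _) = cong suc (to-injective (trans (combination₂ b⁻¹ (⊖ to i)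
      (solve 4 (λ a b b⁻¹ m → m :- (con (+ 1) :- a) :* b⁻¹ := b⁻¹ :* ((a :* con (+ 1) :+ b :* m) :- con (+ 1))
        :+ :- m :* (b :* b⁻¹ :- con (+ 1))) ≈-refl a b b⁻¹ (to i)) eq bb⁻¹≈1) (sym (to-from m₀))))
  ...   | yes b≈0 with c ≈? 0#
  -- Here x is the identity, which fixes all q + 1 points: the one expected and q more.
  ...     | yes c≈0 = ≡.trans
            (≡.trans (Σℚ.sum-cong-≗ (λ m → 𝟏-yes (fixes? (point m) x) (fixes (point m)))) (sum-const (suc q) 1ℚ))
            (≡.trans (ℚ.*-identityʳ (ι (suc q))) (≡.trans (ι-suc q)
              (≡.sym (cong (λ s → 1ℚ + s) (≡.trans (cong (ι q *_) (𝟏-yes (x ≋? 𝟙) x≋𝟙)) (ℚ.*-identityʳ (ι q)))))))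
    where
    x≋𝟙 : x ≋ 𝟙
    x≋𝟙 = e₁₂≈0⇒e₁₁≈1 x det≈1 tr≈2 b≈0 , b≈0 , c≈0 , e₁₂≈0⇒e₂₂≈1 x det≈1 tr≈2 b≈0
    fixes : ∀ w → Fixes w x
    fixes w@(u , v) = let p , r = ·ᵛ-congˡ w x≋𝟙 in
      trans p (solve 2 (λ u v → con (+ 1) :* u :+ con (+ 0) :* v := u) ≈-refl u v) ,
      trans r (solve 2 (λ u v → con (+ 0) :* u :+ con (+ 1) :* v := v) ≈-refl u v)
  ...     | no c≉0 = ≡.trans (sum-𝟏-unique (λ m → fixes? (point m) x) zero fixes₀ unique)
            (≡.sym (≡.trans (cong (λ s → 1ℚ + s) (≡.trans
              (cong (ι q *_) (𝟏-no (x ≋? 𝟙) (λ (_ , _ , c≈0 , _) → c≉0 c≈0))) (ℚ.*-zeroʳ (ι q)))) (ℚ.+-identityʳ 1ℚ)))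
    where
    d≈1 = e₁₂≈0⇒e₂₂≈1 x det≈1 tr≈2 b≈0
    fixes₀ : Fixes (point zero) x
    fixes₀ =
      trans (solve 2 (λ a b → a :* con (+ 0) :+ b :* con (+ 1) := b) ≈-refl a b) b≈0 ,
      trans (solve 2 (λ c d → c :* con (+ 0) :+ d :* con (+ 1) := d) ≈-refl c d) d≈1
    unique : ∀ m → Fixes (point m) x → m ≡ zero
    unique zero    _        = refl
    unique (suc i) (_ , eq) = contradiction (combination₂ 1# (⊖ to i)
      (solve 3 (λ c d m → c :- con (+ 0) := con (+ 1) :* ((c :* con (+ 1) :+ d :* m) :- m)
        :+ :- m :* (d :- con (+ 1))) ≈-refl c d (to i)) eq d≈1) c≉0

  -- The characteristic polynomial is (X - 1)², so 1 is the only eigenvalue.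
  eigen⇒fixes : ∀ m x → HasDet1 x → tr x ≈ 2# → cross (x ·ᵛ point m) (point m) ≈ 0# → Fixes (point m) x
  eigen⇒fixes zero (mat a b c d) det≈1 tr≈2 eq = b≈0 , d≈1
    where
    b≈0 : a ⊛ 0# ⊕ b ⊛ 1# ≈ 0#
    b≈0 = combination₁ 1# (solve 4 (λ a b c d → (a :* con (+ 0) :+ b :* con (+ 1)) :- con (+ 0)
      := con (+ 1) :* (((a :* con (+ 0) :+ b :* con (+ 1)) :* con (+ 1) :- (c :* con (+ 0) :+ d :* con
          (+ 1)) :* con (+ 0)) :- con (+ 0)))
      ≈-refl a b c d) eq
    d≈1 : c ⊛ 0# ⊕ d ⊛ 1# ≈ 1#
    d≈1 = x⊖y≈0⇒x≈y (square-zero (combination₃ d (⊖ 1#) (⊖ c)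
      (solve 4 (λ a b c d → ((c :* con (+ 0) :+ d :* con (+ 1)) :- con (+ 1)) :* ((c :* con (+ 0) :+ d :* con
          (+ 1)) :- con (+ 1)) :- con (+ 0)
        := d :* ((a :+ d) :- con (+ 2)) :+ (:- con (+ 1) :* ((a :* d :- b :* c) :- con (+ 1))
           :+ :- c :* ((a :* con (+ 0) :+ b :* con (+ 1)) :- con (+ 0)))) ≈-refl a b c d)
      tr≈2 det≈1 b≈0))
  eigen⇒fixes (suc i) (mat a b c d) det≈1 tr≈2 eq = value≈1 , combination₂ m (⊖ 1#)
      (solve 5 (λ a b c d m → (c :* con (+ 1) :+ d :* m) :- m
        := m :* ((a :* con (+ 1) :+ b :* m) :- con (+ 1))
           :+ :- con (+ 1) :* (((a :* con (+ 1) :+ b :* m) :* m :- (c :* con (+ 1) :+ d :* m) :* con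
               (+ 1)) :- con (+ 0)))
        ≈-refl a b c d m) value≈1 eq
    where
    m = to i
    value≈1 : a ⊛ 1# ⊕ b ⊛ m ≈ 1#
    value≈1 = x⊖y≈0⇒x≈y (square-zero (combination₃ (a ⊕ m ⊛ b) (⊖ 1#) b
      (solve 5 (λ a b c d m → ((a :* con (+ 1) :+ b :* m) :- con (+ 1)) :* ((a :* con (+ 1) :+ b :* m) :- con
          (+ 1)) :- con (+ 0)
        := (a :+ m :* b) :* ((a :+ d) :- con (+ 2)) :+ (:- con (+ 1) :* ((a :* d :- b :* c) :- con (+ 1))
           :+ b :* (((a :* con (+ 1) :+ b :* m) :* m :- (c :* con (+ 1) :+ d :* m) :* con (+ 1)) :- con (+ 0))))
        ≈-refl a b c d m) tr≈2 det≈1 eq))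

  fixes⇒eigen : ∀ w x → Fixes w x → cross (x ·ᵛ w) w ≈ 0#
  fixes⇒eigen w@(u , v) x fixes = trans (cross-congˡ w fixes)
    (solve 2 (λ u v → u :* v :- v :* u := con (+ 0)) ≈-refl u v)

-- Quadratic forms over ℚ

quadratic-cong : ∀ {n} {N N′ : Fin n → Fin n → ℚ} w → (∀ j k → N j k ≡ N′ j k) → quadratic N w ≡ quadratic N′ w
quadratic-cong w eq = Σℚ.sum-cong-≗ (λ j → Σℚ.sum-cong-≗ (λ k → cong (w j * w k *_) (eq j k)))

quadratic-+ : ∀ {n} (N N′ : Fin n → Fin n → ℚ) w →
  quadratic (λ j k → N j k + N′ j k) w ≡ quadratic N w + quadratic N′ w
quadratic-+ N N′ w = ≡.trans
  (Σℚ.sum-cong-≗ (λ j → ≡.trans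
    (Σℚ.sum-cong-≗ (λ k → ℚ.*-distribˡ-+ (w j * w k) (N j k) (N′ j k)))
    (Σℚ.∑-distrib-+ (λ k → w j * w k * N j k) (λ k → w j * w k * N′ j k))))
  (Σℚ.∑-distrib-+ (λ j → sum (λ k → w j * w k * N j k)) (λ j → sum (λ k → w j * w k * N′ j k)))

quadratic-sum : ∀ {m n} (N : Fin m → Fin n → Fin n → ℚ) w →
  quadratic (λ j k → sum (λ i → N i j k)) w ≡ sum (λ i → quadratic (N i) w)
quadratic-sum N w = begin
  sum (λ j → sum (λ k → w j * w k * sum (λ i → N i j k)))
    ≡⟨ Σℚ.sum-cong-≗ (λ j → Σℚ.sum-cong-≗ (λ k → sum-*ˡ (w j * w k) (λ i → N i j k))) ⟨
  sum (λ j → sum (λ k → sum (λ i → w j * w k * N i j k)))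
    ≡⟨ Σℚ.sum-cong-≗ (λ j → Σℚ.∑-comm (λ k i → w j * w k * N i j k)) ⟩
  sum (λ j → sum (λ i → sum (λ k → w j * w k * N i j k)))
    ≡⟨ Σℚ.∑-comm (λ j i → sum (λ k → w j * w k * N i j k)) ⟩
  sum (λ i → quadratic (N i) w) ∎
  where open ≡-Reasoning

quadratic-scalar : ∀ {n} p (w : Vector ℚ n) → quadratic (λ _ _ → p) w ≡ p * (sum w * sum w)
quadratic-scalar p w = begin
  sum (λ j → sum (λ k → w j * w k * p))     ≡⟨ Σℚ.sum-cong-≗ (λ j → sum-*ʳ p (λ k → w j * w k)) ⟩
  sum (λ j → sum (λ k → w j * w k) * p)     ≡⟨ sum-*ʳ p (λ j → sum (λ k → w j * w k)) ⟩
  sum (λ j → sum (λ k → w j * w k)) * p     ≡⟨ cong (_* p) (square-sum w) ⟨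
  sum w * sum w * p                         ≡⟨ ℚ.*-comm _ p ⟩
  p * (sum w * sum w)                       ∎
  where open ≡-Reasoning

quadratic-δ : ∀ {n} p (w : Vector ℚ n) → quadratic (λ j k → p * 𝟏 (k Fin.≟ j)) w ≡ p * ‖ w ‖²
quadratic-δ p w = ≡.trans (Σℚ.sum-cong-≗ diagonal) (sum-*ˡ p (λ j → w j * w j))
  where
  diagonal : ∀ j → sum (λ k → w j * w k * (p * 𝟏 (k Fin.≟ j))) ≡ p * (w j * w j)
  diagonal j = ≡.trans
    (Σℚ.sum-cong-≗ (λ k → ℚ-solve 4 (λ x y p d → x ⊠ y ⊠ (p ⊠ d)
        ≣ d ⊠ (p ⊠ (x ⊠ y))) refl (w j) (w k) p (𝟏 (k Fin.≟ j))))
    (sum-δ (λ k → k Fin.≟ j) j refl (λ _ eq → eq) (λ k → p * (w j * w k)))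

-- The case tr g ≠ 2 of the equation that closes `sum-tr≈2-tr≈2`: n is the count, p the number of
-- eigenlines of g, s = q + 1, and d the indicator of g = 𝟙.
solve-no : ∀ n q p s d → n + q * 0ℚ + p ≡ s + 0ℚ * (q * p) → d ≡ 0ℚ → n + p ≡ s + q * q * d
solve-no n q p s _ eq refl = begin
  n + p                  ≡⟨ ℚ-solve 3 (λ n q p → n ⊞ p ≣ n ⊞ q ⊠ κ 0ℚ ⊞ p) refl n q p ⟩
  n + q * 0ℚ + p         ≡⟨ eq ⟩
  s + 0ℚ * (q * p)       ≡⟨ ℚ-solve 3 (λ s q p → s ⊞ κ 0ℚ ⊠ (q ⊠ p) ≣ s ⊞ q ⊠ q ⊠ κ 0ℚ) refl s q p ⟩
  s + q * q * 0ℚ         ∎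
  where open ≡-Reasoning

-- The case tr g = 2: the eigenlines are then the fixed lines, so p - 1 = q d, and the surplus q p -
-- q becomes q² d.
solve-yes : ∀ n q p s d → n + q * 1ℚ + p ≡ s + 1ℚ * (q * p) → p ≡ 1ℚ + q * d → n + p ≡ s + q * q * d
solve-yes n q p s d eq p≡ = ℚ-Ring.+-cancelʳ q (n + p) (s + q * q * d) (begin
  n + p + q                      ≡⟨ ℚ-solve 3 (λ n q p → n ⊞ p ⊞ q ≣ n ⊞ q ⊠ κ 1ℚ ⊞ p) refl n q p ⟩
  n + q * 1ℚ + p                 ≡⟨ eq ⟩
  s + 1ℚ * (q * p)               ≡⟨ cong (λ p → s + 1ℚ * (q * p)) p≡ ⟩
  s + 1ℚ * (q * (1ℚ + q * d))
    ≡⟨ ℚ-solve 3 (λ s q d → s ⊞ κ 1ℚ ⊠ (q ⊠ (κ 1ℚ ⊞ q ⊠ d)) ≣ (s ⊞ q ⊠ q ⊠ d) ⊞ q) refl s q d ⟩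
  s + q * q * d + q              ∎)
  where open ≡-Reasoning

-- The matrix T and its square

module TraceTwo {c ℓ₁ ℓ₂} (F : HeytingField c ℓ₁ ℓ₂) {q} (|F| : HasOrder F q)
  {n} (|G| : Inverse (≡.setoid (Fin n)) (Group.setoid (Matrices.SL₂ (toCommutativeRing F)))) where
  open Shears F |F| public
  private
    module G = Inverse |G|
    module SL where
      open Group SL₂ public using (_⁻¹; _∙_; inverseˡ; inverseʳ)
      open import Algebra.Properties.Group SL₂ public using (inverseʳ-unique; ⁻¹-involutive)

  SL : Set _
  SL = Group.Carrier SL₂

  element : Fin n → SL
  element = G.to

  index : SL → Fin n
  index = G.from

  M : Fin n → Matrix
  M i = proj₁ (element i)

  M-det : ∀ i → HasDet1 (M i)
  M-det i = proj₂ (element i)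

  M-index : ∀ x → M (index x) ≋ proj₁ x
  M-index x = G.inverseˡ {x} refl

  M-injective : ∀ {i j} → M i ≋ M j → i ≡ j
  M-injective {i} {j} eq =
    ≡.trans (≡.sym (G.inverseʳ {i} {element i} ≋-refl)) (G.inverseʳ {j} {element i} eq)

  abstract
    multiply : SL → Fin n → Fin n
    multiply x i = index (x SL.∙ element i)

    M-multiply : ∀ x i → M (multiply x i) ≋ proj₁ x · M i
    M-multiply x i = M-index (x SL.∙ element i)

  -- The shears along all points run once through each element of trace 2 other than 𝟙, but meet 𝟙
  -- at each of the q + 1 points, q times too often.
  sum-tr≈2 : ∀ (f : Matrix → ℚ) → (∀ {N N′} → N ≋ N′ → f N ≡ f N′) →
    sum (λ i → 𝟏 (tr (M i) ≈? 2#) * f (M i)) + ι q * f 𝟙 ≡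
    sum (λ m → sum (λ l → f (shear (point m) (to l))))
  sum-tr≈2 f f-cong = ≡.sym (begin
    sum (λ m → sum (λ l → f (S m l)))
      ≡⟨ Σℚ.sum-cong-≗ (λ m → Σℚ.sum-cong-≗ (λ l → expand (shear (point m) (to l) , shear-det (point m) (to l)))) ⟩
    sum (λ m → sum (λ l → sum (λ i → 𝟏 (M i ≋? S m l) * f (M i))))
      ≡⟨ Σℚ.sum-cong-≗ (λ m → Σℚ.∑-comm (λ l i → 𝟏 (M i ≋? S m l) * f (M i))) ⟩
    sum (λ m → sum (λ i → sum (λ l → 𝟏 (M i ≋? S m l) * f (M i))))
      ≡⟨ Σℚ.sum-cong-≗ (λ m → Σℚ.sum-cong-≗ (λ i → ≡.trans
           (sum-*ʳ (f (M i)) (λ l → 𝟏 (M i ≋? S m l))) (cong (_* f (M i)) (sum-shear m (M i) (M-det i))))) ⟩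
    sum (λ m → sum (λ i → 𝟏 (fixes? (point m) (M i)) * f (M i)))
      ≡⟨ Σℚ.∑-comm (λ m i → 𝟏 (fixes? (point m) (M i)) * f (M i)) ⟩
    sum (λ i → sum (λ m → 𝟏 (fixes? (point m) (M i)) * f (M i)))
      ≡⟨ Σℚ.sum-cong-≗ (λ i → ≡.trans
           (sum-*ʳ (f (M i)) (λ m → 𝟏 (fixes? (point m) (M i)))) (cong (_* f (M i)) (sum-fixes (M i) (M-det i)))) ⟩
    sum (λ i → (𝟏 (tr (M i) ≈? 2#) + ι q * 𝟏 (M i ≋? 𝟙)) * f (M i))
      ≡⟨ Σℚ.sum-cong-≗ (λ i → distribute (𝟏 (tr (M i) ≈? 2#)) (ι q) (𝟏 (M i ≋? 𝟙)) (f (M i))) ⟩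
    sum (λ i → 𝟏 (tr (M i) ≈? 2#) * f (M i) + ι q * (𝟏 (M i ≋? 𝟙) * f (M i)))
      ≡⟨ Σℚ.∑-distrib-+ (λ i → 𝟏 (tr (M i) ≈? 2#) * f (M i)) (λ i → ι q * (𝟏 (M i ≋? 𝟙) * f (M i))) ⟩
    sum (λ i → 𝟏 (tr (M i) ≈? 2#) * f (M i)) + sum (λ i → ι q * (𝟏 (M i ≋? 𝟙) * f (M i)))
      ≡⟨ cong (sum (λ i → 𝟏 (tr (M i) ≈? 2#) * f (M i)) ℚ.+_)
           (≡.trans (sum-*ˡ (ι q) (λ i → 𝟏 (M i ≋? 𝟙) * f (M i))) (cong (ι q *_) (≡.sym (expand (𝟙 , det-𝟙))))) ⟩
    sum (λ i → 𝟏 (tr (M i) ≈? 2#) * f (M i)) + ι q * f 𝟙 ∎)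
    where
    open ≡-Reasoning
    S : Fin (suc q) → Fin q → Matrix
    S m l = shear (point m) (to l)
    expand : ∀ x → f (proj₁ x) ≡ sum (λ i → 𝟏 (M i ≋? proj₁ x) * f (M i))
    expand x = ≡.trans (f-cong (≋-sym (M-index x)))
      (≡.sym (sum-δ (λ i → M i ≋? proj₁ x) (index x) (M-index x)
        (λ j eq → M-injective (≋-trans eq (≋-sym (M-index x)))) (λ i → f (M i))))
    distribute : ∀ a b c d → (a + b * c) * d ≡ a * d + b * (c * d)
    distribute = ℚ-solve 4 (λ a b c d → (a ⊞ b ⊠ c) ⊠ d ≣ a ⊠ d ⊞ b ⊠ (c ⊠ d)) refl

  -- A shear is 𝟙 plus l times a matrix of rank one, so its product with g is affine in l; the slope
  -- vanishes exactly when w is an eigenvector of g or 0.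
  ⟨shear,⟩ : ∀ w l g → ⟨ shear w l , g ⟩ ≈ tr g ⊕ cross (g ·ᵛ w) w ⊛ l
  ⟨shear,⟩ (u , v) l (mat a b c d) = solve 7 (λ u v l a b c d →
    ((con (+ 1) :- l :* (u :* v)) :* d :+ (con (+ 1) :+ l :* (u :* v)) :* a) :- (l :* (u :* u) :* c :+ :- (l :*
        (v :* v)) :* b)
    := (a :+ d) :+ ((a :* u :+ b :* v) :* v :- (c :* u :+ d :* v) :* u) :* l) ≈-refl u v l a b c d

  private
    eigen : Matrix → Fin (suc q) → ℚ
    eigen g m = 𝟏 (cross (g ·ᵛ point m) (point m) ≈? 0#)

  linear-root : ∀ s {x y} t → x ⊛ y ≈ 1# → t ⊕ x ⊛ ((s ⊖ t) ⊛ y) ≈ s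
  linear-root s {x} {y} t xy≈1 = combination₁ (s ⊖ t)
    (solve 4 (λ s t x y → (t :+ x :* ((s :- t) :* y)) :- s := (s :- t) :* (x :* y :- con (+ 1))) ≈-refl s t x y)
    xy≈1

  linear-root-unique : ∀ s {x y} t l → x ⊛ y ≈ 1# → t ⊕ x ⊛ l ≈ s → l ≈ (s ⊖ t) ⊛ y
  linear-root-unique s {x} {y} t l xy≈1 eq = combination₂ y (⊖ l)
    (solve 5 (λ s t x y l → l :- (s :- t) :* y := y :* ((t :+ x :* l) :- s) :+ :- l :* (x :* y :- con (+ 1)))
      ≈-refl s t x y l)
    eq xy≈1

  -- An affine equation in l has one solution if its slope is nonzero, and otherwise q or none
  -- according to whether tr g = 2. Adding the indicator of slope 0 puts both cases into one
  -- formula.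
  sum-line : ∀ g w →
    sum (λ l → 𝟏 (⟨ shear w (to l) , g ⟩ ≈? 2#)) + 𝟏 (cross (g ·ᵛ w) w ≈? 0#) ≡
    1ℚ + 𝟏 (tr g ≈? 2#) * (ι q * 𝟏 (cross (g ·ᵛ w) w ≈? 0#))
  sum-line g w = by-cases (cross (g ·ᵛ w) w ≈? 0#)
    where
    t = 𝟏 (tr g ≈? 2#)
    by-cases : (Q? : Dec (cross (g ·ᵛ w) w ≈ 0#)) →
      sum (λ l → 𝟏 (⟨ shear w (to l) , g ⟩ ≈? 2#)) + 𝟏 Q? ≡ 1ℚ + t * (ι q * 𝟏 Q?)
    by-cases (no Q≉0) = let Q⁻¹ , QQ⁻¹≈1 = invert Q≉0 in ≡.trans
      (cong (_+ 0ℚ) (sum-𝟏-unique (λ l → ⟨ shear w (to l) , g ⟩ ≈? 2#) (from ((2# ⊖ tr g) ⊛ Q⁻¹))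
        (trans (⟨shear,⟩ w _ g) (trans (+-congˡ (*-congˡ (to-from _))) (linear-root 2# (tr g) QQ⁻¹≈1)))
        (λ j eq → to-injective (trans
          (linear-root-unique 2# (tr g) (to j) QQ⁻¹≈1 (trans (sym (⟨shear,⟩ w (to j) g)) eq)) (sym (to-from _))))))
      (≡.sym (cong (λ s → 1ℚ + s) (≡.trans (cong (t *_) (ℚ.*-zeroʳ (ι q))) (ℚ.*-zeroʳ t))))
    by-cases (yes Q≈0) = ≡.trans
      (cong (_+ 1ℚ) (≡.trans
        (Σℚ.sum-cong-≗ (λ l → 𝟏-⇔ (⟨ shear w (to l) , g ⟩ ≈? 2#) (tr g ≈? 2#)
          (trans (sym (value (to l)))) (trans (value (to l)))))
        (sum-const q t)))
      (≡.trans (ℚ.+-comm (ι q * t) 1ℚ) (cong (λ s → 1ℚ + s)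
        (≡.trans (ℚ.*-comm (ι q) t) (cong (t *_) (≡.sym (ℚ.*-identityʳ (ι q)))))))
      where
      value : ∀ l → ⟨ shear w l , g ⟩ ≈ tr g
      value l = trans (⟨shear,⟩ w l g) (trans (+-congˡ (trans (*-congʳ Q≈0) (zeroˡ l)))
        (solve 1 (λ t → t :+ con (+ 0) := t) ≈-refl (tr g)))

  -- This is T² + Π at the pair (𝟙, g). `sum-tr≈2` splits the count by points, with one affine
  -- equation for each, and `sum-fixes` supplies the number of eigenlines when tr g = 2.
  sum-tr≈2-tr≈2 : ∀ g → HasDet1 g →
    sum (λ i → 𝟏 (tr (M i) ≈? 2#) * 𝟏 (⟨ M i , g ⟩ ≈? 2#)) + sum (eigen g) ≡ ι (suc q) + ι q * ι q * 𝟏 (g ≋? 𝟙)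
  sum-tr≈2-tr≈2 g det≈1 = conclude (tr g ≈? 2#) (begin
    N + ι q * 𝟏 (tr g ≈? 2#) + Π
      ≡⟨ cong (λ s → N + ι q * s + Π) (𝟏-⇔ (tr g ≈? 2#) (⟨ 𝟙 , g ⟩ ≈? 2#) (trans ⟨𝟙,g⟩) (trans (sym ⟨𝟙,g⟩))) ⟩
    N + ι q * f 𝟙 + Π
      ≡⟨ cong (_+ Π) (sum-tr≈2 f f-cong) ⟩
    sum (λ m → sum (λ l → f (shear (point m) (to l)))) + Π
      ≡⟨ Σℚ.∑-distrib-+ (λ m → sum (λ l → f (shear (point m) (to l)))) (eigen g) ⟨
    sum (λ m → sum (λ l → f (shear (point m) (to l))) + eigen g m)
      ≡⟨ Σℚ.sum-cong-≗ (λ m → sum-line g (point m)) ⟩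
    sum (λ m → 1ℚ + 𝟏 (tr g ≈? 2#) * (ι q * eigen g m))
      ≡⟨ sum-affine (𝟏 (tr g ≈? 2#)) ⟩
    ι (suc q) + 𝟏 (tr g ≈? 2#) * (ι q * Π) ∎)
    where
    open ≡-Reasoning
    f : Matrix → ℚ
    f x = 𝟏 (⟨ x , g ⟩ ≈? 2#)
    f-cong : ∀ {x y} → x ≋ y → f x ≡ f y
    f-cong {x} {y} eq = 𝟏-⇔ (⟨ x , g ⟩ ≈? 2#) (⟨ y , g ⟩ ≈? 2#)
      (trans (⟨⟩-cong {y} {x} {g} (≋-sym {x} {y} eq) ≋-refl)) (trans (⟨⟩-cong {x} {y} {g} eq ≋-refl))
    N = sum (λ i → 𝟏 (tr (M i) ≈? 2#) * f (M i))
    Π = sum (eigen g)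
    ⟨𝟙,g⟩ : ⟨ 𝟙 , g ⟩ ≈ tr g
    ⟨𝟙,g⟩ = trans (⟨⟩-sym 𝟙 g) (⟨,𝟙⟩ g)
    sum-affine : ∀ t → sum (λ m → 1ℚ + t * (ι q * eigen g m)) ≡ ι (suc q) + t * (ι q * Π)
    sum-affine t = ≡.trans (Σℚ.∑-distrib-+ {suc q} (λ m → 1ℚ) (λ m → t * (ι q * eigen g m)))
      (cong₂ _+_ (≡.trans (sum-const (suc q) 1ℚ) (ℚ.*-identityʳ (ι (suc q))))
           (≡.trans (sum-*ˡ t (λ m → ι q * eigen g m)) (cong (t *_) (sum-*ˡ (ι q) (eigen g)))))
    Π≡ : tr g ≈ 2# → Π ≡ 1ℚ + ι q * 𝟏 (g ≋? 𝟙)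
    Π≡ tr≈2 = begin
      Π
        ≡⟨ Σℚ.sum-cong-≗ (λ m → 𝟏-⇔ (cross (g ·ᵛ point m) (point m) ≈? 0#) (fixes? (point m) g)
             (eigen⇒fixes m g det≈1 tr≈2) (fixes⇒eigen (point m) g)) ⟩
      sum (λ m → 𝟏 (fixes? (point m) g))       ≡⟨ sum-fixes g det≈1 ⟩
      𝟏 (tr g ≈? 2#) + ι q * 𝟏 (g ≋? 𝟙)        ≡⟨ cong (_+ ι q * 𝟏 (g ≋? 𝟙)) (𝟏-yes (tr g ≈? 2#) tr≈2) ⟩
      1ℚ + ι q * 𝟏 (g ≋? 𝟙)                    ∎
    conclude : (t? : Dec (tr g ≈ 2#)) → N + ι q * 𝟏 t? + Π ≡ ι (suc q) + 𝟏 t? * (ι q * Π) →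
      N + Π ≡ ι (suc q) + ι q * ι q * 𝟏 (g ≋? 𝟙)
    conclude (no tr≉2)  eq = solve-no N (ι q) Π (ι (suc q)) (𝟏 (g ≋? 𝟙)) eq (𝟏-no (g ≋? 𝟙) (tr≉2 ∘ tr-cong {g} {𝟙}))
    conclude (yes tr≈2) eq = solve-yes N (ι q) Π (ι (suc q)) (𝟏 (g ≋? 𝟙)) eq (Π≡ tr≈2)

  T : Fin n → Fin n → ℚ
  T i j = 𝟏 (⟨ M i , M j ⟩ ≈? 2#)

  T-sym : ∀ i j → T i j ≡ T j i
  T-sym i j = 𝟏-⇔ (⟨ M i , M j ⟩ ≈? 2#) (⟨ M j , M i ⟩ ≈? 2#)
    (trans (⟨⟩-sym (M j) (M i))) (trans (⟨⟩-sym (M i) (M j)))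

  parallel : Fin n → Fin n → Fin (suc q) → ℚ
  parallel j k m = 𝟏 (cross (M k ·ᵛ point m) (M j ·ᵛ point m) ≈? 0#)

  -- Left translation by the inverse of y moves the pair (y, z) to (𝟙, y⁻¹ z) without changing the
  -- form.
  gram-T : ∀ j k → gram T j k + sum (parallel j k) ≡ ι (suc q) + ι q * ι q * 𝟏 (k Fin.≟ j)
  gram-T j k = begin
    gram T j k + sum (parallel j k)
      ≡⟨ cong₂ _+_ translate (Σℚ.sum-cong-≗ adjoint) ⟩
    sum (λ i → 𝟏 (tr (M i) ≈? 2#) * 𝟏 (⟨ M i , g ⟩ ≈? 2#)) + sum (eigen g)
      ≡⟨ sum-tr≈2-tr≈2 g (proj₂ g′) ⟩
    ι (suc q) + ι q * ι q * 𝟏 (g ≋? 𝟙)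
      ≡⟨ cong (λ s → ι (suc q) + ι q * ι q * s) (𝟏-⇔ (g ≋? 𝟙) (k Fin.≟ j) g≋𝟙⇒k≡j
           (λ { refl → SL.inverseˡ (element j) })) ⟩
    ι (suc q) + ι q * ι q * 𝟏 (k Fin.≟ j) ∎
    where
    open ≡-Reasoning
    y = element j
    z = element k
    g′ : SL
    g′ = y SL.⁻¹ SL.∙ z
    g = proj₁ g′
    g≋𝟙⇒k≡j : g ≋ 𝟙 → k ≡ j
    g≋𝟙⇒k≡j eq = M-injective (≋-trans (SL.inverseʳ-unique (y SL.⁻¹) z eq) (SL.⁻¹-involutive y))
    adjoint : ∀ m → parallel j k m ≡ eigen g m
    adjoint m = 𝟏-⇔ (cross (M k ·ᵛ point m) (M j ·ᵛ point m) ≈? 0#) (cross (g ·ᵛ point m) (point m) ≈? 0#)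
      (trans (cross-adj (M j) (M k) (point m))) (trans (sym (cross-adj (M j) (M k) (point m))))
    undo : ∀ x y → proj₁ x · proj₁ y ≋ 𝟙 → ∀ i → multiply x (multiply y i) ≡ i
    undo x y eq i = M-injective (≋-trans {M (multiply x (multiply y i))} (M-multiply x (multiply y i))
      (≋-trans {proj₁ x · M (multiply y i)} {proj₁ x · proj₁ y · M i} {M i}
        (·-cong (≋-refl {proj₁ x}) (M-multiply y i))
        (≋-trans {proj₁ x · proj₁ y · M i} {(proj₁ x · proj₁ y) · M i} {M i}
          (≋-sym {(proj₁ x · proj₁ y) · M i} (·-assoc (proj₁ x) (proj₁ y) (M i)))
          (≋-trans {(proj₁ x · proj₁ y) · M i} {𝟙 · M i} {M i}
            (·-cong {proj₁ x · proj₁ y} {𝟙} {M i} {M i} eq (≋-refl {M i})) (·-identityˡ (M i))))))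
    shift : Permutation n n
    shift = permutation (multiply y) (multiply (y SL.⁻¹))
      (undo y (y SL.⁻¹) (SL.inverseʳ y)) (undo (y SL.⁻¹) y (SL.inverseˡ y))
    shifted : ∀ i N → ⟨ M (multiply y i) , N ⟩ ≈ ⟨ M i , adj (M j) · N ⟩
    shifted i N = trans (⟨⟩-cong {M (multiply y i)} {M j · M i} {N} {N} (M-multiply y i) (≋-refl {N}))
      (⟨·,⟩ (M j) (M i) N)
    shifted-self : ∀ i → ⟨ M (multiply y i) , M j ⟩ ≈ tr (M i)
    shifted-self i = trans (shifted i (M j))
      (trans (⟨⟩-cong {M i} {M i} {adj (M j) · M j} {𝟙} (≋-refl {M i}) (SL.inverseˡ y)) (⟨,𝟙⟩ (M i)))
    translate : gram T j k ≡ sum (λ i → 𝟏 (tr (M i) ≈? 2#) * 𝟏 (⟨ M i , g ⟩ ≈? 2#))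
    translate = ≡.trans (Σℚ.sum-permute (λ i → T i j * T i k) shift) (Σℚ.sum-cong-≗ (λ i → cong₂ _*_
      (𝟏-⇔ (⟨ M (multiply y i) , M j ⟩ ≈? 2#) (tr (M i) ≈? 2#)
        (trans (sym (shifted-self i))) (trans (shifted-self i)))
      (𝟏-⇔ (⟨ M (multiply y i) , M k ⟩ ≈? 2#) (⟨ M i , g ⟩ ≈? 2#)
        (trans (sym (shifted i (M k)))) (trans (shifted i (M k))))))

  -- The diagonal case of `gram-T`: entries 0 and 1 equal their squares, and all q + 1 points have
  -- equal images under one and the same matrix.
  sum-T : ∀ j → sum (λ i → T i j) ≡ ι q * ι q
  sum-T j = ℚ-Ring.+-cancelʳ (ι (suc q)) (sum (λ i → T i j)) (ι q * ι q) (begin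
    sum (λ i → T i j) + ι (suc q)
      ≡⟨ cong₂ _+_ (Σℚ.sum-cong-≗ (λ i → idempotent (⟨ M i , M j ⟩ ≈? 2#)))
           (≡.sym (≡.trans (Σℚ.sum-cong-≗ (λ m → 𝟏-yes (cross (M j ·ᵛ point m) (M j ·ᵛ point m) ≈? 0#)
               (cross-self _ _)))
             (≡.trans (sum-const (suc q) 1ℚ) (ℚ.*-identityʳ (ι (suc q)))))) ⟩
    gram T j j + sum (parallel j j)                ≡⟨ gram-T j j ⟩
    ι (suc q) + ι q * ι q * 𝟏 (j Fin.≟ j)         
        ≡⟨ cong (λ s → ι (suc q) + ι q * ι q * s) (𝟏-yes (j Fin.≟ j) refl) ⟩
    ι (suc q) + ι q * ι q * 1ℚ                     ≡⟨ cong (λ s → ι (suc q) + s) (ℚ.*-identityʳ (ι q * ι q)) ⟩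
    ι (suc q) + ι q * ι q                          ≡⟨ ℚ.+-comm (ι (suc q)) (ι q * ι q) ⟩
    ι q * ι q + ι (suc q)                          ∎)
    where
    open ≡-Reasoning
    idempotent : ∀ {p} {P : Set p} (d : Dec P) → 𝟏 d ≡ 𝟏 d * 𝟏 d
    idempotent (yes _) = refl
    idempotent (no _)  = refl
    cross-self : ∀ u v → cross (u , v) (u , v) ≈ 0#
    cross-self u v = solve 2 (λ u v → u :* v :- v :* u := con (+ 0)) ≈-refl u v

  ‖T∙w‖²≤ : ∀ w → ‖ T ∙ w ‖² ≤ ι (suc q) * (sum w * sum w) + ι q * ι q * ‖ w ‖²
  ‖T∙w‖²≤ w = begin
    ‖ T ∙ w ‖²                                 ≡⟨ ‖K∙w‖² T w ⟩
    quadratic (gram T) w                       ≡⟨ ℚ.+-identityʳ _ ⟨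
    quadratic (gram T) w + 0ℚ                  ≤⟨ ℚ.+-monoʳ-≤ (quadratic (gram T) w) Π-nonNeg ⟩
    quadratic (gram T) w + quadratic Π w       ≡⟨ quadratic-+ (gram T) Π w ⟨
    quadratic (λ j k → gram T j k + Π j k) w   ≡⟨ quadratic-cong w gram-T ⟩
    quadratic (λ j k → ι (suc q) + ι q * ι q * 𝟏 (k Fin.≟ j)) w
      ≡⟨ quadratic-+ (λ _ _ → ι (suc q)) (λ j k → ι q * ι q * 𝟏 (k Fin.≟ j)) w ⟩
    quadratic (λ _ _ → ι (suc q)) w + quadratic (λ j k → ι q * ι q * 𝟏 (k Fin.≟ j)) w
      ≡⟨ cong₂ _+_ (quadratic-scalar (ι (suc q)) w) (quadratic-δ (ι q * ι q) w) ⟩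
    ι (suc q) * (sum w * sum w) + ι q * ι q * ‖ w ‖² ∎
    where
    open ℚ.≤-Reasoning
    Π : Fin n → Fin n → ℚ
    Π j k = sum (parallel j k)
    -- For fixed m, column j marks the line onto which `M j` carries the point m. The Gram matrix of
    -- `D m` compares these lines, and Π is the sum of these Gram matrices over m.
    D : Fin (suc q) → Fin (suc q) → Fin n → ℚ
    D m l j = 𝟏 (cross (M j ·ᵛ point m) (point l) ≈? 0#)
    Π≡ : ∀ j k → Π j k ≡ sum (λ m → gram (D m) j k)
    Π≡ j k = Σℚ.sum-cong-≗ (λ m → ≡.sym (sum-parallel (M j ·ᵛ point m) (M k ·ᵛ point m)
      (·ᵛ-≉0 (M j) (M-det j) (point-≉0 m))))
    Π-nonNeg : 0ℚ ≤ quadratic Π w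
    Π-nonNeg = subst (0ℚ ≤_)
      (≡.trans (Σℚ.sum-cong-≗ (λ m → ‖K∙w‖² (D m) w))
        (≡.trans (≡.sym (quadratic-sum (λ m → gram (D m)) w)) (≡.sym (quadratic-cong w Π≡))))
      (sum-nonNeg (λ m → sum-nonNeg (λ l → square-nonNeg ((D m ∙ w) l))))

-- Rational inequalities, null sequences and apartness of reals

+-monoʳ-cancel-< : ∀ p {r s} → r + p < s + p → r < s
+-monoʳ-cancel-< p {r} {s} lt = subst₂ _<_ (cancel r p) (cancel s p) (ℚ.+-monoˡ-< (- p) lt)
  where
  cancel : ∀ r p → r + p + - p ≡ r
  cancel = ℚ-solve 2 (λ r p → r ⊞ p ⊟ p ≣ r) refl

*-mono-≤ : ∀ {p r s t} → 0ℚ ≤ r → 0ℚ ≤ s → p ≤ r → s ≤ t → p * s ≤ r * t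
*-mono-≤ {p} {r} {s} {t} 0≤r 0≤s p≤r s≤t = ℚ.≤-trans
  (ℚ.*-monoʳ-≤-nonNeg s {{ℚ.nonNegative 0≤s}} p≤r)
  (ℚ.*-monoˡ-≤-nonNeg r {{ℚ.nonNegative 0≤r}} s≤t)

*-monoˡ-≤ : ∀ {p r s} → 0ℚ ≤ p → r ≤ s → p * r ≤ p * s
*-monoˡ-≤ {p} 0≤p = ℚ.*-monoˡ-≤-nonNeg p {{ℚ.nonNegative 0≤p}}

*-pos : ∀ {p r} → 0ℚ < p → 0ℚ < r → 0ℚ < p * r
*-pos {p} {r} 0<p 0<r = ℚ.positive⁻¹ (p * r) {{ℚ.pos*pos⇒pos p {{ℚ.positive 0<p}} r {{ℚ.positive 0<r}}}}

*-nonNeg : ∀ {p r} → 0ℚ ≤ p → 0ℚ ≤ r → 0ℚ ≤ p * r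
*-nonNeg {p} {r} 0≤p 0≤r = ℚ.nonNegative⁻¹ (p * r) {{ℚ.nonNeg*nonNeg⇒nonNeg p {{ℚ.nonNegative 0≤p}} r {{ℚ.nonNegative 0≤r}}}}

square-mono-∣∣ : ∀ {p r} → 0ℚ ≤ p → p ≤ ∣ r ∣ → p * p ≤ r * r
square-mono-∣∣ {p} {r} 0≤p p≤∣r∣ = ℚ.≤-trans (*-mono-≤ (ℚ.0≤∣p∣ r) 0≤p p≤∣r∣ p≤∣r∣) (ℚ.≤-reflexive ∣r∣²)
  where
  ∣r∣² : ∣ r ∣ * ∣ r ∣ ≡ r * r
  ∣r∣² = ≡.trans (≡.sym (ℚ.∣p*q∣≡∣p∣*∣q∣ r r)) (ℚ.0≤p⇒∣p∣≡p (square-nonNeg r))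

p≤∣p∣ : ∀ p → p ≤ ∣ p ∣
p≤∣p∣ p with ℚ.≤-total 0ℚ p
... | inj₁ 0≤p = ℚ.≤-reflexive (≡.sym (ℚ.0≤p⇒∣p∣≡p 0≤p))
... | inj₂ p≤0 = ℚ.≤-trans p≤0 (ℚ.0≤∣p∣ p)

Eventually : (ℕ → Set) → Set
Eventually P = ∃ λ N → ∀ n → N ℕ.≤ n → P n

eventually₂ : ∀ {P Q : ℕ → Set} → Eventually P → Eventually Q → Eventually (λ n → P n × Q n)
eventually₂ (M , p) (N , r) = M ℕ.⊔ N , λ n n≥ → p n (ℕ.m⊔n≤o⇒m≤o M N n≥) , r n (ℕ.m⊔n≤o⇒n≤o M N n≥)

Null : (ℕ → ℚ) → Set
Null z = ∀ ε → 0ℚ < ε → Eventually (λ n → ∣ z n ∣ < ε)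

Null-cong : ∀ {y z} → (∀ n → y n ≡ z n) → Null y → Null z
Null-cong eq null ε 0<ε = let N , p = null ε 0<ε in N , λ n n≥ → subst (λ t → ∣ t ∣ < ε) (eq n) (p n n≥)

Null-+ : ∀ y z → Null y → Null z → Null (λ n → y n + z n)
Null-+ y z null-y null-z ε 0<ε =
  let N , p = eventually₂ (null-y _ (ℝ.Cauchy.half 0<ε)) (null-z _ (ℝ.Cauchy.half 0<ε)) in
  N , λ n n≥ → let p₁ , p₂ = p n n≥ in
    ℚ.≤-<-trans (ℚ.∣p+q∣≤∣p∣+∣q∣ (y n) (z n))
      (subst (∣ y n ∣ + ∣ z n ∣ <_) (ℝ.Cauchy.half+half ε) (ℚ.+-mono-< p₁ p₂))

Null-sum : ∀ {m} {z : Fin m → ℕ → ℚ} → (∀ i → Null (z i)) → Null (λ n → sum (λ i → z i n))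
Null-sum {zero}  null ε 0<ε = 0 , λ _ _ → 0<ε
Null-sum {suc m} {z} null = Null-+ (z zero) (λ n → sum (λ i → z (suc i) n)) (null zero) (Null-sum (null ∘ suc))

Bounded : (ℕ → ℚ) → Set
Bounded y = ∃ λ B → 0ℚ < B × Eventually (λ n → ∣ y n ∣ ≤ B)

cauchy⇒bounded : ∀ {y} → IsCauchy y → Bounded y
cauchy⇒bounded cauchy = let N , B , 0<B , ≤B = ℝ.Cauchy.bound cauchy in B , 0<B , N , ≤B

null⇒bounded : ∀ {y} → Null y → Bounded y
null⇒bounded null = let N , p = null 1ℚ (ℚ.positive⁻¹ 1ℚ) in 1ℚ , ℚ.positive⁻¹ 1ℚ , N , λ n n≥ → ℚ.<⇒≤ (p n n≥)

Null-* : ∀ y z → Bounded y → Null z → Null (λ n → y n * z n)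
Null-* y z (B , 0<B , bound) null ε 0<ε =
  let δ , 0<δ , Bδ≡ε = ℝ.Cauchy.scale 0<B 0<ε
      N , p = eventually₂ bound (null δ 0<δ)
  in N , λ n n≥ → let ∣y∣≤B , ∣z∣<δ = p n n≥ in
    subst₂ _<_ (≡.sym (ℚ.∣p*q∣≡∣p∣*∣q∣ (y n) (z n))) Bδ≡ε
      (ℚ.≤-<-trans (ℚ.*-monoʳ-≤-nonNeg ∣ z n ∣ {{ℚ.nonNegative (ℚ.0≤∣p∣ (z n))}} ∣y∣≤B)
        (ℚ.*-monoʳ-<-pos B {{ℚ.positive 0<B}} ∣z∣<δ))

Apart : (ℕ → ℚ) → Set
Apart z = ∃ λ η → 0ℚ < η × Eventually (λ n → η < z n)

-- A Cauchy sequence is decided, up to ε, by one sufficiently late term.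
small-or-apart : ∀ {z} → IsCauchy z → ∀ ε → 0ℚ < ε → Eventually (λ n → z n < ε) ⊎ Apart z
-- With threshold ε/2 and modulus ε/4, a late term below the threshold keeps all later ones below
-- 3ε/4, and any other keeps them above ε/4.
small-or-apart {z} cauchy ε 0<ε with cauchy (½ * (½ * ε)) (ℝ.Cauchy.half (ℝ.Cauchy.half 0<ε))
... | N , close with z N ℚ.<? ½ * ε
...   | yes small = inj₁ (N , λ n n≥ → begin-strict
        z n                           ≡⟨ ℝ.Cauchy.split (z n) (z N) ⟩
        z N + (z n - z N)             ≤⟨ ℚ.+-monoʳ-≤ (z N) (p≤∣p∣ (z n - z N)) ⟩
        z N + ∣ z n - z N ∣           <⟨ ℚ.+-mono-< small (close n N n≥ ℕ.≤-refl) ⟩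
        ½ * ε + ½ * (½ * ε)           <⟨ ℚ.+-monoʳ-< (½ * ε) quarter<half ⟩
        ½ * ε + ½ * ε                 ≡⟨ ℝ.Cauchy.half+half ε ⟩
        ε                             ∎)
  where
  open ℚ.≤-Reasoning
  quarter<half : ½ * (½ * ε) < ½ * ε
  quarter<half = subst₂ _<_ (ℚ.+-identityʳ (½ * (½ * ε))) (ℝ.Cauchy.half+half (½ * ε))
    (ℚ.+-monoʳ-< (½ * (½ * ε)) (ℝ.Cauchy.half (ℝ.Cauchy.half 0<ε)))
...   | no large = inj₂ (½ * (½ * ε) , ℝ.Cauchy.half (ℝ.Cauchy.half 0<ε) , N , λ n n≥ →
        +-monoʳ-cancel-< (½ * (½ * ε)) (begin-strict
          ½ * (½ * ε) + ½ * (½ * ε)   ≡⟨ ℝ.Cauchy.half+half (½ * ε) ⟩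
          ½ * ε                       ≤⟨ ℚ.≮⇒≥ large ⟩
          z N                         ≡⟨ ℝ.Cauchy.split (z N) (z n) ⟩
          z n + (z N - z n)           ≤⟨ ℚ.+-monoʳ-≤ (z n) (p≤∣p∣ (z N - z n)) ⟩
          z n + ∣ z N - z n ∣         <⟨ ℚ.+-monoʳ-< (z n) (close N n ℕ.≤-refl n≥) ⟩
          z n + ½ * (½ * ε)           ∎))
  where open ℚ.≤-Reasoning

open ℝ.ℝ

-‿cauchy : ∀ x y → IsCauchy (λ n → approx x n - approx y n)
-‿cauchy x y ε 0<ε = let N , p = cauchy (x ℝ.+ fromℚ (- 1ℚ) ℝ.* y) ε 0<ε in
  N , λ m n m≥ n≥ → subst (λ t → ∣ t ∣ < ε)
    (cong₂ _-_ (minus (approx x m) (approx y m)) (minus (approx x n) (approx y n))) (p m n m≥ n≥)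
  where
  minus : ∀ a b → a + - 1ℚ * b ≡ a - b
  minus = ℚ-solve 2 (λ a b → a ⊞ κ (- 1ℚ) ⊠ b ≣ a ⊟ b) refl

-- Since every ε is decided by `small-or-apart`, refuting apartness is enough for equality. Together
-- with `¬apart⇒≤` this takes the place of excluded middle in `eigenvalue-bound`.
¬apart⇒≃ : ∀ x y → ¬ Apart (λ n → ∣ approx x n - approx y n ∣) → x ℝ.≃ y
¬apart⇒≃ x y ¬apart ε 0<ε with small-or-apart (ℝ.Cauchy.∣∣-cauchy (λ n → approx x n - approx y n)
    (-‿cauchy x y)) ε 0<ε
... | inj₁ small = small
... | inj₂ apart = contradiction apart ¬apart

¬apart⇒≤ : ∀ x y → ¬ Apart (λ n → approx x n - approx y n) → x ℝ.≤ y
¬apart⇒≤ x y ¬apart ε 0<ε with small-or-apart (-‿cauchy x y) ε 0<ε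
... | inj₂ apart = contradiction apart ¬apart
... | inj₁ (N , p) = N , λ n n≥ → subst₂ _<_ (back (approx x n) (approx y n)) (ℚ.+-comm ε (approx y n))
        (ℚ.+-monoˡ-< (approx y n) (p n n≥))
  where
  back : ∀ a b → a - b + b ≡ a
  back = ℚ-solve 2 (λ a b → a ⊟ b ⊞ b ≣ a) refl

approx-sum : ∀ {m} (f : Vector ℝ.ℝ m) n → approx (ℝ.sum f) n ≡ sum (λ i → approx (f i) n)
approx-sum {zero}  f n = refl
approx-sum {suc m} f n = cong (approx (f zero) n ℚ.+_) (approx-sum (f ∘ suc) n)

-- With d = (k − μ) s the last two hypotheses give ϑ² X ≤ ϑ² ρ² V + C d².
estimate : ∀ {ρ δ η ϑ C X V s} μ k → 0ℚ ≤ ρ → 0ℚ < δ → 0ℚ < η → 0ℚ < ϑ → 0ℚ ≤ C →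
  ρ + δ < ∣ μ ∣ → ϑ < ∣ k - μ ∣ → η * η ≤ V → X ≤ ρ * ρ * V + C * (s * s) →
  ϑ * ϑ * (δ * δ * (η * η)) ≤ ϑ * ϑ * (μ * μ * V - X) + C * ((k - μ) * s * ((k - μ) * s))
estimate {ρ} {δ} {η} {ϑ} {C} {X} {V} {s} μ k 0≤ρ 0<δ 0<η 0<ϑ 0≤C ρ+δ<∣μ∣ ϑ<∣k-μ∣ η²≤V X≤ = begin
  ϑ * ϑ * (δ * δ * (η * η))
    ≤⟨ *-monoˡ-≤ (square-nonNeg ϑ) (*-monoˡ-≤ (square-nonNeg δ) η²≤V) ⟩
  ϑ * ϑ * (δ * δ * V)
    ≡⟨ insert (ϑ * ϑ) (δ * δ) V (ρ * ρ * V + C * (s * s)) ⟩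
  ϑ * ϑ * (δ * δ * V + (ρ * ρ * V + C * (s * s)) - (ρ * ρ * V + C * (s * s)))
    ≤⟨ *-monoˡ-≤ (square-nonNeg ϑ) (ℚ.+-monoʳ-≤ (δ * δ * V + (ρ * ρ * V + C * (s * s))) (ℚ.neg-antimono-≤ X≤)) ⟩
  ϑ * ϑ * (δ * δ * V + (ρ * ρ * V + C * (s * s)) - X)
    ≡⟨ regroup (ϑ * ϑ) (δ * δ) (ρ * ρ) V (C * (s * s)) X ⟩
  ϑ * ϑ * ((ρ * ρ + δ * δ) * V - X) + ϑ * ϑ * (C * (s * s))
    ≤⟨ ℚ.+-mono-≤
         (*-monoˡ-≤ (square-nonNeg ϑ) (ℚ.+-monoˡ-≤ (- X) (ℚ.*-monoʳ-≤-nonNeg V {{ℚ.nonNegative 0≤V}} ρ²+δ²≤μ²)))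
         (ℚ.*-monoʳ-≤-nonNeg (C * (s * s)) {{ℚ.nonNegative (*-nonNeg 0≤C (square-nonNeg s))}}
           (square-mono-∣∣ (ℚ.<⇒≤ 0<ϑ) (ℚ.<⇒≤ ϑ<∣k-μ∣))) ⟩
  ϑ * ϑ * (μ * μ * V - X) + (k - μ) * (k - μ) * (C * (s * s))
    ≡⟨ cong (λ t → ϑ * ϑ * (μ * μ * V - X) + t) (square-* (k - μ) C s) ⟩
  ϑ * ϑ * (μ * μ * V - X) + C * ((k - μ) * s * ((k - μ) * s)) ∎
  where
  open ℚ.≤-Reasoning
  insert : ∀ t d V Y → t * (d * V) ≡ t * (d * V + Y - Y)
  insert = ℚ-solve 4 (λ t d V Y → t ⊠ (d ⊠ V) ≣ t ⊠ (d ⊠ V ⊞ Y ⊟ Y)) refl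
  regroup : ∀ t d r V Y X → t * (d * V + (r * V + Y) - X) ≡ t * ((r + d) * V - X) + t * Y
  regroup = ℚ-solve 6 (λ t d r V Y X → t ⊠ (d ⊠ V ⊞ (r ⊠ V ⊞ Y) ⊟ X) ≣ t ⊠ ((r ⊞ d) ⊠ V ⊟ X) ⊞ t ⊠ Y) refl
  square-* : ∀ a C s → a * a * (C * (s * s)) ≡ C * (a * s * (a * s))
  square-* = ℚ-solve 3 (λ a C s → a ⊠ a ⊠ (C ⊠ (s ⊠ s)) ≣ C ⊠ (a ⊠ s ⊠ (a ⊠ s))) refl
  0≤V : 0ℚ ≤ V
  0≤V = ℚ.≤-trans (square-nonNeg η) η²≤V
  0≤δ = ℚ.<⇒≤ 0<δ
  ρ²+δ²≤μ² : ρ * ρ + δ * δ ≤ μ * μ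
  ρ²+δ²≤μ² = begin
    ρ * ρ + δ * δ                        ≡⟨ ℚ.+-identityʳ _ ⟨
    ρ * ρ + δ * δ + 0ℚ                   ≤⟨ ℚ.+-monoʳ-≤ (ρ * ρ + δ * δ) (ℚ.+-mono-≤ (*-nonNeg 0≤ρ 0≤δ)
        (*-nonNeg 0≤ρ 0≤δ)) ⟩
    ρ * ρ + δ * δ + (ρ * δ + ρ * δ)      ≡⟨ ℚ-solve 2 (λ r d → r ⊠ r ⊞ d ⊠ d ⊞ (r ⊠ d ⊞ r ⊠ d)
        ≣ (r ⊞ d) ⊠ (r ⊞ d)) refl ρ δ ⟩
    (ρ + δ) * (ρ + δ)                    ≤⟨ square-mono-∣∣ (ℚ.+-mono-≤ 0≤ρ 0≤δ) (ℚ.<⇒≤ ρ+δ<∣μ∣) ⟩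
    μ * μ                                ∎

sum-- : ∀ {n} (f g : Vector ℚ n) → sum (λ i → f i - g i) ≡ sum f - sum g
sum-- f g = ≡.trans (Σℚ.∑-distrib-+ f (λ i → - g i)) (cong (λ s → sum f + s) (negate g))
  where
  negate : ∀ {n} (g : Vector ℚ n) → sum (λ i → - g i) ≡ - sum g
  negate {zero}  g = refl
  negate {suc n} g = ≡.trans (cong (λ s → - g zero + s) (negate (g ∘ suc))) (≡.sym (ℚ.neg-distrib-+ (g zero) _))

term≤sum : ∀ {n} (f : Vector ℚ n) → (∀ i → 0ℚ ≤ f i) → ∀ i → f i ≤ sum f
term≤sum f 0≤f zero = subst (_≤ sum f) (ℚ.+-identityʳ (f zero)) (ℚ.+-monoʳ-≤ (f zero) (sum-nonNeg (0≤f ∘ suc)))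
term≤sum f 0≤f (suc i) = ℚ.≤-trans (term≤sum (f ∘ suc) (0≤f ∘ suc) i)
  (subst (_≤ sum f) (ℚ.+-identityˡ _) (ℚ.+-monoˡ-≤ (sum (f ∘ suc)) (0≤f zero)))

-- An eigenvector for μ ≠ k has coordinate sum 0, and then the hypothesis bounds μ² by ρ².
eigenvalue-bound : ∀ {m} (A : Fin m → Fin m → ℕ) k {ρ C} → 0ℚ ≤ ρ → 0ℚ ≤ C →
  (∀ w → ‖ (λ i j → ι (A i j)) ∙ w ‖² ≤ ρ * ρ * ‖ w ‖² + C * (sum w * sum w)) →
  (∀ j → sum (λ i → ι (A i j)) ≡ ι k) →
  ∀ B → (∀ n → ρ ≤ approx B n) →
  ∀ μ → IsEigenvalue (λ i j → fromℕ (A i j)) μ → ¬ (ℝ.∣ μ ∣ ℝ.≃ fromℕ k) → ℝ.∣ μ ∣ ℝ.≤ B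
eigenvalue-bound {m} A k {ρ} {C} 0≤ρ 0≤C bound columns B ρ≤B μ (v , v≄0 , Av≃μv) μ≄k =
  ¬apart⇒≤ ℝ.∣ μ ∣ B λ (δ , 0<δ , big) →
  v≄0 λ i → ¬apart⇒≃ (v i) (fromℕ 0) λ (η , 0<η , nonzero) →
  μ≄k (¬apart⇒≃ ℝ.∣ μ ∣ (fromℕ k) λ (ϑ , 0<ϑ , differ) →
    -- The lower bound from `estimate`. It does not depend on the index, while the remainder that it
    -- bounds tends to 0, so one late term gives the contradiction.
    let c = ϑ * ϑ * (δ * δ * (η * η))
        0<c = *-pos (*-pos 0<ϑ 0<ϑ) (*-pos (*-pos 0<δ 0<δ) (*-pos 0<η 0<η))
        N , p = eventually₂ (eventually₂ big nonzero) (eventually₂ differ (remainder-null ϑ c 0<c))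
        (big-N , nonzero-N) , (differ-N , small-N) = p N ℕ.≤-refl
    in ℚ.<-irrefl refl (ℚ.≤-<-trans
         (ℚ.≤-trans
           (estimate (μ′ N) (ι k) 0≤ρ 0<δ 0<η 0<ϑ 0≤C (far N big-N) (apart N differ-N)
             (large N i 0<η nonzero-N) (bound (v′ N)))
           (p≤∣p∣ _))
         small-N))
  where
  μ′ : ℕ → ℚ
  μ′ = approx μ
  v′ : ℕ → Vector ℚ m
  v′ n i = approx (v i) n
  Av : ℕ → Vector ℚ m
  Av n = (λ i j → ι (A i j)) ∙ v′ n

  far : ∀ n {δ} → δ < ∣ μ′ n ∣ - approx B n → ρ + δ < ∣ μ′ n ∣
  far n {δ} lt = ℚ.≤-<-trans (ℚ.+-monoˡ-≤ δ (ρ≤B n))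
    (subst (approx B n + δ <_) (ℚ-solve 2 (λ b x → b ⊞ (x ⊟ b) ≣ x) refl (approx B n) ∣ μ′ n ∣)
      (ℚ.+-monoʳ-< (approx B n) lt))

  -- Only ∣ μ ∣ is given as apart from k; as k ≥ 0, the reverse triangle inequality passes this on
  -- to μ.
  apart : ∀ n {ϑ} → ϑ < ∣ ∣ μ′ n ∣ - ι k ∣ → ϑ < ∣ ι k - μ′ n ∣
  apart n lt = ℚ.<-≤-trans lt (subst (λ t → ∣ ∣ μ′ n ∣ - t ∣ ≤ ∣ ι k - μ′ n ∣) (ℚ.0≤p⇒∣p∣≡p (ι-nonNeg k))
    (ℝ.Cauchy.∣∣-≤
      (ℚ.≤-trans (ℝ.Cauchy.∣a∣-∣b∣≤ (μ′ n) (ι k)) (ℚ.≤-reflexive (≡.trans (≡.sym (ℚ.∣-p∣≡∣p∣ (μ′ n - ι k)))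
          (cong ∣_∣ (ℝ.Cauchy.neg-diff (μ′ n) (ι k))))))
      (ℚ.≤-trans (ℚ.≤-reflexive (ℝ.Cauchy.neg-diff ∣ μ′ n ∣ ∣ ι k ∣)) (ℝ.Cauchy.∣a∣-∣b∣≤ (ι k) (μ′ n)))))

  large : ∀ n i {η} → 0ℚ < η → η < ∣ v′ n i - 0ℚ ∣ → η * η ≤ ‖ v′ n ‖²
  large n i 0<η lt = ℚ.≤-trans
    (square-mono-∣∣ (ℚ.<⇒≤ 0<η) (ℚ.<⇒≤ (subst (λ t → _ < ∣ t ∣) (ℚ.+-identityʳ (v′ n i)) lt)))
    (term≤sum (λ i → v′ n i * v′ n i) (λ i → square-nonNeg (v′ n i)) i)

  residual : Fin m → ℕ → ℚ
  residual i n = Av n i - μ′ n * v′ n i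

  residual-null : ∀ i → Null (residual i)
  residual-null i = Null-cong
    (λ n → cong (_- μ′ n * v′ n i) (approx-sum (λ j → fromℕ (A i j) ℝ.* v j) n)) (Av≃μv i)

  -- Pairing A v - μ v with the all-ones vector uses that all columns sum to k. The product with k -
  -- μ is kept as a null sequence instead of dividing by k - μ.
  sum-residual : ∀ n → sum (λ i → residual i n) ≡ (ι k - μ′ n) * sum (v′ n)
  sum-residual n = begin
    sum (λ i → Av n i - μ′ n * v′ n i)                     ≡⟨ sum-- (Av n) (λ i → μ′ n * v′ n i) ⟩
    sum (Av n) - sum (λ i → μ′ n * v′ n i)                 ≡⟨ cong₂ _-_ sum-Av (sum-*ˡ (μ′ n) (v′ n)) ⟩
    ι k * sum (v′ n) - μ′ n * sum (v′ n)                   ≡⟨ ℚ-solve 3 (λ k x s → k ⊠ s ⊟ x ⊠ s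
        ≣ (k ⊟ x) ⊠ s) refl (ι k) (μ′ n) (sum (v′ n)) ⟩
    (ι k - μ′ n) * sum (v′ n)                              ∎
    where
    open ≡-Reasoning
    sum-Av : sum (Av n) ≡ ι k * sum (v′ n)
    sum-Av = begin
      sum (λ i → sum (λ j → ι (A i j) * v′ n j))           ≡⟨ Σℚ.∑-comm (λ i j → ι (A i j) * v′ n j) ⟩
      sum (λ j → sum (λ i → ι (A i j) * v′ n j))          
          ≡⟨ Σℚ.sum-cong-≗ (λ j → ≡.trans (sum-*ʳ (v′ n j) (λ i → ι (A i j))) (cong (_* v′ n j) (columns j))) ⟩
      sum (λ j → ι k * v′ n j)                             ≡⟨ sum-*ˡ (ι k) (v′ n) ⟩
      ι k * sum (v′ n)                                     ∎

  sum-residual-null : Null (λ n → (ι k - μ′ n) * sum (v′ n))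
  sum-residual-null = Null-cong sum-residual (Null-sum residual-null)

  difference-null : Null (λ n → μ′ n * μ′ n * ‖ v′ n ‖² - ‖ Av n ‖²)
  difference-null = Null-cong total (Null-sum (λ i → Null-* (approx (factor i)) (residual i) (bounded i)
      (residual-null i)))
    where
    -- The cofactor of the residual in the difference of squares (μ v)² - (A v)². It is built as a
    -- real number, so that being Cauchy makes it bounded.
    factor : Fin m → ℝ.ℝ
    factor i = fromℚ (- 1ℚ) ℝ.* (ℝ.sum (λ j → fromℕ (A i j) ℝ.* v j) ℝ.+ μ ℝ.* v i)
    bounded : ∀ i → Bounded (approx (factor i))
    bounded i = cauchy⇒bounded (cauchy (factor i))
    product : ∀ x y → - 1ℚ * (x + y) * (x - y) ≡ y * y - x * x
    product = ℚ-solve 2 (λ x y → κ (- 1ℚ) ⊠ (x ⊞ y) ⊠ (x ⊟ y) ≣ y ⊠ y ⊟ x ⊠ x) refl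
    total : ∀ n → sum (λ i → approx (factor i) n * residual i n) ≡ μ′ n * μ′ n * ‖ v′ n ‖² - ‖ Av n ‖²
    total n = begin
      sum (λ i → approx (factor i) n * residual i n)
        ≡⟨ Σℚ.sum-cong-≗ (λ i → ≡.trans
             (cong (λ t → - 1ℚ * (t + μ′ n * v′ n i) * residual i n) (approx-sum (λ j → fromℕ (A i j) ℝ.* v j) n))
             (product (Av n i) (μ′ n * v′ n i))) ⟩
      sum (λ i → μ′ n * v′ n i * (μ′ n * v′ n i) - Av n i * Av n i)
        ≡⟨ sum-- (λ i → μ′ n * v′ n i * (μ′ n * v′ n i)) (λ i → Av n i * Av n i) ⟩
      sum (λ i → μ′ n * v′ n i * (μ′ n * v′ n i)) - ‖ Av n ‖²
        ≡⟨ cong (_- ‖ Av n ‖²) (≡.trans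
             (Σℚ.sum-cong-≗ (λ i → ℚ-solve 2 (λ x y → x ⊠ y ⊠ (x ⊠ y) ≣ x ⊠ x ⊠ (y ⊠ y)) refl (μ′ n) (v′ n i)))
             (sum-*ˡ (μ′ n * μ′ n) (λ i → v′ n i * v′ n i))) ⟩
      μ′ n * μ′ n * ‖ v′ n ‖² - ‖ Av n ‖² ∎
      where open ≡-Reasoning

  remainder-null : ∀ ϑ → Null (λ n → ϑ * ϑ * (μ′ n * μ′ n * ‖ v′ n ‖² - ‖ Av n ‖²) +
    C * ((ι k - μ′ n) * sum (v′ n) * ((ι k - μ′ n) * sum (v′ n))))
  remainder-null ϑ = Null-+ (λ n → ϑ * ϑ * difference n) (λ n → C * (total n * total n))
    (Null-* (const (ϑ * ϑ)) difference (cauchy⇒bounded (ℝ.Cauchy.constCauchy (ϑ * ϑ))) difference-null)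
    (Null-* (const C) (λ n → total n * total n) (cauchy⇒bounded (ℝ.Cauchy.constCauchy C))
      (Null-* total total (null⇒bounded sum-residual-null) sum-residual-null))
    where
    difference total : ℕ → ℚ
    difference n = μ′ n * μ′ n * ‖ v′ n ‖² - ‖ Av n ‖²
    total n = (ι k - μ′ n) * sum (v′ n)

-- Integer lower bounds for square roots, and a norm criterion for Ramanujan graphs

isqrt-mono : ∀ h m N → h ℕ.* h ℕ.≤ m → h ℕ.* N ℕ.≤ isqrt (m ℕ.* (N ℕ.* N))
isqrt-mono h m N h²≤m = ℕ.≮⇒≥ λ isqrt<hN → ℕ.<-irrefl refl (begin-strict
  m ℕ.* (N ℕ.* N)              <⟨ isqrt-upper (m ℕ.* (N ℕ.* N)) ⟩
  _                            ≤⟨ ℕ.*-mono-≤ isqrt<hN isqrt<hN ⟩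
  h ℕ.* N ℕ.* (h ℕ.* N)        ≡⟨ interchange h N ⟩
  h ℕ.* h ℕ.* (N ℕ.* N)        ≤⟨ ℕ.*-monoˡ-≤ (N ℕ.* N) h²≤m ⟩
  m ℕ.* (N ℕ.* N)              ∎)
  where
  open ℕ.≤-Reasoning
  interchange : ∀ h N → h ℕ.* N ℕ.* (h ℕ.* N) ≡ h ℕ.* h ℕ.* (N ℕ.* N)
  interchange = solve-∀

-- With N = n + 1, the integer h N has square at most m N², so the integer part of N √ m reaches it.
-- The bound thus holds for each approximant and not just in the limit, as `eigenvalue-bound`
-- demands of B.
√-lower : ∀ h m → h ℕ.* h ℕ.≤ m → ∀ n → ι h ≤ approx (√ m) n
√-lower h m h²≤m n = ℚ.toℚᵘ-cancel-≤ (begin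
  ℚ.toℚᵘ (ι h)                                      ≃⟨ ι≃ h ⟩
  mkℚᵘ (+ h) 0                                     
      ≤⟨ *≤* (subst₂ ℤ._≤_ (ℤ.pos-* h (suc n)) (≡.sym (ℤ.*-identityʳ (+ s))) (ℤ.+≤+ (isqrt-mono h m (suc n) h²≤m))) ⟩
  mkℚᵘ (+ s) n                                      ≃⟨ ℚ.toℚᵘ-fromℚᵘ (mkℚᵘ (+ s) n) ⟨
  ℚ.toℚᵘ (√-approx m n)                             ∎)
  where
  open ℚᵘ.≤-Reasoning
  s = isqrt (m ℕ.* (suc n ℕ.* suc n))

𝟏-∖ : ∀ {p r s} {P : Set p} {R : Set r} {S : Set s} (P? : Dec P) (R? : Dec R) (S? : Dec S) →
  (P → R × ¬ S) → (R → ¬ S → P) → (S → R) → 𝟏 P? ≡ 𝟏 R? - 𝟏 S?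
𝟏-∖ P? R? (yes s) f g h = ≡.trans (𝟏-no P? (λ p → proj₂ (f p) s)) (cong (_- 1ℚ) (≡.sym (𝟏-yes R? (h s))))
𝟏-∖ P? R? (no ¬s) f g h = ≡.trans (𝟏-⇔ P? R? (proj₁ ∘ f) (λ r → g r ¬s)) (≡.sym (ℚ.+-identityʳ (𝟏 R?)))

ι-𝟏 : ∀ {p} {P : Set p} (d : Dec P) → ι (if does d then 1 else 0) ≡ 𝟏 d
ι-𝟏 (yes _) = refl
ι-𝟏 (no _)  = refl

-- The difference of the two sides is (a + q b)². This replaces the triangle inequality for norms,
-- which involves square roots; the weight q is the expected ratio of ‖ T w ‖ to ‖ w ‖, so that the
-- constant (q + 1)² is not worsened.
weighted-square : ∀ q a b → 0ℚ ≤ q → q * ((a - b) * (a - b)) ≤ (1ℚ + q) * (a * a + q * (b * b))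
weighted-square q a b 0≤q = begin
  q * ((a - b) * (a - b))                                          ≡⟨ ℚ.+-identityʳ _ ⟨
  q * ((a - b) * (a - b)) + 0ℚ                                    
      ≤⟨ ℚ.+-monoʳ-≤ (q * ((a - b) * (a - b))) (square-nonNeg (a + q * b)) ⟩
  q * ((a - b) * (a - b)) + (a + q * b) * (a + q * b)
    ≡⟨ ℚ-solve 3 (λ q a b → q ⊠ ((a ⊟ b) ⊠ (a ⊟ b)) ⊞ (a ⊞ q ⊠ b) ⊠ (a ⊞ q ⊠ b)
         ≣ (κ 1ℚ ⊞ q) ⊠ (a ⊠ a ⊞ q ⊠ (b ⊠ b))) refl q a b ⟩
  (1ℚ + q) * (a * a + q * (b * b))                                 ∎
  where open ℚ.≤-Reasoning

-- For S = 0 the bound on q X becomes (1 + q) (q² + q) V = q (1 + q)² V, exactly q times the claim.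
-- The coefficient of S is rounded up by means of 1 ≤ q, as any constant will do there.
combine-bounds : ∀ q X Y S V → 1ℚ ≤ q → 0ℚ ≤ S → q * X ≤ (1ℚ + q) * (Y + q * V) →
  Y ≤ (1ℚ + q) * S + q * q * V → X ≤ (1ℚ + q) * (1ℚ + q) * V + (1ℚ + q) * (1ℚ + q) * S
combine-bounds q X Y S V 1≤q 0≤S qX≤ Y≤ = ℚ.*-cancelˡ-≤-pos q {{ℚ.positive 0<q}} (begin
  q * X                                                   ≤⟨ qX≤ ⟩
  ρ * (Y + q * V)                                         ≤⟨ *-monoˡ-≤ 0≤ρ (ℚ.+-monoˡ-≤ (q * V) Y≤) ⟩
  ρ * (ρ * S + q * q * V + q * V)
    ≡⟨ ℚ-solve 3 (λ q s v → (κ 1ℚ ⊞ q) ⊠ ((κ 1ℚ ⊞ q) ⊠ s ⊞ q ⊠ q ⊠ v ⊞ q ⊠ v)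
         ≣ q ⊠ ((κ 1ℚ ⊞ q) ⊠ (κ 1ℚ ⊞ q) ⊠ v) ⊞ κ 1ℚ ⊠ ((κ 1ℚ ⊞ q) ⊠ (κ 1ℚ ⊞ q) ⊠ s)) refl q S V ⟩
  q * (ρ * ρ * V) + 1ℚ * (ρ * ρ * S)
    ≤⟨ ℚ.+-monoʳ-≤ (q * (ρ * ρ * V)) (ℚ.*-monoʳ-≤-nonNeg (ρ * ρ * S)
         {{ℚ.nonNegative (*-nonNeg (square-nonNeg ρ) 0≤S)}} 1≤q) ⟩
  q * (ρ * ρ * V) + q * (ρ * ρ * S)                       ≡⟨ ℚ.*-distribˡ-+ q (ρ * ρ * V) (ρ * ρ * S) ⟨
  q * (ρ * ρ * V + ρ * ρ * S)                             ∎)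
  where
  open ℚ.≤-Reasoning
  ρ = 1ℚ + q
  0<q : 0ℚ < q
  0<q = ℚ.<-≤-trans (ℚ.positive⁻¹ 1ℚ) 1≤q
  0≤ρ : 0ℚ ≤ ρ
  0≤ρ = ℚ.+-mono-≤ (ℚ.nonNegative⁻¹ 1ℚ) (ℚ.<⇒≤ 0<q)

module _ {a ℓ e} (Γ : FiniteGraph a ℓ e) where
  open FiniteGraph Γ using (order; vertex; adjacency; _⟶_; _⟶?_)

  adjacency-𝟏 : ∀ {r s} {R : Set r} {S : Set s} i j (R? : Dec R) (S? : Dec S) →
    (vertex i ⟶ vertex j → R × ¬ S) → (R → ¬ S → vertex i ⟶ vertex j) → (S → R) →
    ι (adjacency i j) ≡ 𝟏 R? - 𝟏 S?
  adjacency-𝟏 i j R? S? f g h = ≡.trans (ι-𝟏 (vertex i ⟶? vertex j)) (𝟏-∖ (vertex i ⟶? vertex j) R? S? f g h)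

  -- The row sums give regularity; the column sums make the coordinate sum of an eigenvector vanish
  -- in the limit.
  ramanujan-criterion : IsUndirected Γ → ∀ A → (∀ i j → ι (adjacency i j) ≡ A i j) → ∀ k →
    (∀ i → sum (A i) ≡ ι k) → (∀ j → sum (λ i → A i j) ≡ ι k) →
    ∀ {ρ C} → 0ℚ ≤ ρ → 0ℚ ≤ C → (∀ w → ‖ A ∙ w ‖² ≤ ρ * ρ * ‖ w ‖² + C * (sum w * sum w)) →
    (∀ n → ρ ≤ ℝ.ℝ.approx (fromℕ 2 ℝ.* (√ (k ℕ.∸ 1))) n) → IsRamanujan Γ
  ramanujan-criterion undirected A adjacency≡A k rows columns {ρ} {C} 0≤ρ 0≤C bound ρ≤ =
      (λ {x} {y} → undirected {x} {y}) , k ,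
    (λ i → ι-injective (≡.trans (ι-sum (adjacency i)) (≡.trans (Σℚ.sum-cong-≗ (adjacency≡A i)) (rows i)))) ,
    eigenvalue-bound adjacency k 0≤ρ 0≤C
      (λ w → subst (_≤ ρ * ρ * ‖ w ‖² + C * (sum w * sum w))
        (Σℚ.sum-cong-≗ (λ i → cong (λ a → a * a)
          (Σℚ.sum-cong-≗ (λ j → cong (_* w j) (≡.sym (adjacency≡A i j))))))
        (bound w))
      (λ j → ≡.trans (Σℚ.sum-cong-≗ (λ i → adjacency≡A i j)) (columns j))
      (fromℕ 2 ℝ.* (√ (k ℕ.∸ 1))) ρ≤

-- The set S as the elements of trace 2 other than 𝟙

module Unipotents {c ℓ₁ ℓ₂} (F : HeytingField c ℓ₁ ℓ₂) {q} (|F| : HasOrder F q) (q≡3 : q % 4 ≡ 3) where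
  open Shears F |F|
  open SL₂-over F |F| using (S)
  open Subset S using (Member)

  lower : K → Matrix
  lower t = mat 1# 0# t 1#

  -- `lower t` is the shear along (0, 1) with parameter -t, so its conjugate is the shear with the
  -- same parameter along the second column (b, d) of X.
  conjugate-lower : ∀ X t → HasDet1 X → (X · lower t) · adj X ≋
    (let mat a b c d = X in mat (1# ⊕ t ⊛ (b ⊛ d)) (⊖ (t ⊛ (b ⊛ b))) (t ⊛ (d ⊛ d)) (1# ⊖ t ⊛ (b ⊛ d)))
  conjugate-lower (mat a b c d) t det≈1 =
    combination₁ 1# (solve 5 (λ a b c d t →
      ((a :* con (+ 1) :+ b :* t) :* d :+ (a :* con (+ 0) :+ b :* con (+ 1)) :* :- c) :- (con (+ 1) :+ t :* (b :* d))
      := con (+ 1) :* ((a :* d :- b :* c) :- con (+ 1))) ≈-refl a b c d t) det≈1 ,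
    solve 3 (λ a b t → (a :* con (+ 1) :+ b :* t) :* :- b :+ (a :* con (+ 0) :+ b :* con (+ 1)) :* a
      := :- (t :* (b :* b))) ≈-refl a b t ,
    solve 3 (λ c d t → (c :* con (+ 1) :+ d :* t) :* d :+ (c :* con (+ 0) :+ d :* con (+ 1)) :* :- c
      := t :* (d :* d)) ≈-refl c d t ,
    combination₁ 1# (solve 5 (λ a b c d t →
      ((c :* con (+ 1) :+ d :* t) :* :- b :+ (c :* con (+ 0) :+ d :* con (+ 1)) :* a) :- (con (+ 1) :- t :* (b :* d))
      := con (+ 1) :* ((a :* d :- b :* c) :- con (+ 1))) ≈-refl a b c d t) det≈1

  conjugate-tr≈2 : ∀ X t s → HasDet1 X → (X · lower t) · adj X ≋ s → tr s ≈ 2#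
  conjugate-tr≈2 X@(mat a b c d) t s det≈1 eq =
    trans (tr-cong (≋-trans (≋-sym eq) (conjugate-lower X t det≈1)))
      (solve 3 (λ b d t → (con (+ 1) :+ t :* (b :* d)) :+ (con (+ 1) :- t :* (b :* d)) := con (+ 2)) ≈-refl b d t)

  conjugate-≉𝟙 : ∀ X t s → HasDet1 X → ¬ t ≈ 0# → (X · lower t) · adj X ≋ s → ¬ s ≋ 𝟙
  conjugate-≉𝟙 X@(mat a b c d) t s det≈1 t≉0 eq s≋𝟙 =
    let _ , tb² , td² , _ = ≋-trans (≋-sym (conjugate-lower X t det≈1)) (≋-trans eq s≋𝟙)
        b≈0 = square-zero (*-zero⇒zeroʳ t≉0 (combination₁ (⊖ 1#)
                (solve 2 (λ b t → t :* (b :* b) :- con (+ 0)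
                    := :- con (+ 1) :* (:- (t :* (b :* b)) :- con (+ 0))) ≈-refl b t) tb²))
        d≈0 = square-zero (*-zero⇒zeroʳ t≉0 td²)
    in 1≉0 (combination₃ (⊖ 1#) a (⊖ c)
         (solve 4 (λ a b c d → con (+ 1) :- con (+ 0) := :- con (+ 1) :* ((a :* d :- b :* c) :- con (+ 1))
           :+ (a :* (d :- con (+ 0)) :+ :- c :* (b :- con (+ 0)))) ≈-refl a b c d) det≈1 d≈0 b≈0)

  LowerConjugate : K → Matrix → Set _
  LowerConjugate t s = ∃ λ X → HasDet1 X × (X · lower t) · adj X ≋ s

  -- The second column (β, d) of X must satisfy -t β² = y and 1 + t β d = x; as t² = 1, the latter
  -- determines d. The first column completes it to determinant 1, and trace and determinant of s
  -- give the bottom row.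
  lower-conjugate-e₁₂ : ∀ s → HasDet1 s → tr s ≈ 2# → ∀ t β → t ⊛ t ≈ 1# → ¬ β ≈ 0# →
    ⊖ (t ⊛ (β ⊛ β)) ≈ Matrix.e₁₂ s → LowerConjugate t s
  lower-conjugate-e₁₂ s@(mat x y z w) det≈1 tr≈2 t β t²≈1 β≉0 y≈ =
    X , det-X , ≋-trans (conjugate-lower X t det-X) (eq₁₁ , y≈ , eq₂₁ , eq₂₂)
    where
    γ = proj₁ (invert β≉0)
    βγ≈1 = proj₂ (invert β≉0)
    d = t ⊛ ((x ⊖ 1#) ⊛ γ)
    X = mat 0# β (⊖ γ) d
    det-X : HasDet1 X
    det-X = combination₁ 1# (solve 3 (λ β γ d → (con (+ 0) :* d :- β :* :- γ) :- con (+ 1)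
      := con (+ 1) :* (β :* γ :- con (+ 1))) ≈-refl β γ d) βγ≈1
    eq₁₁ : 1# ⊕ t ⊛ (β ⊛ d) ≈ x
    eq₁₁ = combination₂ ((x ⊖ 1#) ⊛ (β ⊛ γ)) (x ⊖ 1#)
      (solve 4 (λ x t β γ → (con (+ 1) :+ t :* (β :* (t :* ((x :- con (+ 1)) :* γ)))) :- x
        := (x :- con (+ 1)) :* (β :* γ) :* (t :* t :- con (+ 1)) :+ (x :- con (+ 1)) :* (β :* γ :- con (+ 1)))
        ≈-refl x t β γ) t²≈1 βγ≈1
    [x-1]² : (x ⊖ 1#) ⊛ (x ⊖ 1#) ≈ t ⊛ (β ⊛ β) ⊛ z
    [x-1]² = combination₃ x (⊖ 1#) z
      (solve 6 (λ x y z w t β → (x :- con (+ 1)) :* (x :- con (+ 1)) :- t :* (β :* β) :* z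
        := x :* ((x :+ w) :- con (+ 2)) :+ (:- con (+ 1) :* ((x :* w :- y :* z) :- con (+ 1))
           :+ z :* (:- (t :* (β :* β)) :- y))) ≈-refl x y z w t β) tr≈2 det≈1 y≈
    eq₂₁ : t ⊛ (d ⊛ d) ≈ z
    eq₂₁ = combination₃ (t ⊛ t ⊛ t ⊛ (γ ⊛ γ)) (z ⊛ (t ⊛ t ⊛ (β ⊛ γ) ⊕ 1#) ⊛ (β ⊛ γ)) (z ⊛ (t ⊛ t ⊛ (β ⊛ γ) ⊕ 1#))
      (solve 5 (λ x z t β γ →
        t :* ((t :* ((x :- con (+ 1)) :* γ)) :* (t :* ((x :- con (+ 1)) :* γ))) :- z
        := t :* t :* t :* (γ :* γ) :* ((x :- con (+ 1)) :* (x :- con (+ 1)) :- t :* (β :* β) :* z)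
           :+ (z :* (t :* t :* (β :* γ) :+ con (+ 1)) :* (β :* γ) :* (t :* t :- con (+ 1))
           :+ z :* (t :* t :* (β :* γ) :+ con (+ 1)) :* (β :* γ :- con (+ 1)))) ≈-refl x z t β γ)
      [x-1]² t²≈1 βγ≈1
    eq₂₂ : 1# ⊖ t ⊛ (β ⊛ d) ≈ w
    eq₂₂ = combination₂ (⊖ 1#) (⊖ 1#)
      (solve 3 (λ x w e → (con (+ 1) :- e) :- w := :- con (+ 1) :* ((con (+ 1) :+ e) :- x)
        :+ :- con (+ 1) :* ((x :+ w) :- con (+ 2))) ≈-refl x w (t ⊛ (β ⊛ d))) eq₁₁ tr≈2

  lower-conjugate-e₂₁ : ∀ s → HasDet1 s → tr s ≈ 2# → Matrix.e₁₂ s ≈ 0# → ∀ t δ → ¬ δ ≈ 0# →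
    t ⊛ (δ ⊛ δ) ≈ Matrix.e₂₁ s → LowerConjugate t s
  lower-conjugate-e₂₁ s@(mat x y z w) det≈1 tr≈2 y≈0 t δ δ≉0 z≈ =
    X , det-X , ≋-trans (conjugate-lower X t det-X)
      ( trans (solve 2 (λ t δ → con (+ 1) :+ t :* (con (+ 0) :* δ) := con (+ 1)) ≈-refl t δ) (sym x≈1)
      , trans (solve 1 (λ t → :- (t :* (con (+ 0) :* con (+ 0))) := con (+ 0)) ≈-refl t) (sym y≈0)
      , z≈
      , combination₂ (⊖ 1#) 1# (solve 4 (λ t δ x w → (con (+ 1) :- t :* (con (+ 0) :* δ)) :- w
          := :- con (+ 1) :* ((x :+ w) :- con (+ 2)) :+ con (+ 1) :* (x :- con (+ 1))) ≈-refl t δ x w) tr≈2 x≈1)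
    where
    X = mat (proj₁ (invert δ≉0)) 0# 0# δ
    det-X : HasDet1 X
    det-X = combination₁ 1# (solve 2 (λ δ ε → (ε :* δ :- con (+ 0) :* con (+ 0)) :- con (+ 1)
      := con (+ 1) :* (δ :* ε :- con (+ 1))) ≈-refl δ _) (proj₂ (invert δ≉0))
    x≈1 = e₁₂≈0⇒e₁₁≈1 s det≈1 tr≈2 y≈0

  PlusMinusSquare : K → Set _
  PlusMinusSquare x = ∃ λ y → ¬ y ≈ 0# × (x ≈ y ⊛ y ⊎ x ≈ ⊖ (y ⊛ y))

  -- The parameter t is read off from a square class: -y, or z if y = 0, has to be t times a nonzero
  -- square. By `square-or-minus-square` the values 1 and -1 of t cover all cases.
  tr≈2⇒lower-conjugate : ∀ s → HasDet1 s → tr s ≈ 2# → ¬ s ≋ 𝟙 → LowerConjugate 1# s ⊎ LowerConjugate (⊖ 1#) s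
  tr≈2⇒lower-conjugate s@(mat x y z w) det≈1 tr≈2 s≉𝟙 = by-e₁₂ (y ≈? 0#)
    where
    upper : PlusMinusSquare y → LowerConjugate 1# s ⊎ LowerConjugate (⊖ 1#) s
    upper (β , β≉0 , inj₁ y≈β²) = inj₂ (lower-conjugate-e₁₂ s det≈1 tr≈2 (⊖ 1#) β
      (solve 0 (:- con (+ 1) :* :- con (+ 1) := con (+ 1)) ≈-refl) β≉0
      (trans (solve 1 (λ β → :- (:- con (+ 1) :* (β :* β)) := β :* β) ≈-refl β) (sym y≈β²)))
    upper (β , β≉0 , inj₂ y≈-β²) = inj₁ (lower-conjugate-e₁₂ s det≈1 tr≈2 1# β (*-identityˡ 1#) β≉0
      (trans (-‿cong (*-identityˡ (β ⊛ β))) (sym y≈-β²)))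
    lower-triangular : y ≈ 0# → PlusMinusSquare z → LowerConjugate 1# s ⊎ LowerConjugate (⊖ 1#) s
    lower-triangular y≈0 (δ , δ≉0 , inj₁ z≈δ²) = inj₁ (lower-conjugate-e₂₁ s det≈1 tr≈2 y≈0 1# δ δ≉0
      (trans (*-identityˡ (δ ⊛ δ)) (sym z≈δ²)))
    lower-triangular y≈0 (δ , δ≉0 , inj₂ z≈-δ²) = inj₂ (lower-conjugate-e₂₁ s det≈1 tr≈2 y≈0 (⊖ 1#) δ δ≉0
      (trans (solve 1 (λ δ → :- con (+ 1) :* (δ :* δ) := :- (δ :* δ)) ≈-refl δ) (sym z≈-δ²)))
    diagonal : y ≈ 0# → z ≈ 0# → s ≋ 𝟙
    diagonal y≈0 z≈0 = e₁₂≈0⇒e₁₁≈1 s det≈1 tr≈2 y≈0 , y≈0 , z≈0 , e₁₂≈0⇒e₂₂≈1 s det≈1 tr≈2 y≈0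
    by-e₂₁ : y ≈ 0# → Dec (z ≈ 0#) → LowerConjugate 1# s ⊎ LowerConjugate (⊖ 1#) s
    by-e₂₁ y≈0 (yes z≈0) = contradiction (diagonal y≈0 z≈0) s≉𝟙
    by-e₂₁ y≈0 (no z≉0)  = lower-triangular y≈0 (square-or-minus-square q≡3 z≉0)
    by-e₁₂ : Dec (y ≈ 0#) → LowerConjugate 1# s ⊎ LowerConjugate (⊖ 1#) s
    by-e₁₂ (yes y≈0) = by-e₂₁ y≈0 (z ≈? 0#)
    by-e₁₂ (no y≉0)  = upper (square-or-minus-square q≡3 y≉0)

  -1≉0 : ¬ ⊖ 1# ≈ 0#
  -1≉0 eq = 1≉0 (combination₁ (⊖ 1#) (solve 0 (con (+ 1) :- con (+ 0)
      := :- con (+ 1) :* (:- con (+ 1) :- con (+ 0))) ≈-refl) eq)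

  member⇒ : ∀ s → Member s → tr (proj₁ s) ≈ 2# × ¬ proj₁ s ≋ 𝟙
  member⇒ (s , _) (inj₁ ((X , det≈1) , eq)) = conjugate-tr≈2 X 1# s det≈1 eq , conjugate-≉𝟙 X 1# s det≈1 1≉0 eq
  member⇒ (s , _) (inj₂ ((X , det≈1) , eq)) = conjugate-tr≈2 X (⊖ 1#) s det≈1 eq , conjugate-≉𝟙 X
      (⊖ 1#) s det≈1 -1≉0 eq

  ⇒member : ∀ s → tr (proj₁ s) ≈ 2# → ¬ proj₁ s ≋ 𝟙 → Member s
  ⇒member (s , det≈1) tr≈2 s≉𝟙 with tr≈2⇒lower-conjugate s det≈1 tr≈2 s≉𝟙
  ... | inj₁ (X , det-X , eq) = inj₁ ((X , det-X) , eq)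
  ... | inj₂ (X , det-X , eq) = inj₂ ((X , det-X) , eq)

-- The norm bound for the twisted matrix

module SpectralBound {c ℓ₁ ℓ₂} (F : HeytingField c ℓ₁ ℓ₂) {q} (|F| : HasOrder F q) (q≡3 : q % 4 ≡ 3)
  {n} (|G| : Inverse (≡.setoid (Fin n)) (Group.setoid (Matrices.SL₂ (toCommutativeRing F)))) where
  open TraceTwo F |F| |G| public

  ⟨,⟩-self : ∀ M → HasDet1 M → ⟨ M , M ⟩ ≈ 2#
  ⟨,⟩-self (mat a b c d) det≈1 = combination₁ 2# (solve 4 (λ a b c d →
    ((a :* d :+ d :* a) :- (b :* c :+ c :* b)) :- con (+ 2) := con (+ 2) :* ((a :* d :- b :* c) :- con (+ 1)))
    ≈-refl a b c d) det≈1

  1≤ιq : 1ℚ ≤ ι q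
  1≤ιq = nonempty (from 0#)
    where
    nonempty : ∀ {n} → Fin n → 1ℚ ≤ ι n
    nonempty {suc n} _ = subst (1ℚ ≤_) (≡.sym (ι-suc n))
      (subst (_≤ 1ℚ + ι n) (ℚ.+-identityʳ 1ℚ) (ℚ.+-monoʳ-≤ 1ℚ (ι-nonNeg n)))

  degree : ℕ
  degree = q ℕ.* q ℕ.∸ 1

  -- The element `from 0#` shows that q is positive, so the truncated subtraction in `degree` is
  -- exact.
  q²≡ : ι q * ι q ≡ 1ℚ + ι degree
  q²≡ = ≡.trans (≡.sym (ι-* q q)) (go q (from 0#))
    where
    go : ∀ n → Fin n → ι (n ℕ.* n) ≡ 1ℚ + ι (n ℕ.* n ℕ.∸ 1)
    go (suc n) _ = ι-suc (n ℕ.+ n ℕ.* suc n)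

  module Twist (φ : Fin n → Fin n) (φφ : ∀ i → φ (φ i) ≡ i) where
    A : Fin n → Fin n → ℚ
    A i j = T i (φ j) - 𝟏 (φ j Fin.≟ i)

    -- Reindexing by the involution moves the twist from the matrix to the vector. As w ∘ φ has the
    -- norm and the coordinate sum of w, the bound for T - 1 carries over to every φ.
    A∙ : ∀ w i → (A ∙ w) i ≡ (T ∙ (w ∘ φ)) i - w (φ i)
    A∙ w i = begin
      sum (λ j → A i j * w j)
        ≡⟨ Σℚ.sum-cong-≗ (λ j → cong (λ k → A i j * w k) (≡.sym (φφ j))) ⟩
      sum (λ j → (T i (φ j) - 𝟏 (φ j Fin.≟ i)) * w (φ (φ j)))
        ≡⟨ sum-involution (λ j → (T i j - 𝟏 (j Fin.≟ i)) * w (φ j)) φ φφ ⟩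
      sum (λ j → (T i j - 𝟏 (j Fin.≟ i)) * w (φ j))
        ≡⟨ Σℚ.sum-cong-≗ (λ j → ℚ-solve 3 (λ t d w → (t ⊟ d) ⊠ w
            ≣ t ⊠ w ⊟ d ⊠ w) refl (T i j) (𝟏 (j Fin.≟ i)) (w (φ j))) ⟩
      sum (λ j → T i j * w (φ j) - 𝟏 (j Fin.≟ i) * w (φ j))
        ≡⟨ sum-- (λ j → T i j * w (φ j)) (λ j → 𝟏 (j Fin.≟ i) * w (φ j)) ⟩
      (T ∙ (w ∘ φ)) i - sum (λ j → 𝟏 (j Fin.≟ i) * w (φ j))
        ≡⟨ cong (λ s → (T ∙ (w ∘ φ)) i - s) (sum-δ (λ j → j Fin.≟ i) i refl (λ _ eq → eq) (w ∘ φ)) ⟩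
      (T ∙ (w ∘ φ)) i - w (φ i) ∎
      where open ≡-Reasoning

    ‖A∙w‖²≤ : ∀ w → ‖ A ∙ w ‖² ≤ ι (suc q) * ι (suc q) * ‖ w ‖² + ι (suc q) * ι (suc q) * (sum w * sum w)
    ‖A∙w‖²≤ w = subst (λ ρ → ‖ A ∙ w ‖² ≤ ρ * ρ * ‖ w ‖² + ρ * ρ * (sum w * sum w)) (≡.sym (ι-suc q))
      (combine-bounds (ι q) ‖ A ∙ w ‖² ‖ T ∙ w′ ‖² (sum w * sum w) ‖ w ‖² 1≤ιq (square-nonNeg (sum w)) weighted
        (subst₂ (λ s v → ‖ T ∙ w′ ‖² ≤ (1ℚ + ι q) * (s * s) + ι q * ι q * v)
          (sum-involution w φ φφ) ‖w′‖²
          (subst (λ ρ → ‖ T ∙ w′ ‖² ≤ ρ * (sum w′ * sum w′) + ι q * ι q * ‖ w′ ‖²) (ι-suc q) (‖T∙w‖²≤ w′))))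
      where
      w′ = w ∘ φ
      ‖w′‖² : ‖ w′ ‖² ≡ ‖ w ‖²
      ‖w′‖² = sum-involution (λ i → w i * w i) φ φφ
      weighted : ι q * ‖ A ∙ w ‖² ≤ (1ℚ + ι q) * (‖ T ∙ w′ ‖² + ι q * ‖ w ‖²)
      weighted = begin
        ι q * ‖ A ∙ w ‖²
          ≡⟨ sum-*ˡ (ι q) (λ i → (A ∙ w) i * (A ∙ w) i) ⟨
        sum (λ i → ι q * ((A ∙ w) i * (A ∙ w) i))
          ≡⟨ Σℚ.sum-cong-≗ (λ i → cong (λ a → ι q * (a * a)) (A∙ w i)) ⟩
        sum (λ i → ι q * (((T ∙ w′) i - w′ i) * ((T ∙ w′) i - w′ i)))
          ≤⟨ sum-mono-≤ (λ i → weighted-square (ι q) ((T ∙ w′) i) (w′ i) (ι-nonNeg q)) ⟩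
        sum (λ i → (1ℚ + ι q) * ((T ∙ w′) i * (T ∙ w′) i + ι q * (w′ i * w′ i)))
          ≡⟨ sum-*ˡ (1ℚ + ι q) (λ i → (T ∙ w′) i * (T ∙ w′) i + ι q * (w′ i * w′ i)) ⟩
        (1ℚ + ι q) * sum (λ i → (T ∙ w′) i * (T ∙ w′) i + ι q * (w′ i * w′ i))
          ≡⟨ cong ((1ℚ + ι q) *_) (≡.trans
               (Σℚ.∑-distrib-+ (λ i → (T ∙ w′) i * (T ∙ w′) i) (λ i → ι q * (w′ i * w′ i)))
               (cong (λ s → ‖ T ∙ w′ ‖² + s) (≡.trans (sum-*ˡ (ι q) (λ i → w′ i * w′ i)) (cong (ι q *_) ‖w′‖²)))) ⟩
        (1ℚ + ι q) * (‖ T ∙ w′ ‖² + ι q * ‖ w ‖²) ∎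
        where open ℚ.≤-Reasoning

    minus-one : ∀ s d → s ≡ ι q * ι q → d ≡ 1ℚ → s - d ≡ ι degree
    minus-one _ _ refl refl = ≡.trans (cong (_- 1ℚ) q²≡)
      (ℚ-solve 1 (λ k → κ 1ℚ ⊞ k ⊟ κ 1ℚ ≣ k) refl (ι degree))

    column-sum : ∀ j → sum (λ i → A i j) ≡ ι degree
    column-sum j = ≡.trans (sum-- (λ i → T i (φ j)) (λ i → 𝟏 (φ j Fin.≟ i)))
      (minus-one _ _ (sum-T (φ j)) (sum-𝟏-unique (λ i → φ j Fin.≟ i) (φ j) refl (λ _ → ≡.sym)))

    row-sum : ∀ i → sum (A i) ≡ ι degree
    row-sum i = ≡.trans (sum-- (λ j → T i (φ j)) (λ j → 𝟏 (φ j Fin.≟ i)))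
      (minus-one _ _
        (≡.trans (sum-involution (T i) φ φφ) (≡.trans (Σℚ.sum-cong-≗ (T-sym i)) (sum-T i)))
        (sum-𝟏-unique (λ j → φ j Fin.≟ i) (φ i) (φφ i) (λ j eq → ≡.trans (≡.sym (φφ j)) (cong φ eq))))

  -- With q = 4r + 3 the bound q + 1 is twice the integer 2r + 2, whose square is at most q² − 2.
  1+q≤2√[k-1] : ∀ i → ι (suc q) ≤ ℝ.ℝ.approx (fromℕ 2 ℝ.* (√ (degree ℕ.∸ 1))) i
  1+q≤2√[k-1] i = begin
    ι (suc q)                                       ≡⟨ cong ι 1+q≡2h ⟩
    ι (2 ℕ.* h)                                     ≡⟨ ι-* 2 h ⟩
    ι 2 * ι h                                       ≤⟨ *-monoˡ-≤ (ι-nonNeg 2) (√-lower h (degree ℕ.∸ 1) h²≤ i) ⟩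
    ι 2 * ℝ.ℝ.approx (√ (degree ℕ.∸ 1)) i           ∎
    where
    open ℚ.≤-Reasoning
    r = q ℕ./ 4
    h = 2 ℕ.* r ℕ.+ 2
    q≡ : q ≡ 3 ℕ.+ r ℕ.* 4
    q≡ = ≡.trans (ℕ.m≡m%n+[m/n]*n q 4) (cong (ℕ._+ r ℕ.* 4) q≡3)
    double : ∀ r → suc (3 ℕ.+ r ℕ.* 4) ≡ 2 ℕ.* (2 ℕ.* r ℕ.+ 2)
    double = solve-∀
    1+q≡2h : suc q ≡ 2 ℕ.* h
    1+q≡2h = ≡.trans (cong suc q≡) (double r)
    -- The leading 2 lets both truncated subtractions of 1 compute away, and the last summand is the
    -- slack between h² and q² - 2.
    excess : ∀ r → (3 ℕ.+ r ℕ.* 4) ℕ.* (3 ℕ.+ r ℕ.* 4) ≡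
      2 ℕ.+ ((2 ℕ.* r ℕ.+ 2) ℕ.* (2 ℕ.* r ℕ.+ 2) ℕ.+ (12 ℕ.* r ℕ.* r ℕ.+ 16 ℕ.* r ℕ.+ 3))
    excess = solve-∀
    h²≤ : h ℕ.* h ℕ.≤ degree ℕ.∸ 1
    h²≤ = subst (λ k → h ℕ.* h ℕ.≤ k ℕ.∸ 1 ℕ.∸ 1)
      (≡.sym (≡.trans (cong₂ ℕ._*_ q≡ q≡) (excess r))) (ℕ.m≤m+n (h ℕ.* h) _)

-- From a description of the edges to the Ramanujan property

module RepresentedGraph {c ℓ₁ ℓ₂} (F : HeytingField c ℓ₁ ℓ₂) {q} (|F| : HasOrder F q) (q≡3 : q % 4 ≡ 3)
  {a ℓ e} (Γ : FiniteGraph a ℓ e)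
  (rep : Inverse (FiniteGraph.vertices Γ) (Group.setoid (Matrices.SL₂ (toCommutativeRing F)))) where
  open FiniteGraph Γ renaming (_≈_ to _≈ᵍ_)
  open SpectralBound F |F| q≡3 (Comp.inverse (proj₂ finite) rep)
  private
    module V = Setoid vertices

  R : Carrier → Matrix
  R x = proj₁ (Inverse.to rep x)

  module _ (ψ : Carrier → Carrier) (ψ-cong : ∀ {x y} → x ≈ᵍ y → ψ x ≈ᵍ ψ y) (ψ-involutive : ∀ x → ψ (ψ x) ≈ᵍ x)
    (ψ-sym : ∀ x y → ⟨ R x , R (ψ y) ⟩ ≈ ⟨ R y , R (ψ x) ⟩)
    (⟶⇒ : ∀ x y → x ⟶ y → ⟨ R x , R (ψ y) ⟩ ≈ 2# × ¬ x ≈ᵍ ψ y)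
    (⇒⟶ : ∀ x y → ⟨ R x , R (ψ y) ⟩ ≈ 2# → ¬ x ≈ᵍ ψ y → x ⟶ y) where

    undirected : IsUndirected Γ
    undirected {x} {y} x⟶y = let eq , neq = ⟶⇒ x y x⟶y in
      ⇒⟶ y x (trans (ψ-sym y x) eq) (λ y≈ψx → neq (V.sym (V.trans (ψ-cong y≈ψx) (ψ-involutive x))))

    φ : Fin order → Fin order
    φ i = Inverse.from (proj₂ finite) (ψ (vertex i))

    vertex-φ : ∀ i → vertex (φ i) ≈ᵍ ψ (vertex i)
    vertex-φ i = Inverse.inverseˡ (proj₂ finite) refl

    φφ : ∀ i → φ (φ i) ≡ i
    φφ i = M-injective (Inverse.to-cong rep
      (V.trans (vertex-φ (φ i)) (V.trans (ψ-cong (vertex-φ i)) (ψ-involutive (vertex i)))))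

    open Twist φ φφ

    adjacency≡A : ∀ i j → ι (adjacency i j) ≡ A i j
    adjacency≡A i j = adjacency-𝟏 Γ i j (⟨ M i , M (φ j) ⟩ ≈? 2#) (φ j Fin.≟ i)
        (λ e → let eq , neq = ⟶⇒ (vertex i) (vertex j) e in
          trans value eq , λ { refl → neq (vertex-φ j) })
        (λ eq neq → ⇒⟶ (vertex i) (vertex j) (trans (sym value) eq)
          (λ i≈ψj → neq (M-injective (Inverse.to-cong rep (V.trans (vertex-φ j) (V.sym i≈ψj))))))
        -- A pair with x = ψ y also satisfies ⟨ x , ψ y ⟩ = 2, so the subtracted δ always cancels a
        -- 1 and never leaves -1.
        (λ { refl → ⟨,⟩-self (M (φ j)) (M-det (φ j)) })
      where
      value : ⟨ M i , M (φ j) ⟩ ≈ ⟨ M i , R (ψ (vertex j)) ⟩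
      value = ⟨⟩-cong {M i} {M i} {M (φ j)} {R (ψ (vertex j))} ≋-refl (Inverse.to-cong rep (vertex-φ j))

    ramanujan : IsRamanujan Γ
    ramanujan = ramanujan-criterion Γ (λ {x} {y} → undirected {x} {y}) A adjacency≡A degree row-sum column-sum
      (ι-nonNeg (suc q)) (square-nonNeg (ι (suc q))) ‖A∙w‖²≤ 1+q≤2√[k-1]

-- Edges of the three graphs in terms of the form

module RamanujanGraphs {c ℓ₁ ℓ₂} (F : HeytingField c ℓ₁ ℓ₂) {q} (|F| : HasOrder F q) (q≡3 : q % 4 ≡ 3) where
  open Shears F |F|
  open Unipotents F |F| q≡3
  open Group SL₂ using (_⁻¹) renaming (Carrier to SL; _∙_ to _×ᴳ_)
  open Subset (SL₂-over.S F |F|) using (Member)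

  tr-· : ∀ M N → tr (M · N) ≈ ⟨ M , adj N ⟩
  tr-· (mat a b c d) (mat x y z w) = solve 8 (λ a b c d x y z w →
    (a :* x :+ b :* z) :+ (c :* y :+ d :* w) := (a :* x :+ d :* w) :- (b :* :- z :+ c :* :- y))
    ≈-refl a b c d x y z w

  tr-adj· : ∀ M N → tr (adj M · N) ≈ ⟨ M , N ⟩
  tr-adj· (mat a b c d) (mat x y z w) = solve 8 (λ a b c d x y z w →
    (d :* x :+ :- b :* z) :+ (:- c :* y :+ a :* w) := (a :* w :+ d :* x) :- (b :* z :+ c :* y))
    ≈-refl a b c d x y z w

  ⟨,adj⟩-sym : ∀ M N → ⟨ M , adj N ⟩ ≈ ⟨ N , adj M ⟩
  ⟨,adj⟩-sym (mat a b c d) (mat x y z w) = solve 8 (λ a b c d x y z w →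
    (a :* x :+ d :* w) :- (b :* :- z :+ c :* :- y) := (x :* a :+ w :* d) :- (y :* :- c :+ z :* :- b))
    ≈-refl a b c d x y z w

  adj-adj : ∀ M → adj (adj M) ≋ M
  adj-adj (mat a b c d) = ≈-refl , double b , double c , ≈-refl
    where
    double : ∀ x → ⊖ ⊖ x ≈ x
    double = solve 1 (λ x → :- :- x := x) ≈-refl

  ·-adj· : ∀ X N → HasDet1 X → X · (adj X · N) ≋ N
  ·-adj· X N det≈1 = ≋-trans {X · (adj X · N)} {(X · adj X) · N} {N} (≋-sym {(X · adj X) · N} (·-assoc X (adj X) N))
    (≋-trans {(X · adj X) · N} {𝟙 · N} {N} (·-cong {X · adj X} {𝟙} {N} {N} (adj-inverseʳ det≈1) ≋-refl)
        (·-identityˡ N))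

  adj·-· : ∀ X N → HasDet1 X → adj X · (X · N) ≋ N
  adj·-· X N det≈1 = ≋-trans {adj X · (X · N)} {(adj X · X) · N} {N} (≋-sym {(adj X · X) · N} (·-assoc (adj X) X N))
    (≋-trans {(adj X · X) · N} {𝟙 · N} {N} (·-cong {adj X · X} {𝟙} {N} {N} (adj-inverseˡ det≈1) ≋-refl)
        (·-identityˡ N))

  adj·≋𝟙⇒≋ : ∀ X Y → HasDet1 X → adj X · Y ≋ 𝟙 → X ≋ Y
  adj·≋𝟙⇒≋ X Y det≈1 eq = ≋-trans {X} {X · 𝟙} {Y} (≋-sym {X · 𝟙} (·-identityʳ X))
    (≋-trans {X · 𝟙} {X · (adj X · Y)} {Y} (·-cong {X} {X} {𝟙} {adj X · Y} ≋-refl (≋-sym {adj X · Y} eq))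
        (·-adj· X Y det≈1))

  ·≋𝟙⇒≋adj : ∀ X Y → HasDet1 X → X · Y ≋ 𝟙 → X ≋ adj Y
  ·≋𝟙⇒≋adj X Y det≈1 eq = ≋-trans {X} {adj (adj X)} {adj Y} (≋-sym {adj (adj X)} (adj-adj X))
    (adj-cong {adj X} {Y} (adj·≋𝟙⇒≋ (adj X) Y (trans (det-adj X) det≈1)
      (≋-trans {adj (adj X) · Y} {X · Y} (·-cong {adj (adj X)} {X} {Y} {Y} (adj-adj X) ≋-refl) eq)))

  -- The equation x s = y forces s = x⁻¹ y, whose trace is ⟨ x , y ⟩. The twist by σ is moved into y
  -- beforehand.
  quotient-edge : ∀ (x y s : SL) → Member s → proj₁ x · proj₁ s ≋ proj₁ y →
    ⟨ proj₁ x , proj₁ y ⟩ ≈ 2# × ¬ proj₁ x ≋ proj₁ y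
  quotient-edge x@(X , det≈1) (Y , _) s@(N , _) s∈S eq = let tr≈2 , s≉𝟙 = member⇒ s s∈S in
    trans (sym (tr-adj· X Y)) (trans (tr-cong {adj X · Y} {N} (≋-sym {N} N≋)) tr≈2) ,
    λ X≋Y → s≉𝟙 (≋-trans {N} {adj X · Y} N≋ (≋-trans {adj X · Y} {adj X · X}
      (·-cong {adj X} {adj X} {Y} {X} ≋-refl (≋-sym {X} X≋Y)) (adj-inverseˡ {X} det≈1)))
    where
    N≋ : N ≋ adj X · Y
    N≋ = ≋-trans {N} {adj X · (X · N)} (≋-sym {adj X · (X · N)} (adj·-· X N det≈1))
      (·-cong {adj X} {adj X} {X · N} {Y} ≋-refl eq)

  quotient-member : ∀ (x y : SL) → ⟨ proj₁ x , proj₁ y ⟩ ≈ 2# → ¬ proj₁ x ≋ proj₁ y → Member (x ⁻¹ ×ᴳ y)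
  quotient-member x@(X , det≈1) y@(Y , _) eq neq =
    ⇒member (x ⁻¹ ×ᴳ y) (trans (tr-adj· X Y) eq) (neq ∘ adj·≋𝟙⇒≋ X Y det≈1)

  -- In the sum graphs x⁻¹ s = y forces s = x y, and its trace pairs x with the inverse of y: this
  -- is the source of the inversion in ψ.
  product-edge : ∀ (x y s : SL) → Member s → adj (proj₁ x) · proj₁ s ≋ proj₁ y →
    ⟨ proj₁ x , adj (proj₁ y) ⟩ ≈ 2# × ¬ proj₁ x ≋ adj (proj₁ y)
  product-edge x@(X , det≈1) (Y , det-Y) s@(N , _) s∈S eq = let tr≈2 , s≉𝟙 = member⇒ s s∈S in
    trans (sym (tr-· X Y)) (trans (tr-cong {X · Y} {N} (≋-sym {N} N≋)) tr≈2) ,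
    λ X≋adjY → s≉𝟙 (≋-trans {N} {X · Y} N≋ (≋-trans {X · Y} {adj Y · Y}
      (·-cong {X} {adj Y} {Y} {Y} X≋adjY ≋-refl) (adj-inverseˡ {Y} det-Y)))
    where
    N≋ : N ≋ X · Y
    N≋ = ≋-trans {N} {X · (adj X · N)} (≋-sym {X · (adj X · N)} (·-adj· X N det≈1))
      (·-cong {X} {X} {adj X · N} {Y} ≋-refl eq)

  product-member : ∀ (x y : SL) → ⟨ proj₁ x , adj (proj₁ y) ⟩ ≈ 2# → ¬ proj₁ x ≋ adj (proj₁ y) → Member (x ×ᴳ y)
  product-member x@(X , det≈1) y@(Y , _) eq neq =
    ⇒member (x ×ᴳ y) (trans (tr-· X Y) eq) (neq ∘ ·≋𝟙⇒≋adj X Y det≈1)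

  -- Closed forms of the conjugations by `w₊` and `w₋`. The second is an involution although the
  -- square of `w₋` is -𝟙, because -𝟙 is central.
  conj₊ conj₋ : Matrix → Matrix
  conj₊ (mat a b c d) = mat d c b a
  conj₋ (mat a b c d) = mat d (⊖ c) (⊖ b) a

  conj₊-cong : ∀ {M N} → M ≋ N → conj₊ M ≋ conj₊ N
  conj₊-cong (p , q , r , s) = s , r , q , p

  conj₋-cong : ∀ {M N} → M ≋ N → conj₋ M ≋ conj₋ N
  conj₋-cong (p , q , r , s) = s , -‿cong r , -‿cong q , p

  conj₊-isometric : ∀ M N → ⟨ conj₊ M , conj₊ N ⟩ ≈ ⟨ M , N ⟩
  conj₊-isometric (mat a b c d) (mat x y z w) = solve 8 (λ a b c d x y z w →
    (d :* x :+ a :* w) :- (c :* y :+ b :* z) := (a :* w :+ d :* x) :- (b :* z :+ c :* y)) ≈-refl a b c d x y z w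

  conj₋-isometric : ∀ M N → ⟨ conj₋ M , conj₋ N ⟩ ≈ ⟨ M , N ⟩
  conj₋-isometric (mat a b c d) (mat x y z w) = solve 8 (λ a b c d x y z w →
    (d :* x :+ a :* w) :- (:- c :* :- y :+ :- b :* :- z) := (a :* w :+ d :* x) :- (b :* z :+ c :* y))
    ≈-refl a b c d x y z w

  conj₋-involutive : ∀ M → conj₋ (conj₋ M) ≋ M
  conj₋-involutive (mat a b c d) = ≈-refl , double b , double c , ≈-refl
    where
    double : ∀ x → ⊖ ⊖ x ≈ x
    double = solve 1 (λ x → :- :- x := x) ≈-refl

  w₊-conjugate : ∀ M → GL₂.matrix w₊ · M · GL₂.inverse w₊ ≋ conj₊ M
  w₊-conjugate (mat a b c d) =
    solve 4 (λ a b c d → con (+ 0) :* (a :* con (+ 0) :+ b :* con (+ 1)) :+ con (+ 1) :* (c :* con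
        (+ 0) :+ d :* con (+ 1)) := d) ≈-refl a b c d ,
    solve 4 (λ a b c d → con (+ 0) :* (a :* con (+ 1) :+ b :* con (+ 0)) :+ con (+ 1) :* (c :* con
        (+ 1) :+ d :* con (+ 0)) := c) ≈-refl a b c d ,
    solve 4 (λ a b c d → con (+ 1) :* (a :* con (+ 0) :+ b :* con (+ 1)) :+ con (+ 0) :* (c :* con
        (+ 0) :+ d :* con (+ 1)) := b) ≈-refl a b c d ,
    solve 4 (λ a b c d → con (+ 1) :* (a :* con (+ 1) :+ b :* con (+ 0)) :+ con (+ 0) :* (c :* con
        (+ 1) :+ d :* con (+ 0)) := a) ≈-refl a b c d

  w₋-conjugate : ∀ M → GL₂.matrix w₋ · M · GL₂.inverse w₋ ≋ conj₋ M
  w₋-conjugate (mat a b c d) =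
    solve 4 (λ a b c d → con (+ 0) :* (a :* con (+ 0) :+ b :* con (+ 1)) :+ con (+ 1) :* (c :* con
        (+ 0) :+ d :* con (+ 1)) := d) ≈-refl a b c d ,
    solve 4 (λ a b c d → con (+ 0) :* (a :* :- con (+ 1) :+ b :* con (+ 0)) :+ con (+ 1) :* (c :* :- con
        (+ 1) :+ d :* con (+ 0)) := :- c) ≈-refl a b c d ,
    solve 4 (λ a b c d → :- con (+ 1) :* (a :* con (+ 0) :+ b :* con (+ 1)) :+ con (+ 0) :* (c :* con
        (+ 0) :+ d :* con (+ 1)) := :- b) ≈-refl a b c d ,
    solve 4 (λ a b c d → :- con (+ 1) :* (a :* :- con (+ 1) :+ b :* con (+ 0)) :+ con (+ 0) :* (c :* :- con
        (+ 1) :+ d :* con (+ 0)) := a) ≈-refl a b c d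

  σ₊-conjugate : ∀ {σ} → σ ≡ SL₂-over.σ₊ F |F| → ∀ x → proj₁ (Automorphism.⟦_⟧ σ x) ≋ conj₊ (proj₁ x)
  σ₊-conjugate refl x = w₊-conjugate (proj₁ x)

  σ₋-conjugate : ∀ {σ} → σ ≡ SL₂-over.σ₋ F |F| → ∀ x → proj₁ (Automorphism.⟦_⟧ σ x) ≋ conj₋ (proj₁ x)
  σ₋-conjugate refl x = w₋-conjugate (proj₁ x)

  module _ (σ : Automorphism (Matrices.SL₂ (toCommutativeRing F))) (conj : Matrix → Matrix)
    (σ≋conj : ∀ x → proj₁ (Automorphism.⟦_⟧ σ x) ≋ conj (proj₁ x))
    (conj-cong : ∀ {M N} → M ≋ N → conj M ≋ conj N)
    (conj-involutive : ∀ M → conj (conj M) ≋ M)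
    (conj-isometric : ∀ M N → ⟨ conj M , conj N ⟩ ≈ ⟨ M , N ⟩) where
    open Automorphism σ
    open GroupMorphisms.IsGroupIsomorphism isGroupIsomorphism using (⟦⟧-cong)

    involutive : ∀ x → proj₁ ⟦ ⟦ x ⟧ ⟧ ≋ proj₁ x
    involutive x = ≋-trans {proj₁ ⟦ ⟦ x ⟧ ⟧} (σ≋conj ⟦ x ⟧)
      (≋-trans {conj (proj₁ ⟦ x ⟧)} {conj (conj (proj₁ x))} (conj-cong (σ≋conj x)) (conj-involutive (proj₁ x)))

    -- An isometric involution is self-adjoint, which is what makes the twisted relation symmetric.
    adjoint : ∀ M y → ⟨ M , proj₁ ⟦ y ⟧ ⟩ ≈ ⟨ conj M , proj₁ y ⟩
    adjoint M y = trans (⟨⟩-cong {M} {M} {proj₁ ⟦ y ⟧} {conj (proj₁ y)} ≋-refl (σ≋conj y))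
      (trans (sym (conj-isometric M (conj (proj₁ y))))
        (⟨⟩-cong {conj M} {conj M} {conj (conj (proj₁ y))} {proj₁ y} ≋-refl (conj-involutive (proj₁ y))))

    ⟨,σ⟩-sym : ∀ x y → ⟨ proj₁ x , proj₁ ⟦ y ⟧ ⟩ ≈ ⟨ proj₁ y , proj₁ ⟦ x ⟧ ⟩
    ⟨,σ⟩-sym x y = trans (adjoint (proj₁ x) y)
      (trans (⟨⟩-sym (conj (proj₁ x)) (proj₁ y))
        (⟨⟩-cong {proj₁ y} {proj₁ y} {conj (proj₁ x)} {proj₁ ⟦ x ⟧} ≋-refl (≋-sym {proj₁ ⟦ x ⟧} (σ≋conj x))))

    ⟨,σ⁻¹⟩-sym : (∀ M → conj (adj M) ≋ adj (conj M)) →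
      ∀ x y → ⟨ proj₁ x , adj (proj₁ ⟦ y ⟧) ⟩ ≈ ⟨ proj₁ y , adj (proj₁ ⟦ x ⟧) ⟩
    ⟨,σ⁻¹⟩-sym conj-adj x y = trans (⟨,adj⟩-sym (proj₁ x) (proj₁ ⟦ y ⟧))
      (trans (⟨⟩-sym (proj₁ ⟦ y ⟧) (adj (proj₁ x)))
      (trans (adjoint (adj (proj₁ x)) y)
      (trans (⟨⟩-sym (conj (adj (proj₁ x))) (proj₁ y))
        (⟨⟩-cong {proj₁ y} {proj₁ y} {conj (adj (proj₁ x))} {adj (proj₁ ⟦ x ⟧)} ≋-refl
          (≋-trans {conj (adj (proj₁ x))} (conj-adj (proj₁ x))
            (adj-cong {conj (proj₁ x)} {proj₁ ⟦ x ⟧} (≋-sym {proj₁ ⟦ x ⟧} (σ≋conj x))))))))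

    σ⁻¹-involutive : (∀ M → conj (adj M) ≋ adj (conj M)) → ∀ x → proj₁ (⟦ ⟦ x ⟧ ⁻¹ ⟧ ⁻¹) ≋ proj₁ x
    σ⁻¹-involutive conj-adj x = ≋-trans {adj (proj₁ ⟦ ⟦ x ⟧ ⁻¹ ⟧)} {adj (adj (proj₁ x))} {proj₁ x}
      (adj-cong {proj₁ ⟦ ⟦ x ⟧ ⁻¹ ⟧} {adj (proj₁ x)}
        (≋-trans {proj₁ ⟦ ⟦ x ⟧ ⁻¹ ⟧} {conj (adj (proj₁ ⟦ x ⟧))} {adj (proj₁ x)} (σ≋conj (⟦ x ⟧ ⁻¹))
          (≋-trans {conj (adj (proj₁ ⟦ x ⟧))} {adj (conj (proj₁ ⟦ x ⟧))} {adj (proj₁ x)} (conj-adj (proj₁ ⟦ x ⟧))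
            (adj-cong {conj (proj₁ ⟦ x ⟧)} {proj₁ x}
              (≋-trans {conj (proj₁ ⟦ x ⟧)} {proj₁ ⟦ ⟦ x ⟧ ⟧} {proj₁ x} (≋-sym {proj₁ ⟦ ⟦ x ⟧ ⟧} (σ≋conj ⟦ x ⟧))
                  (involutive x))))))
      (adj-adj (proj₁ x))

    swapˡ : ∀ z y → proj₁ ⟦ z ⟧ ≋ proj₁ y → proj₁ z ≋ proj₁ ⟦ y ⟧
    swapˡ z y eq = ≋-trans {proj₁ z} {proj₁ ⟦ ⟦ z ⟧ ⟧} {proj₁ ⟦ y ⟧} (≋-sym {proj₁ ⟦ ⟦ z ⟧ ⟧} (involutive z))
        (⟦⟧-cong {⟦ z ⟧} {y} eq)

    swapʳ : ∀ z y → proj₁ z ≋ proj₁ ⟦ y ⟧ → proj₁ ⟦ z ⟧ ≋ proj₁ y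
    swapʳ z y eq = ≋-trans {proj₁ ⟦ z ⟧} {proj₁ ⟦ ⟦ y ⟧ ⟧} {proj₁ y} (⟦⟧-cong {z} {⟦ y ⟧} eq) (involutive y)

    twisted-⟶⇒ : ∀ x y → FiniteGraph._⟶_ (twistedCayleyGraph (SL₂-over.G F |F|) (SL₂-over.S F |F|) σ) x y →
      ⟨ proj₁ x , proj₁ ⟦ y ⟧ ⟩ ≈ 2# × ¬ proj₁ x ≋ proj₁ ⟦ y ⟧
    twisted-⟶⇒ x y (s , s∈S , eq) = quotient-edge x ⟦ y ⟧ s s∈S (swapˡ _ y eq)

    twisted-⇒⟶ : ∀ x y → ⟨ proj₁ x , proj₁ ⟦ y ⟧ ⟩ ≈ 2# → ¬ proj₁ x ≋ proj₁ ⟦ y ⟧ →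
      FiniteGraph._⟶_ (twistedCayleyGraph (SL₂-over.G F |F|) (SL₂-over.S F |F|) σ) x y
    twisted-⇒⟶ x@(X , det≈1) y eq neq =
      x ⁻¹ ×ᴳ ⟦ y ⟧ , quotient-member x ⟦ y ⟧ eq neq , swapʳ _ y (·-adj· X (proj₁ ⟦ y ⟧) det≈1)

    twistedSum-⟶⇒ : ∀ x y → FiniteGraph._⟶_ (twistedCayleySumGraph (SL₂-over.G F |F|) (SL₂-over.S F |F|) σ) x y →
      ⟨ proj₁ x , adj (proj₁ ⟦ y ⟧) ⟩ ≈ 2# × ¬ proj₁ x ≋ adj (proj₁ ⟦ y ⟧)
    twistedSum-⟶⇒ x y (s , s∈S , eq) = product-edge x ⟦ y ⟧ s s∈S (swapˡ _ y eq)

    twistedSum-⇒⟶ : ∀ x y → ⟨ proj₁ x , adj (proj₁ ⟦ y ⟧) ⟩ ≈ 2# → ¬ proj₁ x ≋ adj (proj₁ ⟦ y ⟧) →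
      FiniteGraph._⟶_ (twistedCayleySumGraph (SL₂-over.G F |F|) (SL₂-over.S F |F|) σ) x y
    twistedSum-⇒⟶ x@(X , det≈1) y eq neq =
      x ×ᴳ ⟦ y ⟧ , product-member x ⟦ y ⟧ eq neq , swapʳ _ y (adj·-· X (proj₁ ⟦ y ⟧) det≈1)

    twisted-ramanujan : IsRamanujan (twistedCayleyGraph (SL₂-over.G F |F|) (SL₂-over.S F |F|) σ)
    twisted-ramanujan = RepresentedGraph.ramanujan F |F| q≡3 (twistedCayleyGraph (SL₂-over.G F |F|)
        (SL₂-over.S F |F|) σ)
      (Identity.inverse (Group.setoid (Matrices.SL₂ (toCommutativeRing F)))) ⟦_⟧
      (λ {x} {y} → ⟦⟧-cong {x} {y}) involutive ⟨,σ⟩-sym twisted-⟶⇒ twisted-⇒⟶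

    twistedSum-ramanujan : (∀ M → conj (adj M) ≋ adj (conj M)) → IsRamanujan (twistedCayleySumGraph
        (SL₂-over.G F |F|) (SL₂-over.S F |F|) σ)
    twistedSum-ramanujan conj-adj = RepresentedGraph.ramanujan F |F| q≡3 (twistedCayleySumGraph
        (SL₂-over.G F |F|) (SL₂-over.S F |F|) σ)
      (Identity.inverse (Group.setoid (Matrices.SL₂ (toCommutativeRing F)))) (λ y → ⟦ y ⟧ ⁻¹)
      (λ {x} {y} eq → adj-cong {proj₁ ⟦ x ⟧} {proj₁ ⟦ y ⟧} (⟦⟧-cong {x} {y} eq))
      (σ⁻¹-involutive conj-adj) (⟨,σ⁻¹⟩-sym conj-adj) twistedSum-⟶⇒ twistedSum-⇒⟶

  sum-⟶⇒ : ∀ x y → FiniteGraph._⟶_ (cayleySumGraph (SL₂-over.G F |F|) (SL₂-over.S F |F|)) x y →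
    ⟨ proj₁ x , adj (proj₁ y) ⟩ ≈ 2# × ¬ proj₁ x ≋ adj (proj₁ y)
  sum-⟶⇒ x y (s , s∈S , eq) = product-edge x y s s∈S eq

  sum-⇒⟶ : ∀ x y → ⟨ proj₁ x , adj (proj₁ y) ⟩ ≈ 2# → ¬ proj₁ x ≋ adj (proj₁ y) →
    FiniteGraph._⟶_ (cayleySumGraph (SL₂-over.G F |F|) (SL₂-over.S F |F|)) x y
  sum-⇒⟶ x@(X , det≈1) y eq neq = x ×ᴳ y , product-member x y eq neq , adj·-· X (proj₁ y) det≈1

  sum-ramanujan : IsRamanujan (cayleySumGraph (SL₂-over.G F |F|) (SL₂-over.S F |F|))
  sum-ramanujan = RepresentedGraph.ramanujan F |F| q≡3 (cayleySumGraph (SL₂-over.G F |F|) (SL₂-over.S F |F|))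
    (Identity.inverse (Group.setoid (Matrices.SL₂ (toCommutativeRing F)))) _⁻¹
    (λ {x} {y} → adj-cong {proj₁ x} {proj₁ y}) (λ x → adj-adj (proj₁ x)) (λ x y → ⟨,adj⟩-sym (proj₁ x) (proj₁ y))
    sum-⟶⇒ sum-⇒⟶

  conjugation₊-ramanujan : ∀ σ → σ ≡ SL₂-over.σ₊ F |F| →
    IsRamanujan (twistedCayleyGraph (SL₂-over.G F |F|) (SL₂-over.S F |F|) σ) × IsRamanujan
        (twistedCayleySumGraph (SL₂-over.G F |F|) (SL₂-over.S F |F|) σ)
  conjugation₊-ramanujan σ σ≡σ₊ =
    twisted-ramanujan σ conj₊ (σ₊-conjugate σ≡σ₊) (λ {M} {N} → conj₊-cong {M} {N}) (λ _ → ≋-refl) conj₊-isometric ,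
    twistedSum-ramanujan σ conj₊ (σ₊-conjugate σ≡σ₊) (λ {M} {N} → conj₊-cong {M} {N}) (λ _ → ≋-refl) conj₊-isometric
      (λ _ → ≋-refl)

  conjugation₋-ramanujan : ∀ σ → σ ≡ SL₂-over.σ₋ F |F| →
    IsRamanujan (twistedCayleyGraph (SL₂-over.G F |F|) (SL₂-over.S F |F|) σ) × IsRamanujan
        (twistedCayleySumGraph (SL₂-over.G F |F|) (SL₂-over.S F |F|) σ)
  conjugation₋-ramanujan σ σ≡σ₋ =
    twisted-ramanujan σ conj₋ (σ₋-conjugate σ≡σ₋) (λ {M} {N} → conj₋-cong {M} {N}) conj₋-involutive conj₋-isometric ,
    twistedSum-ramanujan σ conj₋ (σ₋-conjugate σ≡σ₋) (λ {M} {N} → conj₋-cong {M} {N}) conj₋-involutive conj₋-isometric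
      (λ _ → ≋-refl)

theorem5p3 : ∀ {c ℓ₁ ℓ₂} (q : ℕ) → IsPrimePower q → q % 4 ≡ 3 →
    (F : HeytingField c ℓ₁ ℓ₂) (|F| : HasOrder F q) →
    IsRamanujan (cayleySumGraph (SL₂-over.G F |F|) (SL₂-over.S F |F|)) ×
    (∀ σ → σ ≡ SL₂-over.σ₊ F |F| ⊎ σ ≡ SL₂-over.σ₋ F |F| →
    IsRamanujan (twistedCayleyGraph (SL₂-over.G F |F|) (SL₂-over.S F |F|) σ) ×
    IsRamanujan (twistedCayleySumGraph (SL₂-over.G F |F|) (SL₂-over.S F |F|) σ))
theorem5p3 q _ q≡3 F |F| = RamanujanGraphs.sum-ramanujan F |F| q≡3 , λ where
    σ (inj₁ σ≡σ₊) → RamanujanGraphs.conjugation₊-ramanujan F |F| q≡3 σ σ≡σ₊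
    σ (inj₂ σ≡σ₋) → RamanujanGraphs.conjugation₋-ramanujan F |F| q≡3 σ σ≡σ₋
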